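{- Let $k=k(n)$ and $m=m(n)$ be functions of $n$ such that $m\geq n$. (i) If $\liminf_{n\rightarrow\infty} \frac{k^2n}{m\log n}>1$, then asymptotically almost surely $G(n,m,k)$ is connected. (ii) If $\limsup_{n\rightarrow\infty} \frac{k^2n}{m\log n}<1$, then asymptotically almost surely $G(n,m,k)$ is not connected.
   Context: The uniform random intersection graph $G(n,m,k)$ (for positive integers $k\le m$) is the random graph on a set $V$ of $n$ nodes defined as follows: fix a set $M$ of $m$ colours; to each node $v\in V$ assign a subset $F_v\subseteq M$ of exactly $k$ distinct colours, chosen uniformly at random among all $k$-subsets of $M$, independently for different nodes; distinct nodes $u,v$ are joined by an edge if and only if $F_u\cap F_v\neq\emptyset$. An event holds asymptotically almost surely if its probability tends to $1$ as $n\rightarrow\infty$. Here $\log$ denotes the natural logarithm. -}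

module Defs where

open import Data.Nat.Base as ℕ using (ℕ; zero; suc; s≤s; z≤n)
import Data.Nat.Properties as ℕ
import Data.Integer.Base as ℤ
import Data.Integer.Properties as ℤ
open import Data.Rational.Base hiding (truncate)
open import Data.Rational.Properties
import Data.Rational.Unnormalised.Base as ℚᵘ
import Data.Rational.Unnormalised.Properties as ℚᵘ
open import Data.Rational.Solver using (module +-*-Solver)
open +-*-Solver using (_:=_; _:+_; _:-_; _:*_; :-_) renaming (solve to solveℚ)
open import Data.Fin.Base using (Fin)
import Data.Fin.Properties as Fin
open import Data.Fin.Subset using (Subset; inside; outside; Nonempty; _∩_)
  renaming (∣_∣ to card)
open import Data.Fin.Subset.Properties using (nonempty?)
open import Data.List.Base using (List; []; _∷_; [_]; _++_; map; filter; length; cartesianProductWith; allFin)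
open import Data.List.Membership.Propositional using (_∈_)
open import Data.List.Membership.Propositional.Properties using (∈-allFin)
open import Data.List.Relation.Unary.Any using (here; there)
open import Data.Vec.Base as Vec using (Vec; lookup)
open import Data.Product.Base using (∃-syntax; _×_; _,_; proj₁; proj₂)
open import Data.Sum.Base using (_⊎_; inj₁; inj₂; [_,_]′)
open import Function.Base using (id)
open import Level using (0ℓ)
open import Relation.Binary.Core using (Rel)
open import Relation.Binary.Definitions using () renaming (Decidable to Decidable₂)
open import Relation.Binary.Construct.Closure.ReflexiveTransitive using (Star; _◅_; _◅◅_) renaming (ε to stop)
open import Relation.Binary.PropositionalEquality hiding ([_])
open import Relation.Nullary.Decidable using (yes; no; map′; ¬?; _×-dec_; _⊎-dec_)
open import Relation.Nullary.Negation using (contradiction)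
open import Relation.Unary using (Pred; Decidable)

subsets : ∀ m → List (Subset m)
subsets zero    = [ Vec.[] ]
subsets (suc m) = map (inside Vec.∷_) (subsets m) ++ map (outside Vec.∷_) (subsets m)

kSubsets : ∀ m k → List (Subset m)
kSubsets m k = filter (λ p → card p ℕ.≟ k) (subsets m)

tuples : ∀ {A : Set} n → List A → List (Vec A n)
tuples zero    xs = [ Vec.[] ]
tuples (suc n) xs = cartesianProductWith Vec._∷_ xs (tuples n xs)

-- Choosing F v uniformly among the k-subsets, independently for each node v, is
-- the same as choosing F uniformly in this duplicate-free list.
assignments : ∀ n m k → List (Vec (Subset m) n)
assignments n m k = tuples n (kSubsets m k)

-- The case b = 0 does not arise below: assignments n m k is nonempty when k ≤ m.
proportion : ℕ → ℕ → ℚ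
proportion a zero      = 0ℚ
proportion a b@(suc _) = ℤ.+ a / b

-- The probability that P holds for a uniformly random entry of the list.
Pr : ∀ {A : Set} (P : Pred A 0ℓ) → Decidable P → List A → ℚ
Pr P P? xs = proportion (length (filter P? xs)) (length xs)

Adjacent : ∀ {n m} → Vec (Subset m) n → Rel (Fin n) 0ℓ
Adjacent F u v = u ≢ v × Nonempty (lookup F u ∩ lookup F v)

adjacent? : ∀ {n m} (F : Vec (Subset m) n) → Decidable₂ (Adjacent F)
adjacent? F u v = ¬? (u Fin.≟ v) ×-dec nonempty? (lookup F u ∩ lookup F v)

Connected : ∀ {n m} → Pred (Vec (Subset m) n) 0ℓ
Connected F = ∀ u v → Star (Adjacent F) u v

-- Reachability is decided by Warshall's algorithm: `Via ws u v` says that v is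
-- reached from u by a path all of whose inner nodes lie in ws.
module Warshall {n} {_~_ : Rel (Fin n) 0ℓ} (_~?_ : Decidable₂ _~_) where

  Via : List (Fin n) → Rel (Fin n) 0ℓ
  Via []       u v = u ≡ v ⊎ u ~ v
  Via (w ∷ ws) u v = Via ws u v ⊎ Via ws u w × Via ws w v

  via? : ∀ ws → Decidable₂ (Via ws)
  via? []       u v = (u Fin.≟ v) ⊎-dec (u ~? v)
  via? (w ∷ ws) u v = via? ws u v ⊎-dec (via? ws u w ×-dec via? ws w v)

  fromBase : ∀ ws {u v} → Via [] u v → Via ws u v
  fromBase []       p = p
  fromBase (w ∷ ws) p = inj₁ (fromBase ws p)

  compose : ∀ ws {u w v} → w ∈ ws → Via ws u w → Via ws w v → Via ws u v
  compose (w ∷ ws) (here refl) p q = inj₂ ([ id , proj₁ ]′ p , [ id , proj₂ ]′ q)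
  compose (_ ∷ ws) (there i) (inj₁ p)         (inj₁ q)         = inj₁ (compose ws i p q)
  compose (_ ∷ ws) (there i) (inj₁ p)         (inj₂ (q₁ , q₂)) = inj₂ (compose ws i p q₁ , q₂)
  compose (_ ∷ ws) (there i) (inj₂ (p₁ , p₂)) (inj₁ q)         = inj₂ (p₁ , compose ws i p₂ q)
  compose (_ ∷ ws) (there i) (inj₂ (p₁ , _))  (inj₂ (_ , q₂))  = inj₂ (p₁ , q₂)

  sound : ∀ ws {u v} → Via ws u v → Star _~_ u v
  sound []       (inj₁ refl)    = stop
  sound []       (inj₂ e)       = e ◅ stop
  sound (w ∷ ws) (inj₁ p)       = sound ws p
  sound (w ∷ ws) (inj₂ (p , q)) = sound ws p ◅◅ sound ws q

  complete : ∀ {u v} → Star _~_ u v → Via (allFin n) u v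
  complete stop    = fromBase (allFin n) (inj₁ refl)
  complete (e ◅ p) = compose (allFin n) (∈-allFin _) (fromBase (allFin n) (inj₂ e)) (complete p)

  star? : Decidable₂ (Star _~_)
  star? u v = map′ (sound (allFin n)) complete (via? (allFin n) u v)

connected? : ∀ {n m} → Decidable (Connected {n} {m})
connected? F = Fin.all? λ u → Fin.all? λ v → Warshall.star? (adjacent? F) u v

infix 4 _⟶_

_⟶_ : (ℕ → ℚ) → ℚ → Set
p ⟶ ℓ = ∀ ε → 0ℚ < ε → ∃[ N ] ∀ n → N ℕ.≤ n → ∣ p n - ℓ ∣ < ε

AAS : (k m : ℕ → ℕ) (P : ∀ {n m} → Pred (Vec (Subset m) n) 0ℓ) →
      (∀ {n m} → Decidable (P {n} {m})) → Set
AAS k m P P? = (λ n → Pr P P? (assignments n (m n) (k n))) ⟶ 1ℚ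

Cauchy : (ℕ → ℚ) → Set
Cauchy x = ∀ ε → 0ℚ < ε → ∃[ N ] ∀ i j → N ℕ.≤ i → N ℕ.≤ j → ∣ x i - x j ∣ < ε

-- Equality is convergence of the difference to 0, not _≡_; nothing below depends
-- on the choice of representative.
record ℝ : Set where
  constructor mkℝ
  field
    seq    : ℕ → ℚ
    cauchy : Cauchy seq

open ℝ public

infix  4 _≤ᴿ_ _<inf_ sup_<_ _<liminf_ limsup_<_
infixl 7 _·_ _÷ᴿ_

_≤ᴿ_ : Rel ℝ 0ℓ
x ≤ᴿ y = ∀ ε → 0ℚ < ε → ∃[ N ] ∀ j → N ℕ.≤ j → seq x j ≤ seq y j + ε

Positiveᴿ : Pred ℝ 0ℓ
Positiveᴿ x = ∃[ δ ] 0ℚ < δ × ∃[ N ] ∀ j → N ℕ.≤ j → δ ≤ seq x j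

module RationalLemmas where
  p-p≡0 : ∀ p → p - p ≡ 0ℚ
  p-p≡0 = +-inverseʳ

  0≤q-p : ∀ {p q} → p ≤ q → 0ℚ ≤ q - p
  0≤q-p {p} {q} p≤q = subst (_≤ q - p) (p-p≡0 p) (+-monoˡ-≤ (- p) p≤q)

  ∣p-q∣≡∣q-p∣ : ∀ p q → ∣ p - q ∣ ≡ ∣ q - p ∣
  ∣p-q∣≡∣q-p∣ p q = trans (cong ∣_∣ (solveℚ 2 (λ p q → p :- q := :- (q :- p)) refl p q))
                          (∣-p∣≡∣p∣ (q - p))

  *-pos : ∀ {p q} → 0ℚ < p → 0ℚ < q → 0ℚ < p * q
  *-pos {p} {q} 0<p 0<q =
    positive⁻¹ (p * q) {{pos*pos⇒pos p {{positive 0<p}} q {{positive 0<q}}}}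

  *-mono-nonNeg : ∀ {p q r s} → 0ℚ ≤ p → 0ℚ ≤ s → p ≤ q → r ≤ s → p * r ≤ q * s
  *-mono-nonNeg {p} {q} {r} {s} 0≤p 0≤s p≤q r≤s = ≤-trans
    (*-monoˡ-≤-nonNeg p {{nonNegative 0≤p}} r≤s)
    (*-monoʳ-≤-nonNeg s {{nonNegative 0≤s}} p≤q)

open RationalLemmas

const : ℚ → ℝ
const q = mkℝ (λ _ → q) λ ε 0<ε → 0 , λ _ _ _ _ → subst (λ d → ∣ d ∣ < ε) (sym (p-p≡0 q)) 0<ε

_·_ : ℚ → ℝ → ℝ
c · mkℝ x x-cauchy = mkℝ (λ j → c * x j) scaled
  where
  c⁺ = ∣ c ∣ + 1ℚ
  0<c⁺ : 0ℚ < c⁺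
  0<c⁺ = +-mono-≤-< (0≤∣p∣ c) (positive⁻¹ 1ℚ)
  instance
    c⁺-pos : Positive c⁺
    c⁺-pos = positive 0<c⁺
    c⁺-nz : NonZero c⁺
    c⁺-nz = pos⇒nonZero c⁺

  scaled : Cauchy (λ j → c * x j)
  scaled ε 0<ε with x-cauchy (1/ c⁺ * ε) (*-pos (positive⁻¹ (1/ c⁺) {{1/pos⇒pos c⁺}}) 0<ε)
  ... | N , close = N , λ i j N≤i N≤j → begin-strict
    ∣ c * x i - c * x j ∣   ≡⟨ cong ∣_∣ (solveℚ 3 (λ c a b → c :* a :- c :* b := c :* (a :- b)) refl c (x i) (x j)) ⟩
    ∣ c * (x i - x j) ∣     ≡⟨ ∣p*q∣≡∣p∣*∣q∣ c (x i - x j) ⟩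
    ∣ c ∣ * ∣ x i - x j ∣   ≤⟨ *-monoʳ-≤-nonNeg ∣ x i - x j ∣ {{∣-∣-nonNeg (x i - x j)}}
                                 (subst (_≤ c⁺) (+-identityʳ ∣ c ∣) (+-monoʳ-≤ ∣ c ∣ (<⇒≤ (positive⁻¹ 1ℚ)))) ⟩
    c⁺ * ∣ x i - x j ∣      <⟨ *-monoʳ-<-pos c⁺ (close i j N≤i N≤j) ⟩
    c⁺ * (1/ c⁺ * ε)        ≡⟨ *-assoc c⁺ (1/ c⁺) ε ⟨
    c⁺ * 1/ c⁺ * ε          ≡⟨ cong (_* ε) (*-inverseʳ c⁺) ⟩
    1ℚ * ε                  ≡⟨ *-identityˡ ε ⟩
    ε                       ∎
    where open ≤-Reasoning

recip : ℚ → ℚ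
recip q with q ≟ 0ℚ
... | yes _  = 0ℚ
... | no q≢0 = (1/ q) {{≢-nonZero q≢0}}

module RecipLemmas where
  *-recip : ∀ q → 0ℚ < q → q * recip q ≡ 1ℚ
  *-recip q 0<q with q ≟ 0ℚ
  ... | yes q≡0 = contradiction (sym q≡0) (<⇒≢ 0<q)
  ... | no q≢0  = *-inverseʳ q {{≢-nonZero q≢0}}

open RecipLemmas

-- As y is positive, its terms are eventually nonzero, so the value of recip at 0
-- does not affect the quotient.
_÷ᴿ_ : (c : ℚ) (y : ℝ) → {{Positiveᴿ y}} → ℝ
(c ÷ᴿ mkℝ y y-cauchy) {{δ , 0<δ , N₀ , δ≤y}} = c · mkℝ (λ j → recip (y j)) inverted
  where
  inverted : Cauchy (λ j → recip (y j))
  inverted ε 0<ε with y-cauchy (ε * (δ * δ)) (*-pos 0<ε (*-pos 0<δ 0<δ))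
  ... | N , close = N₀ ℕ.⊔ N , λ i j i≥ j≥ →
    let δ≤yi = δ≤y i (ℕ.≤-trans (ℕ.m≤m⊔n N₀ N) i≥)
        δ≤yj = δ≤y j (ℕ.≤-trans (ℕ.m≤m⊔n N₀ N) j≥)
        0<yi = <-≤-trans 0<δ δ≤yi
        0<yj = <-≤-trans 0<δ δ≤yj
        a = y i ; b = y j ; a′ = recip a ; b′ = recip b
        0<ab = *-pos 0<yi 0<yj
    in *-cancelʳ-<-nonNeg (a * b) {{nonNegative (<⇒≤ 0<ab)}} (begin-strict
      ∣ a′ - b′ ∣ * (a * b)            ≡⟨ cong (∣ a′ - b′ ∣ *_) (0≤p⇒∣p∣≡p (<⇒≤ 0<ab)) ⟨
      ∣ a′ - b′ ∣ * ∣ a * b ∣          ≡⟨ ∣p*q∣≡∣p∣*∣q∣ (a′ - b′) (a * b) ⟨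
      ∣ (a′ - b′) * (a * b) ∣          ≡⟨ cong ∣_∣ (solveℚ 4 (λ a b a′ b′ → (a′ :- b′) :* (a :* b) := (a :* a′) :* b :- (b :* b′) :* a) refl a b a′ b′) ⟩
      ∣ (a * a′) * b - (b * b′) * a ∣  ≡⟨ cong₂ (λ s t → ∣ s * b - t * a ∣) (*-recip a 0<yi) (*-recip b 0<yj) ⟩
      ∣ 1ℚ * b - 1ℚ * a ∣              ≡⟨ cong₂ (λ s t → ∣ s - t ∣) (*-identityˡ b) (*-identityˡ a) ⟩
      ∣ b - a ∣                        ≡⟨ ∣p-q∣≡∣q-p∣ b a ⟩
      ∣ a - b ∣                        <⟨ close i j (ℕ.≤-trans (ℕ.m≤n⊔m N₀ N) i≥) (ℕ.≤-trans (ℕ.m≤n⊔m N₀ N) j≥) ⟩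
      ε * (δ * δ)                      ≤⟨ *-monoˡ-≤-nonNeg ε {{nonNegative (<⇒≤ 0<ε)}} (*-mono-nonNeg (<⇒≤ 0<δ) (<⇒≤ 0<yj) δ≤yi δ≤yj) ⟩
      ε * (a * b)                      ∎)
    where open ≤-Reasoning

-- inf and liminf are extended reals given by their lower rational cuts, sup and
-- limsup by their upper ones.
_<inf_ : ℚ → (ℕ → ℝ) → Set
q <inf x = ∃[ r ] q < r × (∀ n → const r ≤ᴿ x n)

sup_<_ : (ℕ → ℝ) → ℚ → Set
sup x < q = ∃[ r ] r < q × (∀ n → x n ≤ᴿ const r)

-- lim inf x = sup over N of inf over n ≥ N of x n
_<liminf_ : ℚ → (ℕ → ℝ) → Set
q <liminf x = ∃[ N ] q <inf (λ j → x (N ℕ.+ j))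

-- lim sup x = inf over N of sup over n ≥ N of x n
limsup_<_ : (ℕ → ℝ) → ℚ → Set
limsup x < q = ∃[ N ] sup (λ j → x (N ℕ.+ j)) < q

fromℕ : ℕ → ℚ
fromℕ n = ℤ.+ n / 1

-- 1/(a+1) + … + 1/(a+c)
harmonic : ℕ → ℕ → ℚ
harmonic a zero    = 0ℚ
harmonic a (suc c) = ℤ.+ 1 / suc a + harmonic (suc a) c

-- The Riemann sum of ∫₁ⁿ dt/t at the right end points of the subintervals, of
-- which there are N per unit length: the i-th term is
-- (1/N) · 1/(1 + i/N) = 1/(N + i), for 1 ≤ i ≤ (n - 1) N.
logSum : (n N : ℕ) → ℚ
logSum n N = harmonic N (ℕ.pred n ℕ.* N)

module HarmonicLemmas where
  1/suc : ℕ → ℚ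
  1/suc a = ℤ.+ 1 / suc a

  0<1/suc : ∀ a → 0ℚ < 1/suc a
  0<1/suc a = positive⁻¹ (1/suc a) {{normalize-pos 1 (suc a)}}

  1/suc-anti : ∀ {a b} → a ℕ.≤ b → 1/suc b ≤ 1/suc a
  1/suc-anti {a} {b} a≤b = toℚᵘ-cancel-≤ (begin
    toℚᵘ (1/suc b)     ≃⟨ toℚᵘ-fromℚᵘ (ℚᵘ.mkℚᵘ (ℤ.+ 1) b) ⟩
    ℚᵘ.mkℚᵘ (ℤ.+ 1) b  ≤⟨ ℚᵘ.*≤* (ℤ.*-monoˡ-≤-nonNeg (ℤ.+ 1) (ℤ.+≤+ (s≤s a≤b))) ⟩
    ℚᵘ.mkℚᵘ (ℤ.+ 1) a  ≃⟨ toℚᵘ-fromℚᵘ (ℚᵘ.mkℚᵘ (ℤ.+ 1) a) ⟨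
    toℚᵘ (1/suc a)     ∎)
    where open ℚᵘ.≤-Reasoning

  fromℕ-suc : ∀ n → fromℕ (suc n) ≡ 1ℚ + fromℕ n
  fromℕ-suc n = toℚᵘ-injective (begin-equality
    toℚᵘ (fromℕ (suc n))             ≃⟨ toℚᵘ-fromℚᵘ (ℚᵘ.mkℚᵘ (ℤ.+ suc n) 0) ⟩
    ℚᵘ.mkℚᵘ (ℤ.+ suc n) 0            ≃⟨ ℚᵘ.*≡* (cong (λ z → (ℤ.+ 1 ℤ.+ z) ℤ.* ℤ.+ 1) (sym (ℤ.*-identityʳ (ℤ.+ n)))) ⟩
    ℚᵘ.1ℚᵘ ℚᵘ.+ ℚᵘ.mkℚᵘ (ℤ.+ n) 0    ≃⟨ ℚᵘ.+-congʳ ℚᵘ.1ℚᵘ (toℚᵘ-fromℚᵘ (ℚᵘ.mkℚᵘ (ℤ.+ n) 0)) ⟨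
    ℚᵘ.1ℚᵘ ℚᵘ.+ toℚᵘ (fromℕ n)       ≃⟨ toℚᵘ-homo-+ 1ℚ (fromℕ n) ⟨
    toℚᵘ (1ℚ + fromℕ n)              ∎)
    where open ℚᵘ.≤-Reasoning

  fromℕ-suc-* : ∀ n q → fromℕ (suc n) * q ≡ q + fromℕ n * q
  fromℕ-suc-* n q = trans (cong (_* q) (fromℕ-suc n))
    (trans (*-distribʳ-+ q 1ℚ (fromℕ n)) (cong (_+ fromℕ n * q) (*-identityˡ q)))

  fromℕ-*-1/suc : ∀ p j → fromℕ (suc p) * 1/suc (p ℕ.+ j ℕ.* suc p) ≡ 1/suc j
  fromℕ-*-1/suc p j = toℚᵘ-injective (begin-equality
    toℚᵘ (fromℕ (suc p) * 1/suc X)                 ≃⟨ toℚᵘ-homo-* (fromℕ (suc p)) (1/suc X) ⟩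
    toℚᵘ (fromℕ (suc p)) ℚᵘ.* toℚᵘ (1/suc X)       ≃⟨ ℚᵘ.*-cong (toℚᵘ-fromℚᵘ (ℚᵘ.mkℚᵘ (ℤ.+ suc p) 0)) (toℚᵘ-fromℚᵘ (ℚᵘ.mkℚᵘ (ℤ.+ 1) X)) ⟩
    ℚᵘ.mkℚᵘ (ℤ.+ suc p) 0 ℚᵘ.* ℚᵘ.mkℚᵘ (ℤ.+ 1) X   ≃⟨ ℚᵘ.*≡* (cong ℤ.+_ eq) ⟩
    ℚᵘ.mkℚᵘ (ℤ.+ 1) j                              ≃⟨ toℚᵘ-fromℚᵘ (ℚᵘ.mkℚᵘ (ℤ.+ 1) j) ⟨
    toℚᵘ (1/suc j)                                 ∎)
    where
    open ℚᵘ.≤-Reasoning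
    X = p ℕ.+ j ℕ.* suc p
    eq : suc p ℕ.* 1 ℕ.* suc j ≡ 1 ℕ.* (1 ℕ.* suc X)
    eq = trans (cong (ℕ._* suc j) (ℕ.*-identityʳ (suc p)))
        (trans (ℕ.*-comm (suc p) (suc j))
        (sym (trans (ℕ.*-identityˡ _) (ℕ.*-identityˡ _))))

  harmonic-+ : ∀ a c d → harmonic a (c ℕ.+ d) ≡ harmonic a c + harmonic (a ℕ.+ c) d
  harmonic-+ a zero    d rewrite ℕ.+-identityʳ a = sym (+-identityˡ (harmonic a d))
  harmonic-+ a (suc c) d rewrite ℕ.+-suc a c =
    trans (cong (1/suc a +_) (harmonic-+ (suc a) c d)) (sym (+-assoc (1/suc a) _ _))

  harmonic-upper : ∀ {b} a c → b ℕ.≤ a → harmonic a c ≤ fromℕ c * 1/suc b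
  harmonic-upper {b} a zero    b≤a = ≤-reflexive (sym (*-zeroˡ (1/suc b)))
  harmonic-upper {b} a (suc c) b≤a = subst (harmonic a (suc c) ≤_) (sym (fromℕ-suc-* c (1/suc b)))
    (+-mono-≤ (1/suc-anti b≤a) (harmonic-upper (suc a) c (ℕ.m≤n⇒m≤1+n b≤a)))

  harmonic-lower : ∀ {b} a c → a ℕ.+ c ℕ.≤ suc b → fromℕ c * 1/suc b ≤ harmonic a c
  harmonic-lower {b} a zero    h = ≤-reflexive (*-zeroˡ (1/suc b))
  harmonic-lower {b} a (suc c) h = subst (_≤ harmonic a (suc c)) (sym (fromℕ-suc-* c (1/suc b)))
    (+-mono-≤ (1/suc-anti (ℕ.≤-trans (ℕ.m≤m+n a c) (ℕ.s≤s⁻¹ h′))) (harmonic-lower (suc a) c h′))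
    where h′ = subst (ℕ._≤ suc b) (ℕ.+-suc a c) h

  logSum-step : ∀ p N → logSum (suc p) (suc N) + 1/suc N
                      ≡ logSum (suc p) N + harmonic (suc p ℕ.* N) (suc p)
  logSum-step p N = begin
    harmonic (suc N) (p ℕ.* suc N) + 1/suc N             ≡⟨ +-comm _ (1/suc N) ⟩
    harmonic N (suc (p ℕ.* suc N))                       ≡⟨ cong (harmonic N) eq ⟩
    harmonic N (p ℕ.* N ℕ.+ suc p)                       ≡⟨ harmonic-+ N (p ℕ.* N) (suc p) ⟩
    harmonic N (p ℕ.* N) + harmonic (suc p ℕ.* N) (suc p) ∎
    where
    open ≡-Reasoning
    eq : suc (p ℕ.* suc N) ≡ p ℕ.* N ℕ.+ suc p
    eq = trans (cong suc (trans (ℕ.*-suc p N) (ℕ.+-comm p (p ℕ.* N)))) (sym (ℕ.+-suc (p ℕ.* N) p))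

  module _ (p : ℕ) where
    A : ℕ → ℚ
    A j = logSum (suc p) (suc j)

    A-increasing : ∀ j → A j ≤ A (suc j)
    A-increasing j = +-cancelʳ-≤ (1/suc N) (begin
      A j + 1/suc N                                   ≡⟨ cong (A j +_) (fromℕ-*-1/suc p N) ⟨
      A j + fromℕ (suc p) * 1/suc (p ℕ.+ N ℕ.* suc p) ≤⟨ +-monoʳ-≤ (A j) (harmonic-lower (suc p ℕ.* N) (suc p) (ℕ.≤-reflexive eq)) ⟩
      A j + harmonic (suc p ℕ.* N) (suc p)            ≡⟨ logSum-step p N ⟨
      A (suc j) + 1/suc N                             ∎)
      where
      open ≤-Reasoning
      N = suc j
      eq : suc p ℕ.* N ℕ.+ suc p ≡ suc p ℕ.+ N ℕ.* suc p
      eq = trans (ℕ.+-comm (suc p ℕ.* N) (suc p)) (cong (suc p ℕ.+_) (ℕ.*-comm (suc p) N))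
      +-cancelʳ-≤ : ∀ r {s t} → s + r ≤ t + r → s ≤ t
      +-cancelʳ-≤ r {s} {t} h = subst₂ _≤_ (cancel s) (cancel t) (+-monoˡ-≤ (- r) h)
        where
        cancel : ∀ s → s + r - r ≡ s
        cancel s = trans (+-assoc s r (- r)) (trans (cong (s +_) (+-inverseʳ r)) (+-identityʳ s))

    A+1/suc-decreasing : ∀ j → A (suc j) + 1/suc (suc j) ≤ A j + 1/suc j
    A+1/suc-decreasing j = begin
      A (suc j) + 1/suc (suc j)                       ≡⟨ logSum-step p (suc j) ⟩
      A j + harmonic (suc p ℕ.* suc j) (suc p)        ≤⟨ +-monoʳ-≤ (A j) (harmonic-upper (suc p ℕ.* suc j) (suc p) le) ⟩
      A j + fromℕ (suc p) * 1/suc (p ℕ.+ j ℕ.* suc p) ≡⟨ cong (A j +_) (fromℕ-*-1/suc p j) ⟩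
      A j + 1/suc j                                   ∎
      where
      open ≤-Reasoning
      le : p ℕ.+ j ℕ.* suc p ℕ.≤ suc p ℕ.* suc j
      le = ℕ.≤-trans (ℕ.n≤1+n _) (ℕ.≤-reflexive (ℕ.*-comm (suc j) (suc p)))

    A-mono : ∀ i d → A i ≤ A (d ℕ.+ i)
    A-mono i zero    = ≤-refl
    A-mono i (suc d) = ≤-trans (A-mono i d) (A-increasing (d ℕ.+ i))

    A+1/suc-anti : ∀ i d → A (d ℕ.+ i) + 1/suc (d ℕ.+ i) ≤ A i + 1/suc i
    A+1/suc-anti i zero    = ≤-refl
    A+1/suc-anti i (suc d) = ≤-trans (A+1/suc-decreasing (d ℕ.+ i)) (A+1/suc-anti i d)

    A-close : ∀ {i j} → i ℕ.≤ j → ∣ A j - A i ∣ ≤ 1/suc i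
    A-close {i} {j} i≤j = subst (λ j → ∣ A j - A i ∣ ≤ 1/suc i) (ℕ.m∸n+n≡m i≤j) (begin
      ∣ A j′ - A i ∣        ≡⟨ 0≤p⇒∣p∣≡p (0≤q-p (A-mono i d)) ⟩
      A j′ - A i            ≡⟨ cong (_- A i) (+-identityʳ (A j′)) ⟨
      A j′ + 0ℚ - A i       ≤⟨ +-monoˡ-≤ (- A i) (≤-trans (+-monoʳ-≤ (A j′) (<⇒≤ (0<1/suc j′))) (A+1/suc-anti i d)) ⟩
      A i + 1/suc i - A i   ≡⟨ solveℚ 2 (λ a u → a :+ u :- a := u) refl (A i) (1/suc i) ⟩
      1/suc i               ∎)
      where
      open ≤-Reasoning
      d  = j ℕ.∸ i
      j′ = d ℕ.+ i

  archimedean : ∀ ε → 0ℚ < ε → ∃[ N ] 1/suc N < ε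
  archimedean ε@(mkℚ _ d _) 0<ε = suc d , toℚᵘ-cancel-< (begin-strict
    toℚᵘ (1/suc (suc d))      ≃⟨ toℚᵘ-fromℚᵘ (ℚᵘ.mkℚᵘ (ℤ.+ 1) (suc d)) ⟩
    ℚᵘ.mkℚᵘ (ℤ.+ 1) (suc d)   <⟨ ℚᵘ.*<* (ℤ.*-monoˡ-<-pos (ℤ.+ 1) (ℤ.+<+ (ℕ.n<1+n (suc d)))) ⟩
    ℚᵘ.mkℚᵘ (ℤ.+ 1) d         ≤⟨ ℚᵘ.*≤* (ℤ.*-monoʳ-≤-nonNeg (ℤ.+ suc d) (ℤ.i<j⇒suc[i]≤j (ℤ.positive⁻¹ (↥ ε) {{positive 0<ε}}))) ⟩
    toℚᵘ ε                    ∎)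
    where open ℚᵘ.≤-Reasoning

  logSum-cauchy : ∀ p → Cauchy (A p)
  logSum-cauchy p ε 0<ε with archimedean ε 0<ε
  ... | N , 1/N<ε = N , close
    where
    close : ∀ i j → N ℕ.≤ i → N ℕ.≤ j → ∣ A p i - A p j ∣ < ε
    close i j N≤i N≤j with ℕ.≤-total i j
    ... | inj₁ i≤j = subst (_< ε) (∣p-q∣≡∣q-p∣ (A p j) (A p i))
                       (≤-<-trans (A-close p i≤j) (≤-<-trans (1/suc-anti N≤i) 1/N<ε))
    ... | inj₂ j≤i = ≤-<-trans (A-close p j≤i) (≤-<-trans (1/suc-anti N≤j) 1/N<ε)

open HarmonicLemmas

log : (n : ℕ) .{{_ : ℕ.NonZero n}} → ℝ
log n@(suc p) = mkℝ (λ j → logSum n (suc j)) (logSum-cauchy p)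

module PositivityLemmas where
  log-pos : ∀ n → Positiveᴿ (log (2 ℕ.+ n))
  log-pos n = ½ , positive⁻¹ ½ , 0 , λ j _ → ≤-trans ½≤A₀
    (subst (λ k → A (suc n) 0 ≤ A (suc n) k) (ℕ.+-identityʳ j) (A-mono (suc n) 0 j))
    where
    ½≤A₀ : ½ ≤ A (suc n) 0
    ½≤A₀ = subst (_≤ A (suc n) 0) (+-identityʳ ½) (+-monoʳ-≤ ½
      (≤-trans (≤-reflexive (sym (*-zeroʳ (fromℕ (n ℕ.* 1)))))
      (≤-trans (*-monoˡ-≤-nonNeg (fromℕ (n ℕ.* 1)) {{normalize-nonNeg (n ℕ.* 1) 1}}
                 (<⇒≤ (0<1/suc (1 ℕ.+ n ℕ.* 1))))
        (harmonic-lower 2 (n ℕ.* 1) ℕ.≤-refl))))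

  fromℕ-pos : ∀ {m} → 0 ℕ.< m → 0ℚ < fromℕ m
  fromℕ-pos {suc m} _ = positive⁻¹ (fromℕ (suc m)) {{normalize-pos (suc m) 1}}

  ·-pos : ∀ {c} x → 0ℚ < c → Positiveᴿ x → Positiveᴿ (c · x)
  ·-pos {c} _ 0<c (δ , 0<δ , N , δ≤x) = c * δ , *-pos 0<c 0<δ , N ,
    λ j N≤j → *-monoˡ-≤-nonNeg c {{nonNegative (<⇒≤ 0<c)}} (δ≤x j N≤j)

open PositivityLemmas

-- k²n / (m log n), for n = 2 + j; it is undefined at n = 1 because log 1 = 0.
ratio : (k m : ℕ → ℕ) → (∀ n → n ℕ.≤ m n) → ℕ → ℝ
ratio k m n≤m j = fromℕ (k n ℕ.* k n ℕ.* n) ÷ᴿ (fromℕ (m n) · log n)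
  where
  n = 2 ℕ.+ j
  instance
    denominator-pos : Positiveᴿ (fromℕ (m n) · log n)
    denominator-pos = ·-pos (log n) (fromℕ-pos (ℕ.≤-trans (s≤s z≤n) (n≤m n))) (log-pos j)

{-# OPTIONS --safe #-}

-- A disconnected graph has a set S of at most half of the nodes without an edge to the rest; take
-- the union bound over S. Either the colours of the s nodes of S lie in a w-set W, which has
-- probability at most C(m,w)(w/m)^(ks), or they are at least w many and the other n - s nodes all
-- avoid them, which has probability at most (1 - k/m)^(w(n-s)). As connectedness is monotone in k,
-- one may take k²n/m of order log n. Then w slightly below sk works when s is at most n divided by
-- exp(c√log n), and w = ε min(m, sk) for the other s ≤ n/2, because k is at least of order √log n.
-- Below the threshold the second moment method yields an isolated node.
-- All estimates are made for natural numbers. The only property of log that is used is that it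
-- lies between i/(K+1) and (i+1)/K when (1 + 1/K)^i ≤ n < (1 + 1/K)^(i+1).

module Submission where

open import Algebra.Bundles using (module CommutativeMonoid)
open import Data.Nat.Base
open import Data.Nat.Properties
open import Algebra.Properties.CommutativeSemigroup *-commutativeSemigroup
  using (interchange; x∙yz≈y∙xz; xy∙z≈xz∙y; xy∙z≈y∙xz; x∙yz≈yx∙z; xy∙z≈x∙zy)
open import Data.Nat.DivMod using (m≡m%n+[m/n]*n; m%n<n; m/n*n≤m)
open import Data.Nat.Tactic.RingSolver using (solve-∀)
open import Data.Bool.Base using (true; if_then_else_)
open import Data.Fin.Base using (Fin; zero; suc)
import Data.Fin.Properties as Fin
open import Data.Fin.Subset as Sub using (Subset; inside; outside; _∪_; _∩_; _⊆_; Nonempty; ⊥; _∉_) renaming (∣_∣ to card; ∁ to ∁ₛ)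
open import Data.Fin.Subset.Properties
open import Data.Vec.Base using (Vec; []; _∷_; here; there; lookup; tabulate)
open import Data.Vec.Properties using (lookup⇒[]=; []=⇒lookup; lookup∘tabulate)
open import Data.List.Base using (List; []; _∷_; _++_; map; filter; length; cartesianProductWith; downFrom; allFin)
import Data.List.Properties as List
import Data.List.Relation.Unary.Any as Any
open import Data.List.Membership.Propositional using (_∈_)
open import Data.List.Membership.Propositional.Properties
  using (∈-filter⁺; ∈-filter⁻; ∈-map⁺; ∈-++⁺ˡ; ∈-++⁺ʳ; ∈-downFrom⁺; ∈-cartesianProductWith⁻)
open import Data.Product.Base using (∃-syntax; _×_; _,_; proj₁; proj₂)
open import Data.Sum.Base using (_⊎_; inj₁; inj₂)
open import Function.Base using (_∘_; id)
open import Level using (0ℓ)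
import Relation.Binary.Construct.Closure.ReflexiveTransitive as Star
open Star using (Star; _◅_; _◅◅_) renaming (ε to stop)
open import Relation.Binary.PropositionalEquality hiding ([_])
open import Relation.Nullary.Decidable using (Dec; yes; no; does; ¬?; decidable-stable)
open import Relation.Nullary.Negation using (¬_; contradiction)
open import Relation.Unary using (Pred; Decidable; ∁)
open import Relation.Unary.Properties using (∁?)
open import Defs

-- Single nodes already decide the threshold. For small S the exponent w(n-s) may therefore lose
-- only a factor close to 1: just a fraction `1/Q` of the sk colours can be given up, where
-- `Q = suc K` and `K` depends on the excess `1 + 1/R` over the threshold. What then has to beat the
-- number of choices of S and W is a power of w/m with exponent about sk/Q. Let `g` stand for √log
-- n. Since k ≥ `g`, the bound n ≤ 2^(βg²) gives n ≤ 2^(βgk), so w/m ≤ 2^(-bg) is small enough for a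
-- suitable constant `b`. As k²n/m is of order g², this is the case when s ≤ n/2^(2bg). For larger s
-- the number of choices of S is at most (4n/s)^s, which is 2^(O(gs)) and no longer n^s; against an
-- exponent of order g² per node even a constant fraction `1/H` of the colours suffices, once `g` is
-- large compared with `H`. Sets of size s are given a further factor `(4 * D) ^ s`, which makes the
-- sum over s geometric and the total at most 1/D.

private variable
  𝒜 ℬ : Set
  m n k : ℕ

-- Finite sums and counting

∑ : List 𝒜 → (𝒜 → ℕ) → ℕ
∑ []       f = 0
∑ (x ∷ xs) f = f x + ∑ xs f

𝟙 : {P : Set} → Dec P → ℕ
𝟙 d = if does d then 1 else 0

𝟙-yes : {P : Set} (d : Dec P) → P → 𝟙 d ≡ 1
𝟙-yes (yes _) _ = refl
𝟙-yes (no ¬p) p = contradiction p ¬p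

∑-mono : ∀ (xs : List 𝒜) {f g : 𝒜 → ℕ} → (∀ x → x ∈ xs → f x ≤ g x) → ∑ xs f ≤ ∑ xs g
∑-mono []       h = z≤n
∑-mono (x ∷ xs) h = +-mono-≤ (h x (Any.here refl)) (∑-mono xs λ y y∈ → h y (Any.there y∈))

∑-cong : ∀ (xs : List 𝒜) {f g : 𝒜 → ℕ} → (∀ x → x ∈ xs → f x ≡ g x) → ∑ xs f ≡ ∑ xs g
∑-cong []       h = refl
∑-cong (x ∷ xs) h = cong₂ _+_ (h x (Any.here refl)) (∑-cong xs λ y y∈ → h y (Any.there y∈))

∑-++ : ∀ (xs ys : List 𝒜) f → ∑ (xs ++ ys) f ≡ ∑ xs f + ∑ ys f
∑-++ []       ys f = refl
∑-++ (x ∷ xs) ys f = trans (cong (f x +_) (∑-++ xs ys f)) (sym (+-assoc (f x) _ _))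

∑-map : ∀ (h : 𝒜 → ℬ) xs f → ∑ (map h xs) f ≡ ∑ xs (f ∘ h)
∑-map h []       f = refl
∑-map h (x ∷ xs) f = cong (f (h x) +_) (∑-map h xs f)

∑-+ : ∀ (xs : List 𝒜) f g → ∑ xs (λ x → f x + g x) ≡ ∑ xs f + ∑ xs g
∑-+ []       f g = refl
∑-+ (x ∷ xs) f g rewrite ∑-+ xs f g = lemma (f x) (g x) (∑ xs f) (∑ xs g)
  where
  lemma : ∀ a b c d → (a + b) + (c + d) ≡ (a + c) + (b + d)
  lemma = solve-∀

∑-*ˡ : ∀ (xs : List 𝒜) c f → ∑ xs (λ x → c * f x) ≡ c * ∑ xs f
∑-*ˡ []       c f = sym (*-zeroʳ c)
∑-*ˡ (x ∷ xs) c f = trans (cong (c * f x +_) (∑-*ˡ xs c f)) (sym (*-distribˡ-+ c (f x) _))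

∑-*ʳ : ∀ (xs : List 𝒜) c f → ∑ xs (λ x → f x * c) ≡ ∑ xs f * c
∑-*ʳ []       c f = refl
∑-*ʳ (x ∷ xs) c f = trans (cong (f x * c +_) (∑-*ʳ xs c f)) (sym (*-distribʳ-+ c (f x) _))

∑-const : ∀ (xs : List 𝒜) c → ∑ xs (λ _ → c) ≡ length xs * c
∑-const []       c = refl
∑-const (x ∷ xs) c = cong (c +_) (∑-const xs c)

∑-zero : ∀ (xs : List 𝒜) → ∑ xs (λ _ → 0) ≡ 0
∑-zero xs = trans (∑-const xs 0) (*-zeroʳ (length xs))

∑-swap : ∀ (xs : List 𝒜) (ys : List ℬ) (f : 𝒜 → ℬ → ℕ) →
         ∑ xs (λ x → ∑ ys (f x)) ≡ ∑ ys (λ y → ∑ xs λ x → f x y)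
∑-swap []       ys f = sym (∑-zero ys)
∑-swap (x ∷ xs) ys f = trans (cong (∑ ys (f x) +_) (∑-swap xs ys f))
  (sym (∑-+ ys (f x) (λ y → ∑ xs λ x → f x y)))

∑-∈ : ∀ {x : 𝒜} {xs} f → x ∈ xs → f x ≤ ∑ xs f
∑-∈ f (Any.here refl) = m≤m+n _ _
∑-∈ f (Any.there x∈)  = ≤-trans (∑-∈ f x∈) (m≤n+m _ _)

∑-filter : ∀ {P : Pred 𝒜 0ℓ} (P? : Decidable P) xs f →
           ∑ (filter P? xs) f ≡ ∑ xs (λ x → 𝟙 (P? x) * f x)
∑-filter P? []       f = refl
∑-filter P? (x ∷ xs) f with P? x
... | yes _ = cong₂ _+_ (sym (+-identityʳ (f x))) (∑-filter P? xs f)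
... | no _  = ∑-filter P? xs f

length-filter : ∀ {P : Pred 𝒜 0ℓ} (P? : Decidable P) xs → length (filter P? xs) ≡ ∑ xs (𝟙 ∘ P?)
length-filter P? []       = refl
length-filter P? (x ∷ xs) with P? x
... | yes _ = cong suc (length-filter P? xs)
... | no _  = length-filter P? xs

length-filter-≤ : ∀ {P : Pred 𝒜 0ℓ} (P? : Decidable P) xs {f : 𝒜 → ℕ} →
                  (∀ x → x ∈ xs → P x → 1 ≤ f x) → length (filter P? xs) ≤ ∑ xs f
length-filter-≤ P? []       h = z≤n
length-filter-≤ P? (x ∷ xs) h with P? x
... | yes p = +-mono-≤ (h x (Any.here refl) p) (length-filter-≤ P? xs λ y y∈ → h y (Any.there y∈))
... | no _  = m≤n⇒m≤o+n _ (length-filter-≤ P? xs λ y y∈ → h y (Any.there y∈))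

∑-tuples : ∀ n (xs : List 𝒜) (f : Vec 𝒜 (suc n) → ℕ) →
           ∑ (tuples (suc n) xs) f ≡ ∑ xs (λ x → ∑ (tuples n xs) λ F → f (x ∷ F))
∑-tuples n xs f = go xs
  where
  go : ∀ ys → ∑ (cartesianProductWith _∷_ ys (tuples n xs)) f ≡ ∑ ys (λ x → ∑ (tuples n xs) λ F → f (x ∷ F))
  go []       = refl
  go (y ∷ ys) = trans (∑-++ (map (y ∷_) (tuples n xs)) _ f)
                      (cong₂ _+_ (∑-map (y ∷_) (tuples n xs) f) (go ys))

∑-tuples′ : ∀ n (xs : List 𝒜) (f : Vec 𝒜 (suc n) → ℕ) →
            ∑ (tuples (suc n) xs) f ≡ ∑ (tuples n xs) (λ F → ∑ xs λ x → f (x ∷ F))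
∑-tuples′ n xs f = trans (∑-tuples n xs f) (∑-swap xs (tuples n xs) _)

length≡∑ : ∀ (xs : List 𝒜) → length xs ≡ ∑ xs (λ _ → 1)
length≡∑ xs = sym (trans (∑-const xs 1) (*-identityʳ _))

length-tuples : ∀ n (xs : List 𝒜) → length (tuples n xs) ≡ length xs ^ n
length-tuples zero    xs = refl
length-tuples (suc n) xs = trans (length≡∑ (tuples (suc n) xs)) (trans (∑-tuples n xs _)
  (trans (∑-cong xs λ _ _ → sym (length≡∑ (tuples n xs)))
  (trans (∑-const xs _) (cong (length xs *_) (length-tuples n xs)))))

-- Pascal's recursion replaces the filtered list `kSubsets`, so that counting goes by the same
-- induction as `binom`.
∑ₖ : (m k : ℕ) → (Subset m → ℕ) → ℕ
∑ₖ zero    zero    f = f []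
∑ₖ zero    (suc k) f = 0
∑ₖ (suc m) zero    f = ∑ₖ m zero (f ∘ (outside ∷_))
∑ₖ (suc m) (suc k) f = ∑ₖ m k (f ∘ (inside ∷_)) + ∑ₖ m (suc k) (f ∘ (outside ∷_))

∑-kSubsets : ∀ m k f → ∑ (kSubsets m k) f ≡ ∑ₖ m k f
∑-kSubsets m k f = trans (∑-filter _ (subsets m) f) (go m k f)
  where
  g : ∀ m k → (Subset m → ℕ) → Subset m → ℕ
  g m k f p = 𝟙 (card p ≟ k) * f p
  go : ∀ m k f → ∑ (subsets m) (g m k f) ≡ ∑ₖ m k f
  go zero    zero    f = trans (+-identityʳ _) (+-identityʳ _)
  go zero    (suc k) f = refl
  go (suc m) k f with trans (∑-++ (map (inside ∷_) (subsets m)) (map (outside ∷_) (subsets m)) (g (suc m) k f))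
                       (cong₂ _+_ (∑-map (inside ∷_) (subsets m) (g (suc m) k f)) (∑-map (outside ∷_) (subsets m) (g (suc m) k f)))
  go (suc m) zero    f | eq = trans eq (cong₂ _+_ (∑-zero (subsets m)) (go m zero (f ∘ (outside ∷_))))
  go (suc m) (suc k) f | eq = trans eq (cong₂ _+_ (go m k (f ∘ (inside ∷_))) (go m (suc k) (f ∘ (outside ∷_))))

binom : ℕ → ℕ → ℕ
binom n       zero    = 1
binom zero    (suc k) = 0
binom (suc n) (suc k) = binom n k + binom n (suc k)

∑ₖ-zero : ∀ m k → ∑ₖ m k (λ _ → 0) ≡ 0
∑ₖ-zero zero    zero    = refl
∑ₖ-zero zero    (suc k) = refl
∑ₖ-zero (suc m) zero    = ∑ₖ-zero m zero
∑ₖ-zero (suc m) (suc k) = cong₂ _+_ (∑ₖ-zero m k) (∑ₖ-zero m (suc k))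

∑ₖ-⊆ : ∀ m k (W : Subset m) → ∑ₖ m k (λ p → 𝟙 (p ⊆? W)) ≡ binom (card W) k
∑ₖ-⊆ zero    zero    []            = refl
∑ₖ-⊆ zero    (suc k) []            = refl
∑ₖ-⊆ (suc m) zero    (inside ∷ W)  = ∑ₖ-⊆ m zero W
∑ₖ-⊆ (suc m) zero    (outside ∷ W) = ∑ₖ-⊆ m zero W
∑ₖ-⊆ (suc m) (suc k) (inside ∷ W)  = cong₂ _+_ (∑ₖ-⊆ m k W) (∑ₖ-⊆ m (suc k) W)
∑ₖ-⊆ (suc m) (suc k) (outside ∷ W) = cong₂ _+_ (∑ₖ-zero m k) (∑ₖ-⊆ m (suc k) W)

∑ₖ-one : ∀ m k → ∑ₖ m k (λ _ → 1) ≡ binom m k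
∑ₖ-one zero    zero    = refl
∑ₖ-one zero    (suc k) = refl
∑ₖ-one (suc m) zero    = ∑ₖ-one m zero
∑ₖ-one (suc m) (suc k) = cong₂ _+_ (∑ₖ-one m k) (∑ₖ-one m (suc k))

length-kSubsets : ∀ m k → length (kSubsets m k) ≡ binom m k
length-kSubsets m k = trans (length≡∑ (kSubsets m k)) (trans (∑-kSubsets m k _) (∑ₖ-one m k))

count-⊆ : ∀ {m} k (W : Subset m) → ∑ (kSubsets m k) (λ p → 𝟙 (p ⊆? W)) ≡ binom (card W) k
count-⊆ {m} k W = trans (∑-kSubsets m k _) (∑ₖ-⊆ m k W)

count-⊆∁ : ∀ {m} k (W : Subset m) → ∑ (kSubsets m k) (λ p → 𝟙 (p ⊆? ∁ₛ W)) ≡ binom (m ∸ card W) k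
count-⊆∁ k W = trans (count-⊆ k (∁ₛ W)) (cong (λ c → binom c k) (∣∁p∣≡n∸∣p∣ W))

length-assignments : ∀ n m k → length (assignments n m k) ≡ binom m k ^ n
length-assignments n m k = trans (length-tuples n (kSubsets m k)) (cong (_^ n) (length-kSubsets m k))

-- Binomial coefficients and powers

-- The additive form of (k+1) C(n,k+1) = (n-k) C(n,k): without truncated subtraction it holds for
-- all `k` and survives the induction by Pascal's rule.
binom-step : ∀ n k → suc k * binom n (suc k) + k * binom n k ≡ n * binom n k
binom-step zero    zero    = refl
binom-step zero    (suc k) = cong₂ _+_ (*-zeroʳ k) (*-zeroʳ k)
binom-step (suc n) zero    = trans (lemma (binom n 1)) (cong suc (trans (binom-step n 0) refl))
  where
  lemma : ∀ x → 1 * (1 + x) + 0 ≡ suc (1 * x + 0)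
  lemma = solve-∀
binom-step (suc n) (suc k) = begin
  suc (suc k) * (b + c) + suc k * (a + b)                       ≡⟨ lemma k a b c ⟩
  (suc (suc k) * c + suc k * b) + (suc k * b + k * a) + (a + b) ≡⟨ cong₂ (λ x y → x + y + (a + b)) (binom-step n (suc k)) (binom-step n k) ⟩
  n * b + n * a + (a + b)                                       ≡⟨ lemma′ n a b ⟩
  suc n * (a + b)                                               ∎
  where
  open ≡-Reasoning
  a = binom n k
  b = binom n (suc k)
  c = binom n (suc (suc k))
  lemma : ∀ k a b c → suc (suc k) * (b + c) + suc k * (a + b) ≡ (suc (suc k) * c + suc k * b) + (suc k * b + k * a) + (a + b)
  lemma = solve-∀
  lemma′ : ∀ n a b → n * b + n * a + (a + b) ≡ suc n * (a + b)
  lemma′ = solve-∀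

binom-suc-right : ∀ n k → suc k * binom n (suc k) ≡ (n ∸ k) * binom n k
binom-suc-right n k = begin
  suc k * binom n (suc k)                                   ≡⟨ m+n∸n≡m _ (k * binom n k) ⟨
  suc k * binom n (suc k) + k * binom n k ∸ k * binom n k   ≡⟨ cong (_∸ k * binom n k) (binom-step n k) ⟩
  n * binom n k ∸ k * binom n k                             ≡⟨ *-distribʳ-∸ (binom n k) n k ⟨
  (n ∸ k) * binom n k                                       ∎
  where open ≡-Reasoning

binom-suc-left : ∀ c k → suc c * binom c k ≡ (suc c ∸ k) * binom (suc c) k
binom-suc-left c zero    = refl
binom-suc-left c (suc j) with ≤-total j c
... | inj₁ j≤c = sym (begin
  (c ∸ j) * (binom c j + b)           ≡⟨ *-distribˡ-+ (c ∸ j) _ b ⟩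
  (c ∸ j) * binom c j + (c ∸ j) * b   ≡⟨ cong (_+ (c ∸ j) * b) (binom-suc-right c j) ⟨
  suc j * b + (c ∸ j) * b             ≡⟨ *-distribʳ-+ b (suc j) (c ∸ j) ⟨
  suc (j + (c ∸ j)) * b               ≡⟨ cong (λ x → suc x * b) (m+[n∸m]≡n j≤c) ⟩
  suc c * b                           ∎)
  where
  open ≡-Reasoning
  b = binom c (suc j)
... | inj₂ c≤j rewrite m≤n⇒m∸n≡0 c≤j =
  trans (cong (suc c *_) (*-cancelˡ-≡ (binom c (suc j)) 0 (suc j)
    (trans (binom-suc-right c j) (trans (cong (_* binom c j) (m≤n⇒m∸n≡0 c≤j)) (sym (*-zeroʳ (suc j))))))) (*-zeroʳ (suc c))

1≤binom : ∀ {n k} → k ≤ n → 1 ≤ binom n k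
1≤binom {n}     {zero}  _         = ≤-refl
1≤binom {suc n} {suc k} (s≤s k≤n) = m≤n⇒m≤n+o _ (1≤binom k≤n)

∸-cross : ∀ {w m} k → w ≤ m → (w ∸ k) * m ≤ (m ∸ k) * w
∸-cross {w} {m} k w≤m = begin
  (w ∸ k) * m     ≡⟨ *-distribʳ-∸ m w k ⟩
  w * m ∸ k * m   ≤⟨ ∸-monoʳ-≤ (w * m) (*-monoʳ-≤ k w≤m) ⟩
  w * m ∸ k * w   ≡⟨ cong (_∸ k * w) (*-comm w m) ⟩
  m * w ∸ k * w   ≡⟨ *-distribʳ-∸ w m k ⟨
  (m ∸ k) * w     ∎
  where open ≤-Reasoning

-- C(w,k)/C(m,k) is the product of the (w-j)/(m-j) with j < k, and each of them is at most w/m by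
-- `∸-cross`.
binom-ratio-≤ : ∀ {w m} → w ≤ m → ∀ k → binom w k * m ^ k ≤ binom m k * w ^ k
binom-ratio-≤ w≤m zero = ≤-refl
binom-ratio-≤ {w} {m} w≤m (suc k) = *-cancelˡ-≤ (suc k) (begin
  suc k * (binom w (suc k) * m ^ suc k)  ≡⟨ *-assoc (suc k) (binom w (suc k)) (m ^ suc k) ⟨
  suc k * binom w (suc k) * m ^ suc k    ≡⟨ cong (_* m ^ suc k) (binom-suc-right w k) ⟩
  (w ∸ k) * binom w k * (m * m ^ k)      ≡⟨ interchange (w ∸ k) _ m _ ⟩
  (w ∸ k) * m * (binom w k * m ^ k)      ≤⟨ *-mono-≤ (∸-cross k w≤m) (binom-ratio-≤ w≤m k) ⟩
  (m ∸ k) * w * (binom m k * w ^ k)      ≡⟨ interchange (m ∸ k) w _ _ ⟩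
  (m ∸ k) * binom m k * (w * w ^ k)      ≡⟨ cong (_* w ^ suc k) (binom-suc-right m k) ⟨
  suc k * binom m (suc k) * w ^ suc k    ≡⟨ *-assoc (suc k) (binom m (suc k)) (w ^ suc k) ⟩
  suc k * (binom m (suc k) * w ^ suc k)  ∎)
  where open ≤-Reasoning

-- C(m-w,k)/C(m,k) as a product over the `w` excluded colours: its factors are (x-k)/x with m-w < x
-- ≤ m, each at most (m-k)/m.
binom-avoid-≤ : ∀ m k w → w ≤ m → binom (m ∸ w) k * m ^ w ≤ binom m k * (m ∸ k) ^ w
binom-avoid-≤ m k zero    _   = ≤-refl
binom-avoid-≤ m k (suc w) w<m = *-cancelˡ-≤ (suc c) (begin
  suc c * (binom c k * m ^ suc w)                  ≡⟨ *-assoc (suc c) (binom c k) (m ^ suc w) ⟨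
  suc c * binom c k * m ^ suc w                    ≡⟨ cong (_* m ^ suc w) (binom-suc-left c k) ⟩
  (suc c ∸ k) * binom (suc c) k * (m * m ^ w)      ≡⟨ interchange (suc c ∸ k) _ m _ ⟩
  (suc c ∸ k) * m * (binom (suc c) k * m ^ w)      ≤⟨ *-mono-≤ (∸-cross k sc≤m) (subst (λ x → binom x k * m ^ w ≤ binom m k * (m ∸ k) ^ w) (sym sc≡) (binom-avoid-≤ m k w (<⇒≤ w<m))) ⟩
  (m ∸ k) * suc c * (binom m k * (m ∸ k) ^ w)      ≡⟨ lemma (m ∸ k) (suc c) (binom m k) _ ⟩
  suc c * (binom m k * ((m ∸ k) * (m ∸ k) ^ w))    ∎)
  where
  open ≤-Reasoning
  c = m ∸ suc w
  sc≡ : suc c ≡ m ∸ w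
  sc≡ = sym (+-∸-assoc 1 w<m)
  sc≤m : suc c ≤ m
  sc≤m = ≤-trans (≤-reflexive sc≡) (m∸n≤m m w)
  lemma : ∀ a b c d → (a * b) * (c * d) ≡ b * (c * (a * d))
  lemma = solve-∀

-- With m = 2k + c the factors of C(m-k,j)/C(m,j) are (m-k-i)/(m-i). They decrease in i and are
-- (m-2k)/(m-k) at i = k. The argument `j′` encodes j ≤ k and names the difference k - j.
binom-avoid-≥ : ∀ k c j j′ → j + j′ ≡ k → binom (k + (k + c)) j * c ^ j ≤ binom (k + c) j * (k + c) ^ j
binom-avoid-≥ k c zero    j′ eq = ≤-refl
binom-avoid-≥ k c (suc j) j′ eq = *-cancelˡ-≤ (suc j) (begin
  suc j * (binom M (suc j) * c ^ suc j)    ≡⟨ *-assoc (suc j) (binom M (suc j)) (c ^ suc j) ⟨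
  suc j * binom M (suc j) * c ^ suc j      ≡⟨ cong (_* c ^ suc j) (binom-suc-right M j) ⟩
  (M ∸ j) * binom M j * (c * c ^ j)        ≡⟨ interchange (M ∸ j) _ c _ ⟩
  (M ∸ j) * c * (binom M j * c ^ j)        ≤⟨ *-mono-≤ cross (binom-avoid-≥ k c j (suc j′) eq′) ⟩
  (N ∸ j) * N * (binom N j * N ^ j)        ≡⟨ interchange (N ∸ j) N _ _ ⟩
  (N ∸ j) * binom N j * (N * N ^ j)        ≡⟨ cong (_* N ^ suc j) (binom-suc-right N j) ⟨
  suc j * binom N (suc j) * N ^ suc j      ≡⟨ *-assoc (suc j) (binom N (suc j)) (N ^ suc j) ⟩
  suc j * (binom N (suc j) * N ^ suc j)    ∎)
  where
  open ≤-Reasoning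
  N = k + c
  M = k + N
  eq′ : j + suc j′ ≡ k
  eq′ = trans (+-suc j j′) eq
  sub : ∀ x → (k + x) ∸ j ≡ suc j′ + x
  sub x = trans (cong (_∸ j) (trans (cong (_+ x) (sym eq′)) (+-assoc j _ x))) (m+n∸m≡n j _)
  cross : (M ∸ j) * c ≤ (N ∸ j) * N
  cross rewrite sub N | sub c = ≤-trans (m≤m+n _ (suc j′ * k)) (≤-reflexive (lemma (suc j′) k c))
    where
    lemma : ∀ a k c → (a + (k + c)) * c + a * k ≡ (a + c) * (k + c)
    lemma = solve-∀

-- Factor by factor a(a+2k) ≤ (a+k)². With m = 2k + c and j = k, avoiding two disjoint k-sets is at
-- most as likely as avoiding one of them in two independent trials; this bounds the correlation of
-- isolated nodes.
binom-log-concave : ∀ c k j → binom c j * binom (k + (k + c)) j ≤ binom (k + c) j * binom (k + c) j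
binom-log-concave c k zero    = ≤-refl
binom-log-concave c k (suc j) = *-cancelˡ-≤ (suc j * suc j) (begin
  suc j * suc j * (binom c (suc j) * binom M (suc j))      ≡⟨ interchange (suc j) (suc j) (binom c (suc j)) (binom M (suc j)) ⟩
  suc j * binom c (suc j) * (suc j * binom M (suc j))      ≡⟨ cong₂ _*_ (binom-suc-right c j) (binom-suc-right M j) ⟩
  (c ∸ j) * binom c j * ((M ∸ j) * binom M j)              ≡⟨ interchange (c ∸ j) _ _ _ ⟩
  (c ∸ j) * (M ∸ j) * (binom c j * binom M j)              ≤⟨ *-mono-≤ cross (binom-log-concave c k j) ⟩
  (N ∸ j) * (N ∸ j) * (binom N j * binom N j)              ≡⟨ interchange (N ∸ j) _ _ _ ⟩
  (N ∸ j) * binom N j * ((N ∸ j) * binom N j)              ≡⟨ cong₂ _*_ (binom-suc-right N j) (binom-suc-right N j) ⟨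
  suc j * binom N (suc j) * (suc j * binom N (suc j))      ≡⟨ interchange (suc j) (binom N (suc j)) (suc j) (binom N (suc j)) ⟩
  suc j * suc j * (binom N (suc j) * binom N (suc j))      ∎)
  where
  open ≤-Reasoning
  N = k + c
  M = k + N
  cross : (c ∸ j) * (M ∸ j) ≤ (N ∸ j) * (N ∸ j)
  cross with ≤-total j c
  ... | inj₁ j≤c rewrite +-∸-assoc k j≤c | +-∸-assoc k (m≤n⇒m≤o+n k j≤c) | +-∸-assoc k j≤c =
    ≤-trans (m≤m+n _ (k * k)) (≤-reflexive (lemma (c ∸ j) k))
    where
    lemma : ∀ a k → a * (k + (k + a)) + k * k ≡ (k + a) * (k + a)
    lemma = solve-∀
  ... | inj₂ c≤j rewrite m≤n⇒m∸n≡0 c≤j = z≤n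

-- With m = a + k these say (1 - k/m)^L (1 + Lk/m) ≤ 1 and (1 - k/m)^L ≥ 1 - Lk/m.
bernoulli⁺ : ∀ a k L → a ^ L * (a + k + L * k) ≤ (a + k) ^ L * (a + k)
bernoulli⁺ a k zero    = ≤-reflexive (cong (_+ 0) (+-identityʳ (a + k)))
bernoulli⁺ a k (suc L) = begin
  a * a ^ L * (a + k + (k + L * k))       ≤⟨ m≤m+n _ (a ^ L * (k * (k + L * k))) ⟩
  a * a ^ L * (a + k + (k + L * k)) + a ^ L * (k * (k + L * k)) ≡⟨ lemma a k L (a ^ L) ⟩
  (a + k) * (a ^ L * (a + k + L * k))     ≤⟨ *-monoʳ-≤ (a + k) (bernoulli⁺ a k L) ⟩
  (a + k) * ((a + k) ^ L * (a + k))       ≡⟨ *-assoc (a + k) _ _ ⟨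
  (a + k) * (a + k) ^ L * (a + k)         ∎
  where
  open ≤-Reasoning
  lemma : ∀ a k L p → a * p * (a + k + (k + L * k)) + p * (k * (k + L * k)) ≡ (a + k) * (p * (a + k + L * k))
  lemma = solve-∀

bernoulli⁻ : ∀ a k L → (a + k) ^ L * (a + k) ≤ a ^ L * (a + k) + L * k * (a + k) ^ L
bernoulli⁻ a k zero    = m≤m+n _ _
bernoulli⁻ a k (suc L) = begin
  (a + k) * (a + k) ^ L * (a + k)                              ≡⟨ *-assoc (a + k) _ _ ⟩
  (a + k) * ((a + k) ^ L * (a + k))                            ≤⟨ *-monoʳ-≤ (a + k) (bernoulli⁻ a k L) ⟩
  (a + k) * (a ^ L * (a + k) + L * k * (a + k) ^ L)            ≡⟨ lemma a k L (a ^ L) ((a + k) ^ L) ⟩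
  a * a ^ L * (a + k) + k * (a + k) * a ^ L + L * k * ((a + k) * (a + k) ^ L) ≤⟨ +-monoˡ-≤ (L * k * ((a + k) * (a + k) ^ L)) (+-monoʳ-≤ (a * a ^ L * (a + k)) (*-monoʳ-≤ (k * (a + k)) (^-monoˡ-≤ L (m≤m+n a k)))) ⟩
  a * a ^ L * (a + k) + k * (a + k) * (a + k) ^ L + L * k * ((a + k) * (a + k) ^ L) ≡⟨ lemma′ a k L (a ^ L) ((a + k) ^ L) ⟩
  a * a ^ L * (a + k) + (k + L * k) * ((a + k) * (a + k) ^ L)  ∎
  where
  open ≤-Reasoning
  lemma : ∀ a k L p q → (a + k) * (p * (a + k) + L * k * q) ≡ a * p * (a + k) + k * (a + k) * p + L * k * ((a + k) * q)
  lemma = solve-∀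
  lemma′ : ∀ a k L p q → a * p * (a + k) + k * (a + k) * q + L * k * ((a + k) * q) ≡ a * p * (a + k) + (k + L * k) * ((a + k) * q)
  lemma′ = solve-∀

^-distribʳ-* : ∀ n a b → (a * b) ^ n ≡ a ^ n * b ^ n
^-distribʳ-* zero    a b = refl
^-distribʳ-* (suc n) a b = trans (cong (a * b *_) (^-distribʳ-* n a b)) (interchange a b (a ^ n) (b ^ n))

^-pos : ∀ {a} n → 1 ≤ a → 1 ≤ a ^ n
^-pos {a} n 1≤a = m^n>0 a {{>-nonZero 1≤a}} n

^-monoʳ : ∀ {a m n} → 1 ≤ a → m ≤ n → a ^ m ≤ a ^ n
^-monoʳ {a} 1≤a = ^-monoʳ-≤ a {{>-nonZero 1≤a}}

cancelˡ : ∀ {a b} c → 1 ≤ c → c * a ≤ c * b → a ≤ b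
cancelˡ c 1≤c = *-cancelˡ-≤ c {{>-nonZero 1≤c}}

cancelʳ : ∀ {a b} c → 1 ≤ c → a * c ≤ b * c → a ≤ b
cancelʳ c 1≤c = *-cancelʳ-≤ _ _ c {{>-nonZero 1≤c}}

-- (1 + 1/s)(1 - 1/2s)² ≤ 1, and (1 - 1/2s)^s ≥ 1/2 by Bernoulli
[1+1/s]^s≤4 : ∀ s → suc s ^ s ≤ 4 * s ^ s
[1+1/s]^s≤4 zero    = s≤s z≤n
[1+1/s]^s≤4 s@(suc t) = cancelʳ ((2 * s) ^ s * (2 * s) ^ s) (*-mono-≤ pos pos) (begin
  suc s ^ s * ((2 * s) ^ s * (2 * s) ^ s)           ≤⟨ *-monoʳ-≤ (suc s ^ s) (*-mono-≤ half half) ⟩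
  suc s ^ s * ((2 * u ^ s) * (2 * u ^ s))           ≡⟨ lemma₁ (suc s ^ s) (u ^ s) ⟩
  4 * (suc s ^ s * (u ^ s * u ^ s))                 ≡⟨ cong (λ x → 4 * (suc s ^ s * x)) (^-distribʳ-* s u u) ⟨
  4 * (suc s ^ s * (u * u) ^ s)                     ≡⟨ cong (4 *_) (^-distribʳ-* s (suc s) (u * u)) ⟨
  4 * (suc s * (u * u)) ^ s                         ≤⟨ *-monoʳ-≤ 4 (^-monoˡ-≤ s base) ⟩
  4 * (s * (2 * s * (2 * s))) ^ s                   ≡⟨ cong (4 *_) (^-distribʳ-* s s (2 * s * (2 * s))) ⟩
  4 * (s ^ s * (2 * s * (2 * s)) ^ s)               ≡⟨ cong (λ x → 4 * (s ^ s * x)) (^-distribʳ-* s (2 * s) (2 * s)) ⟩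
  4 * (s ^ s * ((2 * s) ^ s * (2 * s) ^ s))         ≡⟨ *-assoc 4 (s ^ s) _ ⟨
  4 * s ^ s * ((2 * s) ^ s * (2 * s) ^ s)           ∎)
  where
  open ≤-Reasoning
  u = 2 * t + 1
  u+1≡2s : u + 1 ≡ 2 * s
  u+1≡2s = lemma t
    where
    lemma : ∀ t → 2 * t + 1 + 1 ≡ 2 * suc t
    lemma = solve-∀
  pos : 1 ≤ (2 * s) ^ s
  pos = ^-pos s (s≤s z≤n)
  half : (2 * s) ^ s ≤ 2 * u ^ s
  half = *-cancelˡ-≤ s (+-cancelʳ-≤ _ _ _ (begin
    s * (2 * s) ^ s + s * 1 * (2 * s) ^ s  ≡⟨ lemma s ((2 * s) ^ s) ⟩
    (2 * s) ^ s * (2 * s)                  ≤⟨ subst (λ x → x ^ s * x ≤ u ^ s * x + s * 1 * x ^ s) u+1≡2s (bernoulli⁻ u 1 s) ⟩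
    u ^ s * (2 * s) + s * 1 * (2 * s) ^ s  ≡⟨ cong (_+ s * 1 * (2 * s) ^ s) (lemma′ s (u ^ s)) ⟩
    s * (2 * u ^ s) + s * 1 * (2 * s) ^ s  ∎))
    where
    lemma : ∀ s p → s * p + s * 1 * p ≡ p * (2 * s)
    lemma = solve-∀
    lemma′ : ∀ s p → p * (2 * s) ≡ s * (2 * p)
    lemma′ = solve-∀
  base : suc s * (u * u) ≤ s * (2 * s * (2 * s))
  base = ≤-trans (m≤m+n _ (3 * t + 2)) (≤-reflexive (lemma t))
    where
    lemma : ∀ t → suc (suc t) * ((2 * t + 1) * (2 * t + 1)) + (3 * t + 2) ≡ suc t * (2 * suc t * (2 * suc t))
    lemma = solve-∀
  lemma₁ : ∀ a b → a * ((2 * b) * (2 * b)) ≡ 4 * (a * (b * b))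
  lemma₁ = solve-∀

-- The bound (en/s)^s with 4 in place of e: from s to s + 1 the power s^s gains the factor (s+1)(1 +
-- 1/s)^s.
binom-upper : ∀ n s → binom n s * s ^ s ≤ (4 * n) ^ s
binom-upper n zero    = ≤-refl
binom-upper n (suc s) = begin
  binom n (suc s) * (suc s * suc s ^ s)   ≡⟨ x∙yz≈yx∙z (binom n (suc s)) (suc s) _ ⟩
  suc s * binom n (suc s) * suc s ^ s     ≤⟨ *-monoˡ-≤ _ (≤-trans (≤-reflexive (binom-suc-right n s)) (*-monoˡ-≤ _ (m∸n≤m n s))) ⟩
  n * binom n s * suc s ^ s               ≤⟨ *-monoʳ-≤ (n * binom n s) ([1+1/s]^s≤4 s) ⟩
  n * binom n s * (4 * s ^ s)             ≡⟨ lemma₂ n (binom n s) (s ^ s) ⟩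
  4 * n * (binom n s * s ^ s)             ≤⟨ *-monoʳ-≤ (4 * n) (binom-upper n s) ⟩
  4 * n * (4 * n) ^ s                     ∎
  where
  open ≤-Reasoning
  lemma₂ : ∀ n b p → n * b * (4 * p) ≡ 4 * n * (b * p)
  lemma₂ = solve-∀

binom≤n^s : ∀ n s → binom n s ≤ n ^ s
binom≤n^s n zero    = ≤-refl
binom≤n^s n (suc s) = begin
  binom n (suc s)          ≤⟨ m≤m+n _ _ ⟩
  suc s * binom n (suc s)  ≡⟨ binom-suc-right n s ⟩
  (n ∸ s) * binom n s      ≤⟨ *-mono-≤ (m∸n≤m n s) (binom≤n^s n s) ⟩
  n * n ^ s                ∎
  where open ≤-Reasoning

binom≤2^n : ∀ n s → binom n s ≤ 2 ^ n
binom≤2^n n       zero    = ^-pos n (s≤s z≤n)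
binom≤2^n zero    (suc s) = z≤n
binom≤2^n (suc n) (suc s) = +-mono-≤ (binom≤2^n n s) (m≤n⇒m≤n+o 0 (binom≤2^n n (suc s)))

-- Exponential decay of the powers of 1 - k/m

m<[1+m/n]*n : ∀ m n .{{_ : NonZero n}} → m < suc (m / n) * n
m<[1+m/n]*n m n = subst (_< suc (m / n) * n) (sym (m≡m%n+[m/n]*n m n)) (+-monoˡ-< (m / n * n) (m%n<n m n))

-- (1 - k/m)^M ≤ (1 + 1/K)^(-i) when M k/m exceeds i/K with some room for rounding:
-- group the M factors into i groups of L = ⌈m/kK⌉, to each of which Bernoulli applies.
decay-upper : ∀ a k K i M → 1 ≤ K → 1 ≤ k → i * (a + k + k * K) ≤ M * (k * K) →
              a ^ M * suc K ^ i ≤ (a + k) ^ M * K ^ i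
decay-upper a k K i M 1≤K 1≤k h = begin
  a ^ M * suc K ^ i                            ≡⟨ cong (λ x → a ^ x * suc K ^ i) M≡ ⟩
  a ^ (L * i + r) * suc K ^ i                  ≡⟨ cong (_* suc K ^ i) (trans (^-distribˡ-+-* a (L * i) r) (cong (_* a ^ r) (sym (^-*-assoc a L i)))) ⟩
  (a ^ L) ^ i * a ^ r * suc K ^ i              ≡⟨ xy∙z≈xz∙y ((a ^ L) ^ i) (a ^ r) (suc K ^ i) ⟩
  (a ^ L) ^ i * suc K ^ i * a ^ r              ≡⟨ cong (_* a ^ r) (^-distribʳ-* i (a ^ L) (suc K)) ⟨
  (a ^ L * suc K) ^ i * a ^ r                  ≤⟨ *-mono-≤ (^-monoˡ-≤ i group) (^-monoˡ-≤ r (m≤m+n a k)) ⟩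
  (b ^ L * K) ^ i * b ^ r                      ≡⟨ cong (_* b ^ r) (^-distribʳ-* i (b ^ L) K) ⟩
  (b ^ L) ^ i * K ^ i * b ^ r                  ≡⟨ xy∙z≈xz∙y ((b ^ L) ^ i) (b ^ r) (K ^ i) ⟨
  (b ^ L) ^ i * b ^ r * K ^ i                  ≡⟨ cong (_* K ^ i) (trans (^-distribˡ-+-* b (L * i) r) (cong (_* b ^ r) (sym (^-*-assoc b L i)))) ⟨
  b ^ (L * i + r) * K ^ i                      ≡⟨ cong (λ x → b ^ x * K ^ i) M≡ ⟨
  b ^ M * K ^ i                                ∎
  where
  open ≤-Reasoning
  b = a + k
  1≤kK : 1 ≤ k * K
  1≤kK = *-mono-≤ 1≤k 1≤K
  1≤m : 1 ≤ b
  1≤m = ≤-trans 1≤k (m≤n+m k a)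
  instance _ = >-nonZero 1≤kK
  q = b / (k * K)
  L = suc q
  m≤L : b ≤ L * (k * K)
  m≤L = <⇒≤ (m<[1+m/n]*n b (k * K))
  L≤ : L * i ≤ M
  L≤ = *-cancelʳ-≤ (L * i) M (k * K) (begin
    L * i * (k * K)                      ≡⟨ lemma₀ q i (k * K) ⟩
    i * (q * (k * K) + k * K)            ≤⟨ *-monoʳ-≤ i (+-monoˡ-≤ (k * K) (m/n*n≤m b (k * K))) ⟩
    i * (b + k * K)                      ≤⟨ h ⟩
    M * (k * K)                          ∎)
    where
    lemma₀ : ∀ q i x → suc q * i * x ≡ i * (q * x + x)
    lemma₀ = solve-∀
  r = M ∸ L * i
  M≡ : M ≡ L * i + r
  M≡ = sym (m+[n∸m]≡n L≤)
  group : a ^ L * suc K ≤ b ^ L * K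
  group = cancelʳ b 1≤m (begin
    a ^ L * suc K * b                    ≡⟨ lemma₁ (a ^ L) K b ⟩
    a ^ L * (b * K + b)                  ≤⟨ *-monoʳ-≤ (a ^ L) (+-monoʳ-≤ (b * K) m≤L) ⟩
    a ^ L * (b * K + L * (k * K))        ≡⟨ lemma₂ (a ^ L) b K L k ⟩
    a ^ L * (b + L * k) * K              ≤⟨ *-monoˡ-≤ K (bernoulli⁺ a k L) ⟩
    b ^ L * b * K                        ≡⟨ xy∙z≈xz∙y (b ^ L) b K ⟩
    b ^ L * K * b                        ∎)
    where
    lemma₁ : ∀ x K b → x * suc K * b ≡ x * (b * K + b)
    lemma₁ = solve-∀
    lemma₂ : ∀ x b K L k → x * (b * K + L * (k * K)) ≡ x * (b + L * k) * K
    lemma₂ = solve-∀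

-- The reverse bound, with L = ⌊m/(K+1)k⌋ factors per group.
decay-lower : ∀ a k K i M → 1 ≤ a → 1 ≤ k → M * (k * suc K) + i * (k * suc K) ≤ i * (a + k) →
              (a + k) ^ M * K ^ i ≤ a ^ M * suc K ^ i
decay-lower a k K i M 1≤a 1≤k h = cancelʳ (a ^ r * b ^ r) (*-mono-≤ (^-pos r 1≤a) (^-pos r (≤-trans 1≤k (m≤n+m k a)))) (begin
  b ^ M * K ^ i * (a ^ r * b ^ r)     ≡⟨ lemma₃ (b ^ M) (K ^ i) (a ^ r) (b ^ r) ⟩
  b ^ M * b ^ r * K ^ i * a ^ r       ≡⟨ cong (λ x → x * K ^ i * a ^ r) (power b) ⟩
  (b ^ L) ^ i * K ^ i * a ^ r         ≡⟨ cong (_* a ^ r) (^-distribʳ-* i (b ^ L) K) ⟨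
  (b ^ L * K) ^ i * a ^ r             ≤⟨ *-mono-≤ (^-monoˡ-≤ i group) (^-monoˡ-≤ r (m≤m+n a k)) ⟩
  (a ^ L * suc K) ^ i * b ^ r         ≡⟨ cong (_* b ^ r) (^-distribʳ-* i (a ^ L) (suc K)) ⟩
  (a ^ L) ^ i * suc K ^ i * b ^ r     ≡⟨ cong (λ x → x * suc K ^ i * b ^ r) (power a) ⟨
  a ^ M * a ^ r * suc K ^ i * b ^ r   ≡⟨ lemma₄ (a ^ M) (suc K ^ i) (a ^ r) (b ^ r) ⟨
  a ^ M * suc K ^ i * (a ^ r * b ^ r) ∎)
  where
  open ≤-Reasoning
  b = a + k
  x = k * suc K
  1≤x : 1 ≤ x
  1≤x = *-mono-≤ 1≤k (s≤s z≤n)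
  instance _ = >-nonZero 1≤x
  L = b / x
  M≤ : M ≤ L * i
  M≤ = *-cancelʳ-≤ M (L * i) x (+-cancelʳ-≤ (i * x) _ _ (begin
    M * x + i * x       ≤⟨ h ⟩
    i * b               ≤⟨ *-monoʳ-≤ i (<⇒≤ (m<[1+m/n]*n b x)) ⟩
    i * (suc L * x)     ≡⟨ lemma₀ i L x ⟩
    L * i * x + i * x   ∎))
    where
    lemma₀ : ∀ i L x → i * (suc L * x) ≡ L * i * x + i * x
    lemma₀ = solve-∀
  -- The groups have at least `M` factors in all. Both sides are multiplied by `a ^ r * b ^ r`, and
  -- a ≤ b is used for the `r` surplus factors.
  r = L * i ∸ M
  power : ∀ b → b ^ M * b ^ r ≡ (b ^ L) ^ i
  power b = trans (sym (^-distribˡ-+-* b M r)) (trans (cong (b ^_) (m+[n∸m]≡n M≤)) (sym (^-*-assoc b L i)))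
  lemma₃ : ∀ p q r s → p * q * (r * s) ≡ p * s * q * r
  lemma₃ = solve-∀
  lemma₄ : ∀ p q r s → p * q * (r * s) ≡ p * r * q * s
  lemma₄ = solve-∀
  group : b ^ L * K ≤ a ^ L * suc K
  group = cancelʳ b (≤-trans 1≤k (m≤n+m k a)) (+-cancelʳ-≤ (suc K * (L * k * b ^ L)) _ _ (begin
    b ^ L * K * b + suc K * (L * k * b ^ L)        ≡⟨ lemma₅ (b ^ L) K b L k ⟩
    b ^ L * (K * b + L * x)                        ≤⟨ *-monoʳ-≤ (b ^ L) (+-monoʳ-≤ (K * b) (m/n*n≤m b x)) ⟩
    b ^ L * (K * b + b)                            ≡⟨ lemma₆ (b ^ L) K b ⟩
    suc K * (b ^ L * b)                            ≤⟨ *-monoʳ-≤ (suc K) (bernoulli⁻ a k L) ⟩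
    suc K * (a ^ L * b + L * k * b ^ L)            ≡⟨ lemma₇ (a ^ L) (b ^ L) K b (L * k) ⟩
    a ^ L * suc K * b + suc K * (L * k * b ^ L)    ∎))
    where
    lemma₅ : ∀ p K b L k → p * K * b + suc K * (L * k * p) ≡ p * (K * b + L * (k * suc K))
    lemma₅ = solve-∀
    lemma₆ : ∀ p K b → p * (K * b + b) ≡ suc K * (p * b)
    lemma₆ = solve-∀
    lemma₇ : ∀ p q K b y → suc K * (p * b + y * q) ≡ p * suc K * b + suc K * (y * q)
    lemma₇ = solve-∀

-- The union bound over node sets

∈-subsets : (p : Subset m) → p ∈ subsets m
∈-subsets []            = Any.here refl
∈-subsets (inside ∷ p)  = ∈-++⁺ˡ (∈-map⁺ (inside ∷_) (∈-subsets p))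
∈-subsets (outside ∷ p) = ∈-++⁺ʳ (map (inside ∷_) (subsets _)) (∈-map⁺ (outside ∷_) (∈-subsets p))

∈-kSubsets : (p : Subset m) → card p ≡ k → p ∈ kSubsets m k
∈-kSubsets p eq = ∈-filter⁺ _ (∈-subsets p) eq

binom-monoˡ-≤ : ∀ {a b} k → a ≤ b → binom a k ≤ binom b k
binom-monoˡ-≤ {a}     zero    _         = ≤-refl
binom-monoˡ-≤ {zero}  (suc k) _         = z≤n
binom-monoˡ-≤ {suc a} (suc k) (s≤s a≤b) = +-mono-≤ (binom-monoˡ-≤ k a≤b) (binom-monoˡ-≤ (suc k) a≤b)

𝟙≤1 : {P : Set} (d : Dec P) → 𝟙 d ≤ 1
𝟙≤1 (yes _) = ≤-refl
𝟙≤1 (no _)  = z≤n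

-- Events are products of 0/1 indicators along the vector of nodes, so that sums over `assignments`
-- factor node by node.
allWithin : Subset m → Subset n → Vec (Subset m) n → ℕ
allWithin W []            []      = 1
allWithin W (inside ∷ S)  (f ∷ F) = 𝟙 (f ⊆? W) * allWithin W S F
allWithin W (outside ∷ S) (f ∷ F) = allWithin W S F

othersAvoid : Subset m → Subset n → Vec (Subset m) n → ℕ
othersAvoid Y []            []      = 1
othersAvoid Y (inside ∷ S)  (f ∷ F) = othersAvoid Y S F
othersAvoid Y (outside ∷ S) (f ∷ F) = 𝟙 (f ⊆? ∁ₛ Y) * othersAvoid Y S F

colours : Subset n → Vec (Subset m) n → Subset m
colours []            []      = ⊥
colours (inside ∷ S)  (f ∷ F) = f ∪ colours S F
colours (outside ∷ S) (f ∷ F) = colours S F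

-- V accumulates the colours of the nodes already dealt with in the induction on S.
largeAndAvoided : ℕ → Subset m → Subset n → Vec (Subset m) n → ℕ
largeAndAvoided w V S F = 𝟙 (w ≤? card (V ∪ colours S F)) * othersAvoid (V ∪ colours S F) S F

∑-allWithin : ∀ k (W : Subset m) (S : Subset n) → ∑ (assignments n m k) (allWithin W S)
              ≡ binom (card W) k ^ card S * binom m k ^ card (∁ₛ S)
∑-allWithin k W [] = refl
∑-allWithin {m} {suc n} k W (inside ∷ S) = begin
  ∑ (assignments (suc n) m k) (allWithin W (inside ∷ S))    ≡⟨ ∑-tuples n (kSubsets m k) _ ⟩
  ∑ (kSubsets m k) (λ f → ∑ (assignments n m k) λ F → 𝟙 (f ⊆? W) * allWithin W S F)
    ≡⟨ ∑-cong (kSubsets m k) (λ f _ → ∑-*ˡ (assignments n m k) (𝟙 (f ⊆? W)) (allWithin W S)) ⟩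
  ∑ (kSubsets m k) (λ f → 𝟙 (f ⊆? W) * T)                  ≡⟨ ∑-*ʳ (kSubsets m k) T _ ⟩
  ∑ (kSubsets m k) (λ f → 𝟙 (f ⊆? W)) * T                  ≡⟨ cong₂ _*_ (count-⊆ k W) (∑-allWithin k W S) ⟩
  b * (b ^ card S * binom m k ^ card (∁ₛ S))                 ≡⟨ *-assoc b (b ^ card S) _ ⟨
  b * b ^ card S * binom m k ^ card (∁ₛ S)                   ∎
  where
  open ≡-Reasoning
  T = ∑ (assignments n m k) (allWithin W S)
  b = binom (card W) k
∑-allWithin {m} {suc n} k W (outside ∷ S) = begin
  ∑ (assignments (suc n) m k) (allWithin W (outside ∷ S))   ≡⟨ ∑-tuples n (kSubsets m k) _ ⟩
  ∑ (kSubsets m k) (λ _ → T)                                ≡⟨ ∑-const (kSubsets m k) T ⟩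
  length (kSubsets m k) * T                                 ≡⟨ cong₂ _*_ (length-kSubsets m k) (∑-allWithin k W S) ⟩
  C * (b ^ card S * C ^ card (∁ₛ S))                         ≡⟨ x∙yz≈y∙xz C (b ^ card S) _ ⟩
  b ^ card S * (C * C ^ card (∁ₛ S))                         ∎
  where
  open ≡-Reasoning
  T = ∑ (assignments n m k) (allWithin W S)
  b = binom (card W) k
  C = binom m k

-- A node of S moves its colours into `V`. A node outside S is summed innermost, with Y = V ∪
-- `colours S F` fixed: either |Y| < w and the summand is 0, or the node has at most C(m-w,k)
-- choices.
∑-largeAndAvoided : ∀ k w (V : Subset m) (S : Subset n) → ∑ (assignments n m k) (largeAndAvoided w V S)
                    ≤ binom m k ^ card S * binom (m ∸ w) k ^ card (∁ₛ S)
∑-largeAndAvoided k w V [] = begin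
  𝟙 (w ≤? card (V ∪ ⊥)) * 1 + 0  ≡⟨ trans (+-identityʳ _) (*-identityʳ _) ⟩
  𝟙 (w ≤? card (V ∪ ⊥))          ≤⟨ 𝟙≤1 (w ≤? card (V ∪ ⊥)) ⟩
  1                              ∎
  where open ≤-Reasoning
∑-largeAndAvoided {m} {suc n} k w V (inside ∷ S) = begin
  ∑ (assignments (suc n) m k) (largeAndAvoided w V (inside ∷ S))  ≡⟨ ∑-tuples n (kSubsets m k) _ ⟩
  ∑ (kSubsets m k) (λ f → ∑ (assignments n m k) λ F → largeAndAvoided w V (inside ∷ S) (f ∷ F))
    ≤⟨ ∑-mono (kSubsets m k) (λ f _ → ≤-trans (≤-reflexive (∑-cong (assignments n m k) λ F _ →
         cong (λ Y → 𝟙 (w ≤? card Y) * othersAvoid Y S F) (sym (∪-assoc V f (colours S F)))))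
         (∑-largeAndAvoided k w (V ∪ f) S)) ⟩
  ∑ (kSubsets m k) (λ _ → T)                               ≡⟨ ∑-const (kSubsets m k) T ⟩
  length (kSubsets m k) * T                                ≡⟨ cong (_* T) (length-kSubsets m k) ⟩
  C * (C ^ card S * A ^ card (∁ₛ S))                        ≡⟨ *-assoc C (C ^ card S) _ ⟨
  C * C ^ card S * A ^ card (∁ₛ S)                          ∎
  where
  open ≤-Reasoning
  C = binom m k
  A = binom (m ∸ w) k
  T = C ^ card S * A ^ card (∁ₛ S)
∑-largeAndAvoided {m} {suc n} k w V (outside ∷ S) = begin
  ∑ (assignments (suc n) m k) (largeAndAvoided w V (outside ∷ S)) ≡⟨ ∑-tuples′ n (kSubsets m k) _ ⟩
  ∑ (assignments n m k) (λ F → ∑ (kSubsets m k) λ f → largeAndAvoided w V (outside ∷ S) (f ∷ F))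
    ≤⟨ ∑-mono (assignments n m k) (λ F _ → factor F) ⟩
  ∑ (assignments n m k) (λ F → A * largeAndAvoided w V S F)       ≡⟨ ∑-*ˡ (assignments n m k) A _ ⟩
  A * ∑ (assignments n m k) (largeAndAvoided w V S)               ≤⟨ *-monoʳ-≤ A (∑-largeAndAvoided k w V S) ⟩
  A * (C ^ card S * A ^ card (∁ₛ S))                               ≡⟨ x∙yz≈y∙xz A (C ^ card S) (A ^ card (∁ₛ S)) ⟩
  C ^ card S * (A * A ^ card (∁ₛ S))                               ∎
  where
  open ≤-Reasoning
  C = binom m k
  A = binom (m ∸ w) k
  factor′ : ∀ F Y → (d : Dec (w ≤ card Y)) →
            ∑ (kSubsets m k) (λ f → 𝟙 d * (𝟙 (f ⊆? ∁ₛ Y) * othersAvoid Y S F)) ≤ A * (𝟙 d * othersAvoid Y S F)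
  factor′ F Y (no _)    = ≤-trans (≤-reflexive (∑-zero (kSubsets m k))) z≤n
  factor′ F Y (yes w≤Y) = begin
    ∑ (kSubsets m k) (λ f → 𝟙 (f ⊆? ∁ₛ Y) * othersAvoid Y S F + 0)    ≡⟨ ∑-cong (kSubsets m k) (λ f _ → +-identityʳ _) ⟩
    ∑ (kSubsets m k) (λ f → 𝟙 (f ⊆? ∁ₛ Y) * othersAvoid Y S F)        ≡⟨ ∑-*ʳ (kSubsets m k) (othersAvoid Y S F) _ ⟩
    ∑ (kSubsets m k) (λ f → 𝟙 (f ⊆? ∁ₛ Y)) * othersAvoid Y S F        ≡⟨ cong (_* othersAvoid Y S F) (count-⊆∁ k Y) ⟩
    binom (m ∸ card Y) k * othersAvoid Y S F                         ≤⟨ *-monoˡ-≤ (othersAvoid Y S F) (binom-monoˡ-≤ k (∸-monoʳ-≤ m w≤Y)) ⟩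
    A * othersAvoid Y S F                                            ≡⟨ cong (A *_) (+-identityʳ _) ⟨
    A * (othersAvoid Y S F + 0)                                      ∎
  factor : ∀ F → ∑ (kSubsets m k) (λ f → largeAndAvoided w V (outside ∷ S) (f ∷ F)) ≤ A * largeAndAvoided w V S F
  factor F = factor′ F (V ∪ colours S F) (w ≤? card (V ∪ colours S F))

Separated : Subset n → Vec (Subset m) n → Set
Separated S F = ∀ {u v} → u Sub.∈ S → v ∉ S → ¬ Nonempty (lookup F u ∩ lookup F v)

lookup⊆colours : ∀ {S : Subset n} (F : Vec (Subset m) n) {v} → v Sub.∈ S → lookup F v ⊆ colours S F
lookup⊆colours {S = inside ∷ S}  (f ∷ F) here       = p⊆p∪q (colours S F)
lookup⊆colours {S = inside ∷ S}  (f ∷ F) (there v∈) = q⊆p∪q f (colours S F) ∘ lookup⊆colours F v∈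
lookup⊆colours {S = outside ∷ S} (f ∷ F) (there v∈) = lookup⊆colours F v∈

∈colours : ∀ (S : Subset n) (F : Vec (Subset m) n) {x} → x Sub.∈ colours S F → ∃[ v ] v Sub.∈ S × x Sub.∈ lookup F v
∈colours []            []      x∈ = contradiction x∈ ∉⊥
∈colours (inside ∷ S)  (f ∷ F) x∈ with x∈p∪q⁻ f (colours S F) x∈
... | inj₁ x∈f = zero , here , x∈f
... | inj₂ x∈c with ∈colours S F x∈c
...   | v , v∈S , x∈v = suc v , there v∈S , x∈v
∈colours (outside ∷ S) (f ∷ F) x∈ with ∈colours S F x∈
... | v , v∈S , x∈v = suc v , there v∈S , x∈v

allWithin≡1 : ∀ (W : Subset m) (S : Subset n) F → colours S F ⊆ W → allWithin W S F ≡ 1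
allWithin≡1 W []            []      _ = refl
allWithin≡1 W (inside ∷ S)  (f ∷ F) h = cong₂ _*_ (𝟙-yes (f ⊆? W) (h ∘ p⊆p∪q (colours S F)))
                                                 (allWithin≡1 W S F (h ∘ q⊆p∪q f (colours S F)))
allWithin≡1 W (outside ∷ S) (f ∷ F) h = allWithin≡1 W S F h

othersAvoid≡1 : ∀ (Y : Subset m) (S : Subset n) F → (∀ {v} → v ∉ S → lookup F v ⊆ ∁ₛ Y) → othersAvoid Y S F ≡ 1
othersAvoid≡1 Y []            []      _ = refl
othersAvoid≡1 Y (inside ∷ S)  (f ∷ F) h = othersAvoid≡1 Y S F λ v∉ → h (v∉ ∘ drop-there)
othersAvoid≡1 Y (outside ∷ S) (f ∷ F) h = cong₂ _*_ (𝟙-yes (f ⊆? ∁ₛ Y) (h {zero} λ ()))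
                                                   (othersAvoid≡1 Y S F λ v∉ → h (v∉ ∘ drop-there))

enlarge : ∀ (U : Subset m) w → card U ≤ w → w ≤ m → ∃[ W ] U ⊆ W × card W ≡ w
enlarge []            zero    _         _         = [] , id , refl
enlarge (inside ∷ U)  (suc w) (s≤s U≤w) (s≤s w≤m) with enlarge U w U≤w w≤m
... | W , U⊆W , eq = inside ∷ W , in⊆in U⊆W , cong suc eq
enlarge {suc m} (outside ∷ U) w U≤w w≤sm with m≤n⇒m<n∨m≡n w≤sm
... | inj₁ (s≤s w≤m) with enlarge U w U≤w w≤m
...   | W , U⊆W , eq = outside ∷ W , out⊆ U⊆W , eq
enlarge {suc m} (outside ∷ U) w U≤w w≤sm | inj₂ refl with enlarge U m (∣p∣≤n U) ≤-refl
...   | W , U⊆W , eq = inside ∷ W , out⊆ U⊆W , cong suc eq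

separated-count : ∀ w → w ≤ m → (S : Subset n) (F : Vec (Subset m) n) → Separated S F →
                  1 ≤ ∑ (kSubsets m w) (λ W → allWithin W S F) + largeAndAvoided w ⊥ S F
separated-count {m} w w≤m S F sep = split (w ≤? card (⊥ ∪ colours S F))
  where
  avoid : ∀ {v} → v ∉ S → lookup F v ⊆ ∁ₛ (⊥ ∪ colours S F)
  avoid v∉S {x} x∈Fv = x∉p⇒x∈∁p λ x∈ → case-∪ (x∈p∪q⁻ ⊥ (colours S F) x∈)
    where
    case-∪ : ¬ (x Sub.∈ ⊥ ⊎ x Sub.∈ colours S F)
    case-∪ (inj₁ x∈⊥) = ∉⊥ x∈⊥
    case-∪ (inj₂ x∈c) with ∈colours S F x∈c
    ... | u , u∈S , x∈Fu = sep u∈S v∉S (x , x∈p∩q⁺ (x∈Fu , x∈Fv))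
  split : (d : Dec (w ≤ card (⊥ ∪ colours S F))) →
          1 ≤ ∑ (kSubsets m w) (λ W → allWithin W S F) + 𝟙 d * othersAvoid (⊥ ∪ colours S F) S F
  split (yes _) = m≤n⇒m≤o+n (∑ (kSubsets m w) λ W → allWithin W S F) (≤-reflexive (sym (trans (+-identityʳ _) (othersAvoid≡1 (⊥ ∪ colours S F) S F avoid))))
  split (no w≰) with enlarge (⊥ ∪ colours S F) w (<⇒≤ (≰⇒> w≰)) w≤m
  ... | W , U⊆W , eq = m≤n⇒m≤n+o 0 (≤-trans
        (≤-reflexive (sym (allWithin≡1 W S F (U⊆W ∘ q⊆p∪q ⊥ (colours S F)))))
        (∑-∈ (λ W → allWithin W S F) (∈-kSubsets W eq)))

∑-separated : ∀ k w (S : Subset n) → ∑ (assignments n m k) (λ F → ∑ (kSubsets m w) (λ W → allWithin W S F) + largeAndAvoided w ⊥ S F)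
  ≤ binom m w * (binom w k ^ card S * binom m k ^ card (∁ₛ S)) + binom m k ^ card S * binom (m ∸ w) k ^ card (∁ₛ S)
∑-separated {n} {m} k w S = begin
  ∑ As (λ F → ∑ Ws (λ W → allWithin W S F) + largeAndAvoided w ⊥ S F)   ≡⟨ ∑-+ As _ _ ⟩
  ∑ As (λ F → ∑ Ws (λ W → allWithin W S F)) + ∑ As (largeAndAvoided w ⊥ S)
    ≤⟨ +-mono-≤ (≤-reflexive (trans (∑-swap As Ws _) (trans (∑-cong Ws within) (trans (∑-const Ws c) (cong (_* c) (length-kSubsets m w))))))
                (∑-largeAndAvoided k w ⊥ S) ⟩
  binom m w * c + binom m k ^ card S * binom (m ∸ w) k ^ card (∁ₛ S) ∎
  where
  open ≤-Reasoning
  As = assignments n m k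
  Ws = kSubsets m w
  c = binom w k ^ card S * binom m k ^ card (∁ₛ S)
  within : ∀ W → W ∈ Ws → ∑ As (allWithin W S) ≡ c
  within W W∈ = trans (∑-allWithin k W S) (cong (λ x → binom x k ^ card S * binom m k ^ card (∁ₛ S)) (proj₂ (∈-filter⁻ (λ p → card p ≟ w) {xs = subsets m} W∈)))

-- Some `v` is not reachable from some `u`. The nodes reachable from `u` form a `Subset` because
-- reachability is decidable; it and its complement are both separated from the rest, and the
-- smaller one is taken.
disconnected⇒separated : (F : Vec (Subset m) n) → ¬ Connected F →
                         ∃[ S ] 1 ≤ card S × card S + card S ≤ n × Separated S F
disconnected⇒separated {m} {n} F ¬conn with Fin.¬∀⟶∃¬ n _ (λ u → Fin.all? λ v → Warshall.star? (adjacent? F) u v) ¬conn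
... | u , ¬u with Fin.¬∀⟶∃¬ n _ (λ v → Warshall.star? (adjacent? F) u v) ¬u
...   | v , ¬uv = smaller (≤-total (card S) (card (∁ₛ S)))
  where
  reach : ∀ x → Dec (Star (Adjacent F) u x)
  reach x = Warshall.star? (adjacent? F) u x
  S = tabulate (does ∘ reach)
  does-true : ∀ {x} (d : Dec (Star (Adjacent F) u x)) → Star (Adjacent F) u x → does d ≡ true
  does-true (yes _) _ = refl
  does-true (no ¬p) p = contradiction p ¬p
  true-does : ∀ {x} (d : Dec (Star (Adjacent F) u x)) → does d ≡ true → Star (Adjacent F) u x
  true-does (yes p) _ = p
  ∈S⁺ : ∀ {x} → Star (Adjacent F) u x → x Sub.∈ S
  ∈S⁺ {x} p = lookup⇒[]= x S (trans (lookup∘tabulate (does ∘ reach) x) (does-true (reach x) p))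
  ∈S⁻ : ∀ {x} → x Sub.∈ S → Star (Adjacent F) u x
  ∈S⁻ {x} x∈ = true-does (reach x) (trans (sym (lookup∘tabulate (does ∘ reach) x)) ([]=⇒lookup x∈))
  closed : ∀ {x y} → x Sub.∈ S → y ∉ S → ¬ Adjacent F x y
  closed x∈ y∉ adj = y∉ (∈S⁺ (∈S⁻ x∈ ◅◅ (adj ◅ stop)))
  sepS : Separated S F
  sepS x∈ y∉ ne = closed x∈ y∉ ((λ { refl → y∉ x∈ }) , ne)
  sep∁S : Separated (∁ₛ S) F
  sep∁S {x} {y} x∈ y∉ (c , c∈) = sepS (x∉∁p⇒x∈p y∉) (x∈∁p⇒x∉p x∈)
    (c , x∈p∩q⁺ (let a , b = x∈p∩q⁻ (lookup F x) (lookup F y) c∈ in b , a))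
  nonempty : ∀ {x} {p : Subset n} → x Sub.∈ p → 1 ≤ card p
  nonempty {x} x∈p = subst (_≤ _) (∣⁅x⁆∣≡1 x) (p⊆q⇒∣p∣≤∣q∣ λ y∈ → subst (Sub._∈ _) (sym (x∈⁅y⁆⇒x≡y x y∈)) x∈p)
  total : card S + card (∁ₛ S) ≡ n
  total = trans (cong (card S +_) (∣∁p∣≡n∸∣p∣ S)) (m+[n∸m]≡n (∣p∣≤n S))
  smaller : card S ≤ card (∁ₛ S) ⊎ card (∁ₛ S) ≤ card S → ∃[ S ] 1 ≤ card S × card S + card S ≤ n × Separated S F
  smaller (inj₁ S≤) = S , nonempty (∈S⁺ {u} stop) , ≤-trans (+-monoʳ-≤ _ S≤) (≤-reflexive total) , sepS
  smaller (inj₂ ≤S) = ∁ₛ S , nonempty (x∉p⇒x∈∁p (¬uv ∘ ∈S⁻)) , ≤-trans (+-monoˡ-≤ _ ≤S) (≤-reflexive total) , sep∁S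

geometric : ∀ N B (y : ℕ → ℕ) → (∀ s → y s * 2 ^ s ≤ B) → ∑ (downFrom N) y ≤ 2 * B
geometric N B y h = cancelˡ (2 ^ N) (^-pos N (s≤s z≤n)) (≤-trans (m≤m+n _ (2 * B)) (≤-trans (go N) (≤-reflexive (*-comm (2 * B) _))))
  where
  open ≤-Reasoning
  -- The induction needs the sharper bound 2B(1 - 2^(-N)) for the partial sums, here multiplied by
  -- 2^N.
  go : ∀ N → 2 ^ N * ∑ (downFrom N) y + 2 * B ≤ 2 * B * 2 ^ N
  go zero    = ≤-reflexive (sym (*-identityʳ (2 * B)))
  go (suc N) = begin
    2 * 2 ^ N * (y N + ∑ (downFrom N) y) + 2 * B                  ≡⟨ lemma (2 ^ N) (y N) (∑ (downFrom N) y) B ⟩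
    2 * (2 ^ N * ∑ (downFrom N) y) + 2 * (y N * 2 ^ N) + 2 * B    ≤⟨ +-monoˡ-≤ (2 * B) (+-monoʳ-≤ (2 * (2 ^ N * ∑ (downFrom N) y)) (*-monoʳ-≤ 2 (h N))) ⟩
    2 * (2 ^ N * ∑ (downFrom N) y) + 2 * B + 2 * B                ≡⟨ lemma′ (2 ^ N * ∑ (downFrom N) y) B ⟩
    2 * (2 ^ N * ∑ (downFrom N) y + 2 * B)                        ≤⟨ *-monoʳ-≤ 2 (go N) ⟩
    2 * (2 * B * 2 ^ N)                                           ≡⟨ lemma″ B (2 ^ N) ⟩
    2 * B * (2 * 2 ^ N)                                           ∎
    where
    lemma : ∀ p y s B → 2 * p * (y + s) + 2 * B ≡ 2 * (p * s) + 2 * (y * p) + 2 * B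
    lemma = solve-∀
    lemma′ : ∀ x B → 2 * x + 2 * B + 2 * B ≡ 2 * (x + 2 * B)
    lemma′ = solve-∀
    lemma″ : ∀ B p → 2 * (2 * B * p) ≡ 2 * B * (2 * p)
    lemma″ = solve-∀

disconnected : ℕ → ℕ → ℕ → ℕ
disconnected n m k = length (filter (¬? ∘ connected?) (assignments n m k))

-- Of the `t` factors `4 * D` one gives the claim, its 4 paying for the two alternatives and for the
-- value 2 of the geometric series. The other t - 1 are at least 2 each and produce that series.
union-bound : ∀ n m k D (w : ℕ → ℕ) → 1 ≤ D →
  (∀ t → 1 ≤ t → t + t ≤ n →
     w t ≤ m
   × binom n t * (binom m (w t) * binom (w t) k ^ t) * (4 * D) ^ t ≤ binom m k ^ t
   × binom n t * binom (m ∸ w t) k ^ (n ∸ t) * (4 * D) ^ t ≤ binom m k ^ (n ∸ t)) →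
  D * disconnected n m k ≤ binom m k ^ n
union-bound n m k D w 1≤D h = *-cancelˡ-≤ 4 (begin
  4 * (D * disconnected n m k)                ≡⟨ *-assoc 4 D _ ⟨
  G * disconnected n m k                      ≤⟨ *-monoʳ-≤ G (length-filter-≤ (¬? ∘ connected?) As λ F _ ¬c → hit F ¬c) ⟩
  G * ∑ As (λ F → ∑ (downFrom n) λ s → ∑ (kSubsets n (suc s)) λ S → e s S F)
                                              ≡⟨ cong (G *_) (trans (∑-swap As (downFrom n) _) (∑-cong (downFrom n) λ s _ → ∑-swap As (kSubsets n (suc s)) _)) ⟩
  G * ∑ (downFrom n) T                        ≡⟨ ∑-*ˡ (downFrom n) G T ⟨
  ∑ (downFrom n) (λ s → G * T s)              ≤⟨ geometric n (2 * C ^ n) _ term ⟩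
  2 * (2 * C ^ n)                             ≡⟨ *-assoc 2 2 (C ^ n) ⟨
  4 * C ^ n                                   ∎)
  where
  open ≤-Reasoning
  G = 4 * D
  C = binom m k
  As = assignments n m k
  -- Sizes above n/2 get weight 0. The decision is an argument so that `term′` can split on it.
  e′ : ∀ s → Dec (suc s + suc s ≤ n) → Subset n → Vec (Subset m) n → ℕ
  e′ s d S F = 𝟙 d * (∑ (kSubsets m (w (suc s))) (λ W → allWithin W S F) + largeAndAvoided (w (suc s)) ⊥ S F)
  e : ∀ s → Subset n → Vec (Subset m) n → ℕ
  e s = e′ s (suc s + suc s ≤? n)
  T : ℕ → ℕ
  T s = ∑ (kSubsets n (suc s)) λ S → ∑ As (e s S)
  hit : ∀ F → ¬ Connected F → 1 ≤ ∑ (downFrom n) (λ s → ∑ (kSubsets n (suc s)) λ S → e s S F)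
  hit F ¬c with disconnected⇒separated F ¬c
  ... | S , 1≤S , 2S≤n , sep with card S in eq
  ...   | suc s = ≤-trans one (≤-trans (∑-∈ (λ S → e s S F) (∈-kSubsets S eq))
                    (∑-∈ (λ s → ∑ (kSubsets n (suc s)) λ S → e s S F) (∈-downFrom⁺ (≤-trans (m≤m+n _ _) 2S≤n))))
    where
    one : 1 ≤ e s S F
    one = ≤-trans (separated-count (w (suc s)) (proj₁ (h (suc s) (s≤s z≤n) 2S≤n)) S F sep)
          (≤-reflexive (trans (sym (*-identityˡ _)) (cong (_* (∑ (kSubsets m (w (suc s))) (λ W → allWithin W S F) + largeAndAvoided (w (suc s)) ⊥ S F)) (sym (𝟙-yes (suc s + suc s ≤? n) 2S≤n)))))
  term : ∀ s → G * T s * 2 ^ s ≤ 2 * C ^ n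
  term s = term′ (suc s + suc s ≤? n)
    where
    term′ : (d : Dec (suc s + suc s ≤ n)) → G * ∑ (kSubsets n (suc s)) (λ S → ∑ As (e′ s d S)) * 2 ^ s ≤ 2 * C ^ n
    term′ (no _) = subst (_≤ 2 * C ^ n) (sym (cong (_* 2 ^ s) (trans (cong (G *_) (trans
      (∑-cong (kSubsets n (suc s)) λ S _ → ∑-zero As) (∑-zero (kSubsets n (suc s))))) (*-zeroʳ G)))) z≤n
    term′ (yes 2t≤n) = begin
      G * ∑ Ss (λ S → ∑ As λ F → g S F + 0) * 2 ^ s    ≤⟨ *-monoˡ-≤ (2 ^ s) (*-monoʳ-≤ G (∑-mono Ss λ S S∈ → ≤-trans
                                                         (≤-reflexive (∑-cong As λ F _ → +-identityʳ _)) (each S S∈))) ⟩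
      G * ∑ Ss (λ _ → b) * 2 ^ s                       ≡⟨ cong (λ x → G * x * 2 ^ s) (trans (∑-const Ss b) (cong (_* b) (length-kSubsets n t))) ⟩
      G * (binom n t * b) * 2 ^ s                      ≤⟨ *-monoʳ-≤ (G * (binom n t * b)) (^-monoˡ-≤ s 2≤G) ⟩
      G * (binom n t * b) * G ^ s                      ≡⟨ lemma G (binom n t) (binom m (w t)) (binom (w t) k ^ t) (C ^ t) (C ^ (n ∸ t)) (A ^ (n ∸ t)) (G ^ s) ⟩
      binom n t * (binom m (w t) * binom (w t) k ^ t) * G ^ t * C ^ (n ∸ t) + binom n t * A ^ (n ∸ t) * G ^ t * C ^ t
                                                       ≤⟨ +-mono-≤ (*-monoˡ-≤ (C ^ (n ∸ t)) (proj₁ (proj₂ ht))) (*-monoˡ-≤ (C ^ t) (proj₂ (proj₂ ht))) ⟩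
      C ^ t * C ^ (n ∸ t) + C ^ (n ∸ t) * C ^ t        ≡⟨ cong₂ _+_ C^n (trans (*-comm (C ^ (n ∸ t)) (C ^ t)) C^n) ⟩
      C ^ n + C ^ n                                    ≡⟨ cong (C ^ n +_) (+-identityʳ (C ^ n)) ⟨
      2 * C ^ n                                        ∎
      where
      t = suc s
      ht = h t (s≤s z≤n) 2t≤n
      Ss = kSubsets n t
      A = binom (m ∸ w t) k
      g : Subset n → Vec (Subset m) n → ℕ
      g S F = ∑ (kSubsets m (w t)) (λ W → allWithin W S F) + largeAndAvoided (w t) ⊥ S F
      b = binom m (w t) * (binom (w t) k ^ t * C ^ (n ∸ t)) + C ^ t * A ^ (n ∸ t)
      2≤G : 2 ≤ G
      2≤G = ≤-trans (s≤s (s≤s z≤n)) (*-monoʳ-≤ 4 1≤D)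
      each : ∀ S → S ∈ Ss → ∑ As (g S) ≤ b
      each S S∈ = subst₂ (λ x y → ∑ As (g S) ≤ binom m (w t) * (binom (w t) k ^ x * C ^ y) + C ^ x * A ^ y)
        cS (trans (∣∁p∣≡n∸∣p∣ S) (cong (n ∸_) cS)) (∑-separated k (w t) S)
        where
        cS : card S ≡ t
        cS = proj₂ (∈-filter⁻ (λ p → card p ≟ t) {xs = subsets n} S∈)
      C^n : C ^ t * C ^ (n ∸ t) ≡ C ^ n
      C^n = trans (sym (^-distribˡ-+-* C t (n ∸ t))) (cong (C ^_) (m+[n∸m]≡n (≤-trans (m≤m+n t t) 2t≤n)))
      lemma : ∀ G N M W Ct Cn An Gs → G * (N * (M * (W * Cn) + Ct * An)) * Gs ≡ N * (M * W) * (G * Gs) * Cn + N * An * (G * Gs) * Ct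
      lemma = solve-∀

-- Monotonicity in the number of colours per node

Antitone : (Subset m → ℕ) → Set
Antitone g = ∀ {p q} → p ⊆ q → g q ≤ g p

∑ₖ-mono : ∀ m k {f g : Subset m → ℕ} → (∀ p → f p ≤ g p) → ∑ₖ m k f ≤ ∑ₖ m k g
∑ₖ-mono zero    zero    h = h []
∑ₖ-mono zero    (suc k) h = z≤n
∑ₖ-mono (suc m) zero    h = ∑ₖ-mono m zero (h ∘ (outside ∷_))
∑ₖ-mono (suc m) (suc k) h = +-mono-≤ (∑ₖ-mono m k (h ∘ (inside ∷_))) (∑ₖ-mono m (suc k) (h ∘ (outside ∷_)))

-- Double counting of the pairs p ⊆ q with |p| = k and |q| = k + 1, carried out by recursion on `m`:
-- each q contains k + 1 sets p, all with g q ≤ g p, and each p lies in m - k sets q. For constant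
-- `g` equality holds, which is `binom-step`.
∑ₖ-antitone-step : ∀ m k {g : Subset m → ℕ} → Antitone g → suc k * ∑ₖ m (suc k) g + k * ∑ₖ m k g ≤ m * ∑ₖ m k g
∑ₖ-antitone-step zero    zero    anti = z≤n
∑ₖ-antitone-step zero    (suc k) anti = ≤-reflexive (cong₂ _+_ (*-zeroʳ k) (*-zeroʳ k))
∑ₖ-antitone-step (suc m) zero {g} anti = begin
  1 * (∑ₖ m 0 gᵢ + ∑ₖ m 1 gₒ) + 0       ≡⟨ lemma (∑ₖ m 0 gᵢ) (∑ₖ m 1 gₒ) ⟩
  ∑ₖ m 0 gᵢ + (1 * ∑ₖ m 1 gₒ + 0)       ≤⟨ +-mono-≤ (∑ₖ-mono m 0 λ p → anti (out⊆ ⊆-refl)) (∑ₖ-antitone-step m 0 (anti ∘ s⊆s)) ⟩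
  ∑ₖ m 0 gₒ + m * ∑ₖ m 0 gₒ             ∎
  where
  open ≤-Reasoning
  gᵢ = g ∘ (inside ∷_)
  gₒ = g ∘ (outside ∷_)
  lemma : ∀ x y → 1 * (x + y) + 0 ≡ x + (1 * y + 0)
  lemma = solve-∀
∑ₖ-antitone-step (suc m) (suc k) {g} anti = begin
  (2 + k) * (b + d) + suc k * (a + c)                      ≡⟨ lemma k a b c d ⟩
  (suc k * b + k * a) + ((2 + k) * d + suc k * c) + b + a  ≤⟨ +-monoˡ-≤ a (+-mono-≤ (+-mono-≤ (∑ₖ-antitone-step m k (anti ∘ s⊆s)) (∑ₖ-antitone-step m (suc k) (anti ∘ s⊆s)))
                                                               (∑ₖ-mono m (suc k) λ p → anti (out⊆ ⊆-refl))) ⟩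
  m * a + m * c + c + a                                    ≡⟨ lemma′ m a c ⟩
  suc m * (a + c)                                          ∎
  where
  open ≤-Reasoning
  a = ∑ₖ m k (g ∘ (inside ∷_))
  b = ∑ₖ m (suc k) (g ∘ (inside ∷_))
  c = ∑ₖ m (suc k) (g ∘ (outside ∷_))
  d = ∑ₖ m (suc (suc k)) (g ∘ (outside ∷_))
  lemma : ∀ k a b c d → (2 + k) * (b + d) + suc k * (a + c) ≡ (suc k * b + k * a) + ((2 + k) * d + suc k * c) + b + a
  lemma = solve-∀
  lemma′ : ∀ m a c → m * a + m * c + c + a ≡ suc m * (a + c)
  lemma′ = solve-∀

∑ₖ-antitone-suc : ∀ m k {g : Subset m → ℕ} → Antitone g → ∑ₖ m (suc k) g * binom m k ≤ ∑ₖ m k g * binom m (suc k)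
∑ₖ-antitone-suc m k {g} anti = *-cancelˡ-≤ (suc k) (begin
  suc k * (S′ * binom m k)             ≡⟨ *-assoc (suc k) S′ (binom m k) ⟨
  suc k * S′ * binom m k               ≤⟨ *-monoˡ-≤ (binom m k) step ⟩
  (m ∸ k) * S * binom m k              ≡⟨ xy∙z≈y∙xz (m ∸ k) S (binom m k) ⟩
  S * ((m ∸ k) * binom m k)            ≡⟨ cong (S *_) (binom-suc-right m k) ⟨
  S * (suc k * binom m (suc k))        ≡⟨ x∙yz≈y∙xz S (suc k) (binom m (suc k)) ⟩
  suc k * (S * binom m (suc k))        ∎)
  where
  open ≤-Reasoning
  S = ∑ₖ m k g
  S′ = ∑ₖ m (suc k) g
  step : suc k * S′ ≤ (m ∸ k) * S
  step = begin
    suc k * S′                      ≡⟨ m+n∸n≡m (suc k * S′) (k * S) ⟨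
    suc k * S′ + k * S ∸ k * S      ≤⟨ ∸-monoˡ-≤ (k * S) (∑ₖ-antitone-step m k anti) ⟩
    m * S ∸ k * S                   ≡⟨ *-distribʳ-∸ S m k ⟨
    (m ∸ k) * S                     ∎

∑ₖ-antitone : ∀ m {k k′} {g : Subset m → ℕ} → Antitone g → k ≤′ k′ → k′ ≤ m →
              ∑ₖ m k′ g * binom m k ≤ ∑ₖ m k g * binom m k′
∑ₖ-antitone m anti ≤′-refl _ = ≤-refl
∑ₖ-antitone m {k} {suc k′} {g} anti (≤′-step k≤k′) k′<m = cancelʳ (binom m k′) (1≤binom (<⇒≤ k′<m)) (begin
  ∑ₖ m (suc k′) g * binom m k * binom m k′       ≡⟨ xy∙z≈xz∙y (∑ₖ m (suc k′) g) (binom m k) _ ⟩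
  ∑ₖ m (suc k′) g * binom m k′ * binom m k       ≤⟨ *-monoˡ-≤ (binom m k) (∑ₖ-antitone-suc m k′ anti) ⟩
  ∑ₖ m k′ g * binom m (suc k′) * binom m k       ≡⟨ xy∙z≈xz∙y (∑ₖ m k′ g) (binom m (suc k′)) _ ⟩
  ∑ₖ m k′ g * binom m k * binom m (suc k′)       ≤⟨ *-monoˡ-≤ (binom m (suc k′)) (∑ₖ-antitone m anti k≤k′ (<⇒≤ k′<m)) ⟩
  ∑ₖ m k g * binom m k′ * binom m (suc k′)       ≡⟨ xy∙z≈xz∙y (∑ₖ m k g) (binom m k′) _ ⟩
  ∑ₖ m k g * binom m (suc k′) * binom m k′       ∎)
  where
  open ≤-Reasoning

-- A coupling of larger with smaller colour sets, expressed by means: the first node is treated by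
-- `∑ₖ-antitone` while the others still have k′ colours, then the others by induction.
∑-antitone : ∀ n m {k k′} (f : Vec (Subset m) n → ℕ) →
  (∀ F F′ → (∀ v → lookup F v ⊆ lookup F′ v) → f F′ ≤ f F) → k ≤ k′ → k′ ≤ m →
  ∑ (assignments n m k′) f * binom m k ^ n ≤ ∑ (assignments n m k) f * binom m k′ ^ n
∑-antitone zero    m f anti _ _ = ≤-refl
∑-antitone (suc n) m {k} {k′} f anti k≤k′ k′≤m = begin
  ∑ (assignments (suc n) m k′) f * (B * B ^ n)      ≡⟨ cong (_* (B * B ^ n)) (∑-tuples n (kSubsets m k′) f) ⟩
  ∑ (kSubsets m k′) h * (B * B ^ n)                 ≡⟨ *-assoc (∑ (kSubsets m k′) h) B (B ^ n) ⟨
  ∑ (kSubsets m k′) h * B * B ^ n                   ≤⟨ *-monoˡ-≤ (B ^ n) step ⟩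
  ∑ (kSubsets m k) h * B′ * B ^ n                   ≡⟨ xy∙z≈xz∙y (∑ (kSubsets m k) h) B′ (B ^ n) ⟩
  ∑ (kSubsets m k) h * B ^ n * B′                   ≡⟨ cong (_* B′) (∑-*ʳ (kSubsets m k) (B ^ n) h) ⟨
  ∑ (kSubsets m k) (λ x → h x * B ^ n) * B′         ≤⟨ *-monoˡ-≤ B′ (∑-mono (kSubsets m k) λ x _ → ∑-antitone n m (f ∘ (x ∷_)) (λ F F′ F⊆F′ → anti (x ∷ F) (x ∷ F′) λ { zero → ⊆-refl ; (suc v) → F⊆F′ v }) k≤k′ k′≤m) ⟩
  ∑ (kSubsets m k) (λ x → h′ x * B′ ^ n) * B′       ≡⟨ cong (_* B′) (∑-*ʳ (kSubsets m k) (B′ ^ n) h′) ⟩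
  ∑ (kSubsets m k) h′ * B′ ^ n * B′                 ≡⟨ xy∙z≈x∙zy (∑ (kSubsets m k) h′) (B′ ^ n) B′ ⟩
  ∑ (kSubsets m k) h′ * (B′ * B′ ^ n)               ≡⟨ cong (_* (B′ * B′ ^ n)) (∑-tuples n (kSubsets m k) f) ⟨
  ∑ (assignments (suc n) m k) f * (B′ * B′ ^ n)     ∎
  where
  open ≤-Reasoning
  B = binom m k
  B′ = binom m k′
  h h′ : Subset m → ℕ
  h x = ∑ (assignments n m k′) (λ F → f (x ∷ F))
  h′ x = ∑ (assignments n m k) (λ F → f (x ∷ F))
  step : ∑ (kSubsets m k′) h * B ≤ ∑ (kSubsets m k) h * B′
  step = subst₂ (λ x y → x * B ≤ y * B′) (sym (∑-kSubsets m k′ h)) (sym (∑-kSubsets m k h))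
    (∑ₖ-antitone m (λ {p} {q} p⊆q → ∑-mono (assignments n m k′) λ F _ → anti (p ∷ F) (q ∷ F) λ { zero → p⊆q ; (suc v) → ⊆-refl }) (≤⇒≤′ k≤k′) k′≤m)

Connected-mono : ∀ {F F′ : Vec (Subset m) n} → (∀ v → lookup F v ⊆ lookup F′ v) → Connected F → Connected F′
Connected-mono {F = F} {F′} F⊆F′ conn u v = Star.map step (conn u v)
  where
  step : ∀ {x y} → Adjacent F x y → Adjacent F′ x y
  step {x} {y} (x≢y , c , c∈) with x∈p∩q⁻ (lookup F x) (lookup F y) c∈
  ... | c∈x , c∈y = x≢y , c , x∈p∩q⁺ (F⊆F′ x c∈x , F⊆F′ y c∈y)

disconnected-antitone : ∀ n m {k k′} → k ≤ k′ → k′ ≤ m →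
                        disconnected n m k′ * binom m k ^ n ≤ disconnected n m k * binom m k′ ^ n
disconnected-antitone n m {k} {k′} k≤k′ k′≤m = subst₂ (λ x y → x * binom m k ^ n ≤ y * binom m k′ ^ n)
  (sym (length-filter (¬? ∘ connected?) (assignments n m k′))) (sym (length-filter (¬? ∘ connected?) (assignments n m k)))
  (∑-antitone n m (λ F → 𝟙 (¬? (connected? F))) anti k≤k′ k′≤m)
  where
  𝟙-mono : {P Q : Set} (d : Dec P) (e : Dec Q) → (P → Q) → 𝟙 d ≤ 𝟙 e
  𝟙-mono (yes p) (yes q) _ = ≤-refl
  𝟙-mono (yes p) (no ¬q) f = contradiction (f p) ¬q
  𝟙-mono (no _)  e       _ = z≤n
  anti : ∀ F F′ → (∀ v → lookup F v ⊆ lookup F′ v) → 𝟙 (¬? (connected? F′)) ≤ 𝟙 (¬? (connected? F))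
  anti F F′ F⊆F′ = 𝟙-mono (¬? (connected? F′)) (¬? (connected? F)) (_∘ Connected-mono {F = F} {F′} F⊆F′)

-- Above the threshold

-- The exact probability (C(w,k)/C(m,k))^t is replaced by its bound (w/m)^(kt), so that powers alone
-- remain to be estimated.
within-reduction : ∀ {n m k w t G} → 1 ≤ m → w ≤ m →
  binom n t * (binom m w * (w ^ k) ^ t) * G ^ t ≤ (m ^ k) ^ t →
  binom n t * (binom m w * binom w k ^ t) * G ^ t ≤ binom m k ^ t
within-reduction {n} {m} {k} {w} {t} {G} 1≤m w≤m h = cancelʳ ((m ^ k) ^ t) (^-pos t (^-pos k 1≤m)) (begin
  B * (W * b ^ t) * G ^ t * (m ^ k) ^ t        ≡⟨ lemma₁ B W (b ^ t) (G ^ t) ((m ^ k) ^ t) ⟩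
  B * W * G ^ t * (b ^ t * (m ^ k) ^ t)        ≡⟨ cong (B * W * G ^ t *_) (^-distribʳ-* t b (m ^ k)) ⟨
  B * W * G ^ t * (b * m ^ k) ^ t              ≤⟨ *-monoʳ-≤ (B * W * G ^ t) (^-monoˡ-≤ t (binom-ratio-≤ w≤m k)) ⟩
  B * W * G ^ t * (C * w ^ k) ^ t              ≡⟨ cong (B * W * G ^ t *_) (^-distribʳ-* t C (w ^ k)) ⟩
  B * W * G ^ t * (C ^ t * (w ^ k) ^ t)        ≡⟨ lemma₂ B W (G ^ t) (C ^ t) ((w ^ k) ^ t) ⟩
  C ^ t * (B * (W * (w ^ k) ^ t) * G ^ t)      ≤⟨ *-monoʳ-≤ (C ^ t) h ⟩
  C ^ t * (m ^ k) ^ t                          ∎)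
  where
  open ≤-Reasoning
  B = binom n t
  W = binom m w
  b = binom w k
  C = binom m k
  lemma₁ : ∀ B W b G M → B * (W * b) * G * M ≡ B * W * G * (b * M)
  lemma₁ = solve-∀
  lemma₂ : ∀ B W G C w → B * W * G * (C * w) ≡ C * (B * (W * w) * G)
  lemma₂ = solve-∀

avoiding-reduction : ∀ {n m k w t r G} → 1 ≤ m → w ≤ m →
  binom n t * ((m ∸ k) ^ w) ^ r * G ^ t ≤ (m ^ w) ^ r →
  binom n t * binom (m ∸ w) k ^ r * G ^ t ≤ binom m k ^ r
avoiding-reduction {n} {m} {k} {w} {t} {r} {G} 1≤m w≤m h = cancelʳ ((m ^ w) ^ r) (^-pos r (^-pos w 1≤m)) (begin
  B * A ^ r * G ^ t * (m ^ w) ^ r              ≡⟨ lemma₁ B (A ^ r) (G ^ t) ((m ^ w) ^ r) ⟩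
  B * G ^ t * (A ^ r * (m ^ w) ^ r)            ≡⟨ cong (B * G ^ t *_) (^-distribʳ-* r A (m ^ w)) ⟨
  B * G ^ t * (A * m ^ w) ^ r                  ≤⟨ *-monoʳ-≤ (B * G ^ t) (^-monoˡ-≤ r (binom-avoid-≤ m k w w≤m)) ⟩
  B * G ^ t * (C * (m ∸ k) ^ w) ^ r            ≡⟨ cong (B * G ^ t *_) (^-distribʳ-* r C ((m ∸ k) ^ w)) ⟩
  B * G ^ t * (C ^ r * ((m ∸ k) ^ w) ^ r)      ≡⟨ lemma₂ B (G ^ t) (C ^ r) (((m ∸ k) ^ w) ^ r) ⟩
  C ^ r * (B * ((m ∸ k) ^ w) ^ r * G ^ t)      ≤⟨ *-monoʳ-≤ (C ^ r) h ⟩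
  C ^ r * (m ^ w) ^ r                          ∎)
  where
  open ≤-Reasoning
  B = binom n t
  A = binom (m ∸ w) k
  C = binom m k
  lemma₁ : ∀ B A G M → B * A * G * M ≡ B * G * (A * M)
  lemma₁ = solve-∀
  lemma₂ : ∀ B G C w → B * G * (C * w) ≡ C * (B * w * G)
  lemma₂ = solve-∀

-- (1 + 1/K)^K ≥ 2 by Bernoulli's inequality. This converts powers of 2, the currency of all crude
-- estimates, to the base 1 + 1/K.
2K^K≤[1+K]^K : ∀ K t → 1 ≤ K → 2 ^ t * K ^ (K * t) ≤ suc K ^ (K * t)
2K^K≤[1+K]^K K t 1≤K = begin
  2 ^ t * K ^ (K * t)      ≡⟨ cong (2 ^ t *_) (^-*-assoc K K t) ⟨
  2 ^ t * (K ^ K) ^ t      ≡⟨ ^-distribʳ-* t 2 (K ^ K) ⟨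
  (2 * K ^ K) ^ t          ≤⟨ ^-monoˡ-≤ t base ⟩
  (suc K ^ K) ^ t          ≡⟨ ^-*-assoc (suc K) K t ⟩
  suc K ^ (K * t)          ∎
  where
  open ≤-Reasoning
  bernoulli : ∀ L → K ^ L * (K + L) ≤ suc K ^ L * K
  bernoulli zero    = ≤-reflexive (cong (_+ 0) (+-identityʳ K))
  bernoulli (suc L) = begin
    K * K ^ L * (K + suc L)                   ≤⟨ m≤m+n _ (K ^ L * L) ⟩
    K * K ^ L * (K + suc L) + K ^ L * L       ≡⟨ lemma K L (K ^ L) ⟩
    suc K * (K ^ L * (K + L))                 ≤⟨ *-monoʳ-≤ (suc K) (bernoulli L) ⟩
    suc K * (suc K ^ L * K)                   ≡⟨ *-assoc (suc K) (suc K ^ L) K ⟨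
    suc K * suc K ^ L * K                     ∎
    where
    lemma : ∀ K L p → K * p * (K + suc L) + p * L ≡ suc K * (p * (K + L))
    lemma = solve-∀
  base : 2 * K ^ K ≤ suc K ^ K
  base = cancelʳ K 1≤K (≤-trans (≤-reflexive (lemma K (K ^ K))) (bernoulli K))
    where
    lemma : ∀ K p → 2 * p * K ≡ p * (K + K)
    lemma = solve-∀

n≤2^n : ∀ n → n ≤ 2 ^ n
n≤2^n zero    = z≤n
n≤2^n (suc n) = +-mono-≤ (^-pos n (s≤s z≤n)) (m≤n⇒m≤n+o 0 (n≤2^n n))

-- X ≤ (1 + 1/K)^j ≤ (1 - k/m)^(-M). It is applied with a large `K` where the constant in the
-- exponent matters, and with K = 1, to base 2, where it does not.
decay : ∀ {k m K j M X} → 1 ≤ K → 1 ≤ k → k ≤ m → j * (m + k * K) ≤ M * (k * K) → X * K ^ j ≤ suc K ^ j →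
        X * (m ∸ k) ^ M ≤ m ^ M
decay {k} {m} {K} {j} {M} {X} 1≤K 1≤k k≤m h hX = cancelʳ (K ^ j) (^-pos j 1≤K) (begin
  X * a ^ M * K ^ j      ≡⟨ xy∙z≈y∙xz X (a ^ M) (K ^ j) ⟩
  a ^ M * (X * K ^ j)    ≤⟨ *-monoʳ-≤ (a ^ M) hX ⟩
  a ^ M * suc K ^ j      ≤⟨ subst (λ x → a ^ M * suc K ^ j ≤ x ^ M * K ^ j) a+k≡m
                             (decay-upper a k K j M 1≤K 1≤k (subst (λ x → j * (x + k * K) ≤ M * (k * K)) (sym a+k≡m) h)) ⟩
  m ^ M * K ^ j          ∎)
  where
  open ≤-Reasoning
  a = m ∸ k
  a+k≡m : a + k ≡ m
  a+k≡m = m∸n+n≡m k≤m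

-- `1 + 1/R` is the excess over the threshold, `2 ^ γ` the factor per node that `union-bound`
-- demands, `i` the logarithm of `n` to base 1 + 1/K, and `g` essentially √(i/Q), hence of order
-- √log n. `β` is such that n ≤ 2^(βg²), `2 ^ (2 * b * g)` is the value of n/s that divides small
-- from large sets, and `1/H` is the fraction of the colours used for the large ones.
module Regimes
  (R γ b β K H g n m k i : ℕ)
  (K≡ : K ≡ 5 + 6 * R)
  (β≡ : β ≡ 4 * suc K + 1)
  (b≡ : b ≡ (β + 3) * (2 * suc K))
  (H≡ : H ≡ 2 ^ (4 * b + 8))
  (1≤R : 1 ≤ R)
  (g≥γ+2 : γ + 2 ≤ g)
  (g≥K : suc K ≤ g)
  (g≥H : 8 * H * (2 * b + 2 + γ) ≤ g)
  (g≥e : 4 * R * (1 + K * γ) ≤ g)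
  (g≥c : 32 * (8 * R * K + H) ≤ g)
  (n≤m : n ≤ m)
  (lower-n : suc K ^ i ≤ n * K ^ i)
  (upper-n : n * K ^ suc i ≤ suc K ^ suc i)
  (i≥ : g * g * suc K ≤ i)
  (i≤ : i ≤ suc g * suc g * suc K)
  (k²≥ : suc R * (m * i) ≤ R * (suc K * (k * k * n)))
  (k²≤ : k * k * n ≤ 32 * (m * (g * g)))
  where

  open ≤-Reasoning

  Q = suc K
  G = 2 ^ γ

  1≤K : 1 ≤ K
  1≤K = subst (1 ≤_) (sym K≡) (s≤s z≤n)

  1≤g : 1 ≤ g
  1≤g = ≤-trans (s≤s z≤n) g≥K

  m*g²≤k²n : m * (g * g) ≤ k * k * n
  m*g²≤k²n = cancelˡ (R * Q) (*-mono-≤ 1≤R (s≤s z≤n)) (begin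
    R * Q * (m * (g * g))      ≡⟨ lemma R Q m g ⟩
    R * (m * (g * g * Q))      ≤⟨ *-mono-≤ (n≤1+n R) (*-monoʳ-≤ m i≥) ⟩
    suc R * (m * i)            ≤⟨ k²≥ ⟩
    R * (Q * (k * k * n))      ≡⟨ *-assoc R Q (k * k * n) ⟨
    R * Q * (k * k * n)        ∎)
    where
    lemma : ∀ R Q m g → R * Q * (m * (g * g)) ≡ R * (m * (g * g * Q))
    lemma = solve-∀

  2^g²≤n : 2 ^ (g * g) ≤ n
  2^g²≤n = cancelʳ (K ^ i) (^-pos i 1≤K) (begin
    2 ^ (g * g) * K ^ i                       ≡⟨ cong (λ x → 2 ^ (g * g) * K ^ x) i≡ ⟩
    2 ^ (g * g) * K ^ (j + (i ∸ j))           ≡⟨ cong (2 ^ (g * g) *_) (^-distribˡ-+-* K j (i ∸ j)) ⟩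
    2 ^ (g * g) * (K ^ j * K ^ (i ∸ j))       ≡⟨ *-assoc (2 ^ (g * g)) (K ^ j) _ ⟨
    2 ^ (g * g) * K ^ j * K ^ (i ∸ j)         ≤⟨ *-mono-≤ (2K^K≤[1+K]^K K (g * g) 1≤K) (^-monoˡ-≤ (i ∸ j) (n≤1+n K)) ⟩
    Q ^ j * Q ^ (i ∸ j)                       ≡⟨ ^-distribˡ-+-* Q j (i ∸ j) ⟨
    Q ^ (j + (i ∸ j))                         ≡⟨ cong (Q ^_) i≡ ⟨
    Q ^ i                                     ≤⟨ lower-n ⟩
    n * K ^ i                                 ∎)
    where
    j = K * (g * g)
    i≡ : i ≡ j + (i ∸ j)
    i≡ = sym (m+[n∸m]≡n (≤-trans (≤-trans (*-monoˡ-≤ (g * g) (n≤1+n K)) (≤-reflexive (*-comm Q (g * g)))) i≥))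

  1≤n : 1 ≤ n
  1≤n = ≤-trans (^-pos (g * g) (s≤s z≤n)) 2^g²≤n

  1≤m : 1 ≤ m
  1≤m = ≤-trans 1≤n n≤m

  g≤k : g ≤ k
  g≤k = ≮⇒≥ λ k<g → <⇒≱ (*-mono-< k<g k<g) (cancelʳ n 1≤n (begin
    g * g * n     ≡⟨ *-comm (g * g) n ⟩
    n * (g * g)   ≤⟨ *-monoˡ-≤ (g * g) n≤m ⟩
    m * (g * g)   ≤⟨ m*g²≤k²n ⟩
    k * k * n     ∎))

  1≤k : 1 ≤ k
  1≤k = ≤-trans 1≤g g≤k

  n≤2^βg² : n ≤ 2 ^ (β * (g * g))
  n≤2^βg² = cancelʳ (K ^ suc i) (^-pos (suc i) 1≤K) (begin
    n * K ^ suc i                      ≤⟨ upper-n ⟩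
    Q ^ suc i                          ≤⟨ ^-monoˡ-≤ (suc i) (+-mono-≤ 1≤K (m≤m+n K 0)) ⟩
    (2 * K) ^ suc i                    ≡⟨ ^-distribʳ-* (suc i) 2 K ⟩
    2 ^ suc i * K ^ suc i              ≤⟨ *-monoˡ-≤ (K ^ suc i) (^-monoʳ (s≤s z≤n) exponent) ⟩
    2 ^ (β * (g * g)) * K ^ suc i      ∎)
    where
    -- The origin of `β`: (g+1)² ≤ 4g² and 1 ≤ g².
    exponent : suc i ≤ β * (g * g)
    exponent = begin
      suc i                              ≤⟨ s≤s i≤ ⟩
      1 + suc g * suc g * Q              ≤⟨ +-mono-≤ (*-mono-≤ 1≤g 1≤g) (*-monoˡ-≤ Q (*-mono-≤ sg≤2g sg≤2g)) ⟩
      g * g + (g + g) * (g + g) * Q      ≡⟨ lemma g Q ⟩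
      (4 * Q + 1) * (g * g)              ≡⟨ cong (_* (g * g)) β≡ ⟨
      β * (g * g)                        ∎
      where
      sg≤2g : suc g ≤ g + g
      sg≤2g = +-monoˡ-≤ g 1≤g
      lemma : ∀ g Q → g * g + (g + g) * (g + g) * Q ≡ (4 * Q + 1) * (g * g)
      lemma = solve-∀

  -- k²/m is at most 32g²/n, and n ≥ 2^(g²) outgrows every power of `g`.
  c*k²≤m : ∀ c → 32 * c ≤ g → c * (k * k) ≤ m
  c*k²≤m c 32c≤g = cancelʳ (32 * (g * g)) (*-mono-≤ (s≤s (z≤n {31})) (*-mono-≤ 1≤g 1≤g)) (begin
    c * (k * k) * (32 * (g * g))       ≡⟨ lemma c k g ⟩
    k * k * (32 * c * (g * g))         ≤⟨ *-monoʳ-≤ (k * k) growth ⟩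
    k * k * n                          ≤⟨ k²≤ ⟩
    32 * (m * (g * g))                 ≡⟨ lemma′ m g ⟩
    m * (32 * (g * g))                 ∎)
    where
    lemma : ∀ c k g → c * (k * k) * (32 * (g * g)) ≡ k * k * (32 * c * (g * g))
    lemma = solve-∀
    lemma′ : ∀ m g → 32 * (m * (g * g)) ≡ m * (32 * (g * g))
    lemma′ = solve-∀
    4≤g : 4 ≤ g
    4≤g = ≤-trans (subst (λ x → 4 ≤ suc x) (sym K≡) (s≤s (s≤s (s≤s (s≤s z≤n))))) g≥K
    growth : 32 * c * (g * g) ≤ n
    growth = begin
      32 * c * (g * g)         ≤⟨ *-monoˡ-≤ (g * g) 32c≤g ⟩
      g * (g * g)              ≤⟨ *-monoˡ-≤ (g * g) (m≤m*n g g {{>-nonZero 1≤g}}) ⟩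
      g * g * (g * g)          ≤⟨ *-mono-≤ (*-mono-≤ (n≤2^n g) (n≤2^n g)) (*-mono-≤ (n≤2^n g) (n≤2^n g)) ⟩
      2 ^ g * 2 ^ g * (2 ^ g * 2 ^ g) ≡⟨ lemma″ (2 ^ g) ⟩
      (2 ^ g) ^ 4              ≡⟨ ^-*-assoc 2 g 4 ⟩
      2 ^ (g * 4)              ≤⟨ ^-monoʳ (s≤s z≤n) (*-monoʳ-≤ g 4≤g) ⟩
      2 ^ (g * g)              ≤⟨ 2^g²≤n ⟩
      n                        ∎
      where
      lemma″ : ∀ x → x * x * (x * x) ≡ x * (x * (x * (x * 1)))
      lemma″ = solve-∀

  c*k≤m : ∀ c → 32 * c ≤ g → c * k ≤ m
  c*k≤m c h = ≤-trans (*-monoʳ-≤ c (m≤m*n k k {{>-nonZero 1≤k}})) (c*k²≤m c h)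

  H≤m : H ≤ m
  H≤m = ≤-trans (m≤m*n H k {{>-nonZero 1≤k}}) (c*k≤m H (≤-trans (*-monoʳ-≤ 32 (m≤n+m H (8 * R * K))) g≥c))

  8RKk≤m : 8 * R * K * k ≤ m
  8RKk≤m = c*k≤m (8 * R * K) (≤-trans (*-monoʳ-≤ 32 (m≤m+n (8 * R * K) H)) g≥c)

  k≤m : k ≤ m
  k≤m = ≤-trans (≤-trans (≤-reflexive (sym (*-identityˡ k))) (*-monoˡ-≤ k (*-mono-≤ (*-mono-≤ (s≤s (z≤n {7})) 1≤R) 1≤K))) 8RKk≤m

  -- Here the excess `1 + 1/R` is spent. A factor (K/Q)² is lost in `M`, and a third K/Q because log
  -- n is only known to be at least i/Q whereas decay is measured in steps of 1/K. `K` satisfies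
  -- (K/Q)³(1 + 1/R) ≥ 1 + 1/(2R), and the 1/(2R) is left for the terms of lower order.
  log-decay : ∀ M → Q * Q * M ≥ K * K * (k * n) → n * G * (m ∸ k) ^ M ≤ m ^ M
  log-decay M M≥ = decay {j = suc i + K * γ} {M} {n * G} 1≤K 1≤k k≤m
    (cancelˡ (R * (Q * (Q * Q))) (*-mono-≤ 1≤R (s≤s z≤n)) (begin
      R * (Q * (Q * Q)) * ((suc i + K * γ) * (m + k * K))      ≡⟨ lemma₁ R Q (suc i + K * γ) m (k * K) ⟩
      Q * Q * (Q * (R * ((suc i + K * γ) * (m + k * K))))       ≤⟨ *-monoʳ-≤ (Q * Q) main ⟩
      Q * Q * ((Q * R + 3 * suc R) * (m * i))                  ≡⟨ *-assoc (Q * Q) (Q * R + 3 * suc R) (m * i) ⟨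
      Q * Q * (Q * R + 3 * suc R) * (m * i)                    ≤⟨ *-monoˡ-≤ (m * i) cube ⟩
      K * (K * K) * suc R * (m * i)                            ≡⟨ *-assoc (K * (K * K)) (suc R) (m * i) ⟩
      K * (K * K) * (suc R * (m * i))                          ≤⟨ *-monoʳ-≤ (K * (K * K)) k²≥ ⟩
      K * (K * K) * (R * (Q * (k * k * n)))                    ≡⟨ lemma₂ K R Q k n ⟩
      R * Q * (K * k) * (K * K * (k * n))                      ≤⟨ *-monoʳ-≤ (R * Q * (K * k)) M≥ ⟩
      R * Q * (K * k) * (Q * Q * M)                            ≡⟨ lemma₃ R Q K k M ⟩
      R * (Q * (Q * Q)) * (M * (k * K))                        ∎))
    (begin
      n * G * K ^ (suc i + K * γ)             ≡⟨ cong (n * G *_) (^-distribˡ-+-* K (suc i) (K * γ)) ⟩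
      n * G * (K ^ suc i * K ^ (K * γ))       ≡⟨ interchange n G (K ^ suc i) (K ^ (K * γ)) ⟩
      n * K ^ suc i * (G * K ^ (K * γ))       ≤⟨ *-mono-≤ upper-n (2K^K≤[1+K]^K K γ 1≤K) ⟩
      Q ^ suc i * Q ^ (K * γ)                 ≡⟨ ^-distribˡ-+-* Q (suc i) (K * γ) ⟨
      Q ^ (suc i + K * γ)                     ∎)
    where
    -- The excess of the exponent over `i`: 1 for rounding the logarithm up, `K * γ` for the factor
    -- `G`.
    e = 1 + K * γ
    lemma₁ : ∀ R Q j m x → R * (Q * (Q * Q)) * (j * (m + x)) ≡ Q * Q * (Q * (R * (j * (m + x))))
    lemma₁ = solve-∀
    lemma₂ : ∀ K R Q k n → K * (K * K) * (R * (Q * (k * k * n))) ≡ R * Q * (K * k) * (K * K * (k * n))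
    lemma₂ = solve-∀
    lemma₃ : ∀ R Q K k M → R * Q * (K * k) * (Q * Q * M) ≡ R * (Q * (Q * Q)) * (M * (k * K))
    lemma₃ = solve-∀
    -- As Q = 6(R+1), the summand `3 * suc R` is the fraction 1/(2R) of QR.
    cube : Q * Q * (Q * R + 3 * suc R) ≤ K * (K * K) * suc R
    cube = subst (λ K → suc K * suc K * (suc K * R + 3 * suc R) ≤ K * (K * K) * suc R) (sym K≡)
      (≤-trans (m≤m+n _ (suc R * (17 + 18 * R))) (≤-reflexive (lemma R)))
      where
      lemma : ∀ R → suc (5 + 6 * R) * suc (5 + 6 * R) * (suc (5 + 6 * R) * R + 3 * suc R) + suc R * (17 + 18 * R)
                  ≡ (5 + 6 * R) * ((5 + 6 * R) * (5 + 6 * R)) * suc R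
      lemma = solve-∀
    4Re≤i : 4 * R * e ≤ i
    4Re≤i = ≤-trans g≥e (≤-trans (m≤m*n g g {{>-nonZero 1≤g}}) (≤-trans (m≤m*n (g * g) Q) i≥))
    e≤i : e ≤ i
    e≤i = ≤-trans (≤-trans (≤-reflexive (sym (*-identityˡ e))) (*-monoˡ-≤ e (*-mono-≤ (s≤s (z≤n {3})) 1≤R))) 4Re≤i
    -- These are the terms of (i+e)(m+kK) other than mi. With e ≤ i/(4R) and kK ≤ m/(8R) they amount
    -- to at most mi/(2R).
    extra : 4 * R * (e * m + (i + e) * (k * K)) ≤ 2 * (m * i)
    extra = begin
      4 * R * (e * m + (i + e) * (k * K))          ≤⟨ *-monoʳ-≤ (4 * R) (+-monoʳ-≤ (e * m) (*-monoˡ-≤ (k * K) (+-monoʳ-≤ i e≤i))) ⟩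
      4 * R * (e * m + (i + i) * (k * K))          ≡⟨ lemma R e m i k K ⟩
      4 * R * e * m + 8 * R * K * k * i            ≤⟨ +-mono-≤ (*-monoˡ-≤ m 4Re≤i) (*-monoˡ-≤ i 8RKk≤m) ⟩
      i * m + m * i                                ≡⟨ lemma′ i m ⟩
      2 * (m * i)                                  ∎
      where
      lemma : ∀ R e m i k K → 4 * R * (e * m + (i + i) * (k * K)) ≡ 4 * R * e * m + 8 * R * K * k * i
      lemma = solve-∀
      lemma′ : ∀ i m → i * m + m * i ≡ 2 * (m * i)
      lemma′ = solve-∀
    main : Q * (R * ((suc i + K * γ) * (m + k * K))) ≤ (Q * R + 3 * suc R) * (m * i)
    main = *-cancelˡ-≤ 2 (begin
      2 * (Q * (R * ((suc i + K * γ) * (m + k * K))))       ≡⟨ cong (λ K′ → 2 * (suc K′ * (R * ((suc i + K * γ) * (m + k * K))))) K≡ ⟩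
      2 * ((6 + 6 * R) * (R * ((suc i + K * γ) * (m + k * K))))   ≡⟨ lemma R i (K * γ) m (k * K) ⟩
      2 * ((6 + 6 * R) * R * (m * i)) + 3 * suc R * (4 * R * (e * m + (i + e) * (k * K)))
                                                            ≤⟨ +-monoʳ-≤ (2 * ((6 + 6 * R) * R * (m * i))) (*-monoʳ-≤ (3 * suc R) extra) ⟩
      2 * ((6 + 6 * R) * R * (m * i)) + 3 * suc R * (2 * (m * i))  ≡⟨ lemma′ R (m * i) ⟩
      2 * (((6 + 6 * R) * R + 3 * suc R) * (m * i))         ≡⟨ cong (λ K → 2 * ((suc K * R + 3 * suc R) * (m * i))) K≡ ⟨
      2 * ((Q * R + 3 * suc R) * (m * i))                   ∎)
      where
      lemma : ∀ R i x m y → 2 * ((6 + 6 * R) * (R * ((suc i + x) * (m + y)))) ≡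
              2 * ((6 + 6 * R) * R * (m * i)) + 3 * suc R * (4 * R * ((1 + x) * m + (i + (1 + x)) * y))
      lemma = solve-∀
      lemma′ : ∀ R x → 2 * ((6 + 6 * R) * R * x) + 3 * suc R * (2 * x) ≡ 2 * (((6 + 6 * R) * R + 3 * suc R) * x)
      lemma′ = solve-∀

  ^-regroup : ∀ x s u r → (x ^ (s * u)) ^ r ≡ (x ^ (u * r)) ^ s
  ^-regroup x s u r = trans (^-*-assoc x (s * u) r)
    (trans (cong (x ^_) (trans (*-assoc s u r) (*-comm s (u * r)))) (sym (^-*-assoc x (u * r) s)))

  Bounds : ℕ → ℕ → Set
  Bounds w s =
      w ≤ m
    × binom n s * (binom m w * binom w k ^ s) * G ^ s ≤ binom m k ^ s
    × binom n s * binom (m ∸ w) k ^ (n ∸ s) * G ^ s ≤ binom m k ^ (n ∸ s)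

  -- The colours per node that are given up. For w = su one has w^(ks) = w^w w^(ds); after C(m,w)
  -- w^w ≤ (4m)^w it is (w/m)^(ds) that has to beat everything else.
  d = k / Q
  u = k ∸ d

  d≤k : d ≤ k
  d≤k = ≤-trans (m≤m*n d Q) (m/n*n≤m k Q)

  u+d≡k : u + d ≡ k
  u+d≡k = m∸n+n≡m d≤k

  k≤2Qd : k ≤ 2 * Q * d
  k≤2Qd = begin
    k              ≤⟨ <⇒≤ (m<[1+m/n]*n k Q) ⟩
    suc d * Q      ≤⟨ *-monoˡ-≤ Q (+-monoˡ-≤ d 1≤d) ⟩
    (d + d) * Q    ≡⟨ lemma d Q ⟩
    2 * Q * d      ∎
    where
    lemma : ∀ d Q → (d + d) * Q ≡ 2 * Q * d
    lemma = solve-∀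
    1≤d : 1 ≤ d
    1≤d = n≢0⇒n>0 λ d≡0 → <⇒≱ (subst (λ x → k < suc x * Q) d≡0 (m<[1+m/n]*n k Q)) (≤-trans (≤-reflexive (*-identityˡ Q)) (≤-trans g≥K g≤k))

  g≤gk : g ≤ g * k
  g≤gk = m≤m*n g k {{>-nonZero 1≤k}}

  γ≤g : γ ≤ g
  γ≤g = ≤-trans (m≤m+n γ 2) g≥γ+2

  -- Per node of S the first alternative costs n G 4^u (w/m)^d, where w/m ≤ 2^(-bg). In the second,
  -- u ≥ (K/Q)k and n - s ≥ (K/Q)n, as `log-decay` requires.
  small : ∀ s → 1 ≤ s → s * 2 ^ (2 * b * g) ≤ n → Bounds (s * u) s
  small s 1≤s few = su≤m , within-reduction {n} {m} {k} {s * u} {s} {G} 1≤m su≤m within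
                         , avoiding-reduction {n} {m} {k} {s * u} {s} {n ∸ s} {G} 1≤m su≤m avoiding
    where
    b≥6 : 6 ≤ b
    b≥6 = subst (6 ≤_) (sym b≡) (≤-trans (*-mono-≤ {3} {β + 3} {2} {2 * Q} (m≤n+m 3 β) (*-monoʳ-≤ 2 (s≤s z≤n))) ≤-refl)
    2^bg-square : 2 ^ (2 * b * g) ≡ 2 ^ (b * g) * 2 ^ (b * g)
    2^bg-square = trans (cong (2 ^_) (lemma b g)) (^-distribˡ-+-* 2 (b * g) (b * g))
      where
      lemma : ∀ b g → 2 * b * g ≡ b * g + b * g
      lemma = solve-∀
    32g≤2^bg : 32 * g ≤ 2 ^ (b * g)
    32g≤2^bg = begin
      32 * g             ≤⟨ *-mono-≤ (^-monoʳ {2} {5} {5 * g} (s≤s z≤n) (*-monoʳ-≤ 5 1≤g)) (n≤2^n g) ⟩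
      2 ^ (5 * g) * 2 ^ g ≡⟨ ^-distribˡ-+-* 2 (5 * g) g ⟨
      2 ^ (5 * g + g)    ≡⟨ cong (2 ^_) (+-comm (5 * g) g) ⟩
      2 ^ (6 * g)        ≤⟨ ^-monoʳ (s≤s z≤n) (*-monoˡ-≤ g b≥6) ⟩
      2 ^ (b * g)        ∎
    -- k²n ≤ 32mg² and g ≤ k give kn ≤ 32gm. One of the two factors 2^(bg) in `few` absorbs 32g, the
    -- other is kept.
    rare : s * k * 2 ^ (b * g) ≤ m
    rare = cancelʳ (g * 2 ^ (b * g)) (*-mono-≤ 1≤g (^-pos (b * g) (s≤s z≤n))) (begin
      s * k * x * (g * x)              ≡⟨ lemma s k x g ⟩
      s * (x * x) * (k * g)            ≤⟨ *-mono-≤ (subst (λ y → s * y ≤ n) 2^bg-square few) (*-monoʳ-≤ k g≤k) ⟩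
      n * (k * k)                      ≡⟨ *-comm n (k * k) ⟩
      k * k * n                        ≤⟨ k²≤ ⟩
      32 * (m * (g * g))               ≡⟨ lemma′ m g ⟩
      m * (g * (32 * g))               ≤⟨ *-monoʳ-≤ m (*-monoʳ-≤ g 32g≤2^bg) ⟩
      m * (g * x)                      ∎)
      where
      x = 2 ^ (b * g)
      lemma : ∀ s k x g → s * k * x * (g * x) ≡ s * (x * x) * (k * g)
      lemma = solve-∀
      lemma′ : ∀ m g → 32 * (m * (g * g)) ≡ m * (g * (32 * g))
      lemma′ = solve-∀
    w = s * u
    w≤sk : w ≤ s * k
    w≤sk = *-monoʳ-≤ s (m∸n≤m k d)
    su≤m : w ≤ m
    su≤m = ≤-trans w≤sk (≤-trans (m≤m*n (s * k) (2 ^ (b * g)) {{>-nonZero (^-pos (b * g) (s≤s z≤n))}}) rare)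
    exponents : n * G * 4 ^ u ≤ 2 ^ (b * g * d)
    exponents = begin
      n * G * 4 ^ u                                     ≤⟨ *-mono-≤ (*-mono-≤ n≤2^βg² (^-monoʳ {2} (s≤s z≤n) (≤-trans γ≤g g≤gk))) (^-monoʳ {4} (s≤s z≤n) (m∸n≤m k d)) ⟩
      2 ^ (β * (g * g)) * 2 ^ (g * k) * 4 ^ k           ≡⟨ cong (2 ^ (β * (g * g)) * 2 ^ (g * k) *_) (^-*-assoc 2 2 k) ⟩
      2 ^ (β * (g * g)) * 2 ^ (g * k) * 2 ^ (2 * k)     ≡⟨ cong (_* 2 ^ (2 * k)) (^-distribˡ-+-* 2 (β * (g * g)) (g * k)) ⟨
      2 ^ (β * (g * g) + g * k) * 2 ^ (2 * k)           ≡⟨ ^-distribˡ-+-* 2 (β * (g * g) + g * k) (2 * k) ⟨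
      2 ^ (β * (g * g) + g * k + 2 * k)                 ≤⟨ ^-monoʳ (s≤s z≤n) sum ⟩
      2 ^ (b * g * d)                                   ∎
      where
      -- The origin of `b`: by g ≤ k all terms are bounded by multiples of gk, and k ≤ 2Qd turns gk
      -- into gd.
      sum : β * (g * g) + g * k + 2 * k ≤ b * g * d
      sum = begin
        β * (g * g) + g * k + 2 * k                     ≤⟨ +-mono-≤ (+-monoˡ-≤ (g * k) (*-monoʳ-≤ β (*-monoʳ-≤ g g≤k))) (*-monoʳ-≤ 2 (m≤n*m k g {{>-nonZero 1≤g}})) ⟩
        β * (g * k) + g * k + 2 * (g * k)               ≡⟨ lemma β (g * k) ⟩
        (β + 3) * (g * k)                               ≤⟨ *-monoʳ-≤ (β + 3) (*-monoʳ-≤ g k≤2Qd) ⟩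
        (β + 3) * (g * (2 * Q * d))                     ≡⟨ lemma′ (β + 3) g (2 * Q) d ⟩
        (β + 3) * (2 * Q) * g * d                       ≡⟨ cong (λ x → x * g * d) b≡ ⟨
        b * g * d                                       ∎
        where
        lemma : ∀ β x → β * x + x + 2 * x ≡ (β + 3) * x
        lemma = solve-∀
        lemma′ : ∀ β g q d → β * (g * (q * d)) ≡ β * q * g * d
        lemma′ = solve-∀
    per-node : n * G * ((4 * m) ^ u * w ^ d) ≤ m ^ k
    per-node = begin
      n * G * ((4 * m) ^ u * w ^ d)         ≡⟨ cong (λ x → n * G * (x * w ^ d)) (^-distribʳ-* u 4 m) ⟩
      n * G * (4 ^ u * m ^ u * w ^ d)       ≡⟨ lemma (n * G) (4 ^ u) (m ^ u) (w ^ d) ⟩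
      m ^ u * (n * G * 4 ^ u * w ^ d)       ≤⟨ *-monoʳ-≤ (m ^ u) (*-mono-≤ exponents (^-monoˡ-≤ d w≤sk)) ⟩
      m ^ u * (2 ^ (b * g * d) * (s * k) ^ d)   ≡⟨ cong (λ x → m ^ u * (x * (s * k) ^ d)) (^-*-assoc 2 (b * g) d) ⟨
      m ^ u * ((2 ^ (b * g)) ^ d * (s * k) ^ d) ≡⟨ cong (m ^ u *_) (trans (*-comm ((2 ^ (b * g)) ^ d) _) (sym (^-distribʳ-* d (s * k) (2 ^ (b * g))))) ⟩
      m ^ u * (s * k * 2 ^ (b * g)) ^ d     ≤⟨ *-monoʳ-≤ (m ^ u) (^-monoˡ-≤ d rare) ⟩
      m ^ u * m ^ d                         ≡⟨ ^-distribˡ-+-* m u d ⟨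
      m ^ (u + d)                           ≡⟨ cong (m ^_) u+d≡k ⟩
      m ^ k                                 ∎
      where
      lemma : ∀ x a b c → x * (a * b * c) ≡ b * (x * a * c)
      lemma = solve-∀
    within : binom n s * (binom m w * (w ^ k) ^ s) * G ^ s ≤ (m ^ k) ^ s
    within = begin
      binom n s * (binom m w * (w ^ k) ^ s) * G ^ s               ≡⟨ cong (λ x → binom n s * (binom m w * x) * G ^ s) split ⟩
      binom n s * (binom m w * (w ^ w * (w ^ d) ^ s)) * G ^ s     ≡⟨ lemma (binom n s) (binom m w) (w ^ w) ((w ^ d) ^ s) (G ^ s) ⟩
      binom n s * G ^ s * (binom m w * w ^ w * (w ^ d) ^ s)       ≤⟨ *-mono-≤ (*-monoˡ-≤ (G ^ s) (binom≤n^s n s)) (*-monoˡ-≤ ((w ^ d) ^ s) (binom-upper m w)) ⟩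
      n ^ s * G ^ s * ((4 * m) ^ w * (w ^ d) ^ s)                 ≡⟨ cong₂ (λ x y → x * (y * (w ^ d) ^ s)) (sym (^-distribʳ-* s n G)) (trans (cong ((4 * m) ^_) (*-comm s u)) (sym (^-*-assoc (4 * m) u s))) ⟩
      (n * G) ^ s * (((4 * m) ^ u) ^ s * (w ^ d) ^ s)             ≡⟨ cong ((n * G) ^ s *_) (^-distribʳ-* s ((4 * m) ^ u) (w ^ d)) ⟨
      (n * G) ^ s * ((4 * m) ^ u * w ^ d) ^ s                     ≡⟨ ^-distribʳ-* s (n * G) _ ⟨
      (n * G * ((4 * m) ^ u * w ^ d)) ^ s                         ≤⟨ ^-monoˡ-≤ s per-node ⟩
      (m ^ k) ^ s                                                 ∎
      where
      lemma : ∀ a b c d e → a * (b * (c * d)) * e ≡ a * e * (b * c * d)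
      lemma = solve-∀
      split : (w ^ k) ^ s ≡ w ^ w * (w ^ d) ^ s
      split = begin-equality
        (w ^ k) ^ s                  ≡⟨ cong (λ x → (w ^ x) ^ s) u+d≡k ⟨
        (w ^ (u + d)) ^ s            ≡⟨ cong (_^ s) (^-distribˡ-+-* w u d) ⟩
        (w ^ u * w ^ d) ^ s          ≡⟨ ^-distribʳ-* s (w ^ u) (w ^ d) ⟩
        (w ^ u) ^ s * (w ^ d) ^ s    ≡⟨ cong (_* (w ^ d) ^ s) (trans (^-*-assoc w u s) (cong (w ^_) (*-comm u s))) ⟩
        w ^ w * (w ^ d) ^ s          ∎
    Qs≤n : Q * s ≤ n
    Qs≤n = begin
      Q * s                    ≡⟨ *-comm Q s ⟩
      s * Q                    ≤⟨ *-monoʳ-≤ s (≤-trans g≥K (≤-trans (n≤2^n g) (^-monoʳ {2} (s≤s z≤n) (m≤n*m g (2 * b) {{>-nonZero (≤-trans (s≤s z≤n) (≤-trans b≥6 (m≤m+n b (b + 0))))}})))) ⟩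
      s * 2 ^ (2 * b * g)      ≤⟨ few ⟩
      n                        ∎
    most : Q * Q * (u * (n ∸ s)) ≥ K * K * (k * n)
    most = begin
      K * K * (k * n)                ≡⟨ interchange K K k n ⟩
      K * k * (K * n)                ≤⟨ *-mono-≤ (Kx≤ k d (≤-trans (≤-reflexive (*-comm Q d)) (m/n*n≤m k Q))) (Kx≤ n s Qs≤n) ⟩
      Q * u * (Q * (n ∸ s))          ≡⟨ interchange Q u Q (n ∸ s) ⟩
      Q * Q * (u * (n ∸ s))          ∎
      where
      Kx≤ : ∀ x y → Q * y ≤ x → K * x ≤ Q * (x ∸ y)
      Kx≤ x y h = begin
        K * x                ≡⟨ m+n∸m≡n x (K * x) ⟨
        x + K * x ∸ x        ≤⟨ ∸-monoʳ-≤ (Q * x) h ⟩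
        Q * x ∸ Q * y        ≡⟨ *-distribˡ-∸ Q x y ⟨
        Q * (x ∸ y)          ∎
    avoiding : binom n s * ((m ∸ k) ^ w) ^ (n ∸ s) * G ^ s ≤ (m ^ w) ^ (n ∸ s)
    avoiding = begin
      binom n s * ((m ∸ k) ^ w) ^ (n ∸ s) * G ^ s        ≤⟨ *-monoˡ-≤ (G ^ s) (*-mono-≤ (binom≤n^s n s) (≤-reflexive (^-regroup (m ∸ k) s u (n ∸ s)))) ⟩
      n ^ s * ((m ∸ k) ^ M) ^ s * G ^ s                  ≡⟨ xy∙z≈xz∙y (n ^ s) (((m ∸ k) ^ M) ^ s) (G ^ s) ⟩
      n ^ s * G ^ s * ((m ∸ k) ^ M) ^ s                  ≡⟨ cong (_* ((m ∸ k) ^ M) ^ s) (^-distribʳ-* s n G) ⟨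
      (n * G) ^ s * ((m ∸ k) ^ M) ^ s                    ≡⟨ ^-distribʳ-* s (n * G) _ ⟨
      (n * G * (m ∸ k) ^ M) ^ s                          ≤⟨ ^-monoˡ-≤ s (log-decay M most) ⟩
      (m ^ M) ^ s                                        ≡⟨ ^-regroup m s u (n ∸ s) ⟨
      (m ^ w) ^ (n ∸ s)                                  ∎
      where
      M = u * (n ∸ s)

  1≤H : 1 ≤ H
  1≤H = subst (1 ≤_) (sym H≡) (^-pos (4 * b + 8) (s≤s z≤n))

  instance
    H-nonZero : NonZero H
    H-nonZero = >-nonZero 1≤H

  -- Now C(n,s) G^s ≤ 2^(js) with `j` only of order `g`, while log n is of order g², so estimates to
  -- base 2 suffice. The cap `m / H` keeps w/m small even when sk exceeds m.
  large : ∀ s → 1 ≤ s → s + s ≤ n → n ≤ s * 2 ^ (2 * b * g) → Bounds (s * (k / H) ⊓ (m / H)) s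
  large s 1≤s half many = w≤m , within-reduction {n} {m} {k} {w} {s} {G} 1≤m w≤m within
                              , avoiding-reduction {n} {m} {k} {w} {s} {n ∸ s} {G} 1≤m w≤m avoiding
    where
    v = k / H
    w = s * v ⊓ (m / H)
    j = 2 * b * g + (2 + γ)
    X = 2 ^ (2 * b * g + 2)
    w*H≤m : w * H ≤ m
    w*H≤m = ≤-trans (*-monoˡ-≤ H (m⊓n≤n (s * v) (m / H))) (m/n*n≤m m H)
    w≤m : w ≤ m
    w≤m = ≤-trans (m≤m*n w H) w*H≤m
    w*H≤sk : w * H ≤ s * k
    w*H≤sk = begin
      w * H        ≤⟨ *-monoˡ-≤ H (m⊓n≤m (s * v) (m / H)) ⟩
      s * v * H    ≡⟨ *-assoc s v H ⟩
      s * (v * H)  ≤⟨ *-monoʳ-≤ s (m/n*n≤m k H) ⟩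
      s * k        ∎
    H≤g : 8 * H ≤ g
    H≤g = ≤-trans (m≤m*n (8 * H) (2 * b + 2 + γ) {{>-nonZero (≤-trans (s≤s z≤n) (m≤n⇒m≤n+o γ (m≤n+m 2 (2 * b))))}}) g≥H
    XG≡ : X * G ≡ 2 ^ j
    XG≡ = trans (sym (^-distribˡ-+-* 2 (2 * b * g + 2) γ)) (cong (2 ^_) (+-assoc (2 * b * g) 2 γ))
    binom≤X^s : binom n s ≤ X ^ s
    binom≤X^s = cancelʳ (s ^ s) (^-pos s 1≤s) (begin
      binom n s * s ^ s              ≤⟨ binom-upper n s ⟩
      (4 * n) ^ s                    ≤⟨ ^-monoˡ-≤ s (*-monoʳ-≤ 4 many) ⟩
      (4 * (s * 2 ^ (2 * b * g))) ^ s ≡⟨ cong (_^ s) (trans (lemma s (2 ^ (2 * b * g))) (cong (_* s) (sym (^-distribˡ-+-* 2 (2 * b * g) 2)))) ⟩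
      (X * s) ^ s                    ≡⟨ ^-distribʳ-* s X s ⟩
      X ^ s * s ^ s                  ∎)
      where
      lemma : ∀ s x → 4 * (s * x) ≡ x * 4 * s
      lemma = solve-∀
    binom*G≤ : binom n s * G ^ s ≤ (2 ^ j) ^ s
    binom*G≤ = begin
      binom n s * G ^ s    ≤⟨ *-monoˡ-≤ (G ^ s) binom≤X^s ⟩
      X ^ s * G ^ s        ≡⟨ ^-distribʳ-* s X G ⟨
      (X * G) ^ s          ≡⟨ cong (_^ s) XG≡ ⟩
      (2 ^ j) ^ s          ∎
    within : binom n s * (binom m w * (w ^ k) ^ s) * G ^ s ≤ (m ^ k) ^ s
    within = begin
      binom n s * (binom m w * (w ^ k) ^ s) * G ^ s        ≡⟨ lemma₁ (binom n s) (binom m w) ((w ^ k) ^ s) (G ^ s) ⟩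
      binom n s * G ^ s * (binom m w * (w ^ k) ^ s)        ≤⟨ *-mono-≤ (≤-trans binom*G≤ (^-monoˡ-≤ s 2^j≤h^k)) (≤-reflexive (cong (binom m w *_) (power w))) ⟩
      (h ^ k) ^ s * (binom m w * (w ^ w * w ^ r))          ≡⟨ cong (_* (binom m w * (w ^ w * w ^ r))) (power h) ⟩
      h ^ w * h ^ r * (binom m w * (w ^ w * w ^ r))        ≡⟨ lemma₂ (h ^ w) (h ^ r) (binom m w) (w ^ w) (w ^ r) ⟩
      binom m w * w ^ w * (h ^ w * h ^ r * w ^ r)          ≤⟨ *-mono-≤ (binom-upper m w) (*-monoˡ-≤ (w ^ r) (*-monoˡ-≤ (h ^ r) (^-monoʳ 1≤h w≤r))) ⟩
      (4 * m) ^ w * (h ^ r * h ^ r * w ^ r)                ≡⟨ cong (_* (h ^ r * h ^ r * w ^ r)) (^-distribʳ-* w 4 m) ⟩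
      4 ^ w * m ^ w * (h ^ r * h ^ r * w ^ r)              ≤⟨ *-monoˡ-≤ (h ^ r * h ^ r * w ^ r) (*-monoˡ-≤ (m ^ w) (^-monoʳ (s≤s z≤n) w≤r)) ⟩
      4 ^ r * m ^ w * (h ^ r * h ^ r * w ^ r)              ≡⟨ lemma₃ (4 ^ r) (m ^ w) (h ^ r) (w ^ r) ⟩
      m ^ w * (4 ^ r * (h ^ r * h ^ r) * w ^ r)            ≡⟨ cong (m ^ w *_) joined ⟨
      m ^ w * (w * H) ^ r                                  ≤⟨ *-monoʳ-≤ (m ^ w) (^-monoˡ-≤ r w*H≤m) ⟩
      m ^ w * m ^ r                                        ≡⟨ power m ⟨
      (m ^ k) ^ s                                          ∎
      where
      -- H = 4h². As w ≤ r, the factor C(n,s) G^s ≤ h^(ks) is at most h^(2r), and the 4^w from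
      -- `binom-upper` is at most 4^r; (wH)^r ≤ m^r covers both.
      h = 2 ^ (2 * b + 3)
      r = k * s ∸ w
      1≤h : 1 ≤ h
      1≤h = ^-pos (2 * b + 3) (s≤s z≤n)
      2w≤ks : w + w ≤ k * s
      2w≤ks = begin
        w + w      ≡⟨ cong (w +_) (+-identityʳ w) ⟨
        2 * w      ≡⟨ *-comm 2 w ⟩
        w * 2      ≤⟨ *-monoʳ-≤ w (≤-trans (^-monoʳ {2} {1} {4 * b + 8} (s≤s z≤n) (≤-trans (s≤s z≤n) (m≤n+m 8 (4 * b)))) (≤-reflexive (sym H≡))) ⟩
        w * H      ≤⟨ w*H≤sk ⟩
        s * k      ≡⟨ *-comm s k ⟩
        k * s      ∎
      w≤r : w ≤ r
      w≤r = ≤-trans (≤-reflexive (sym (m+n∸n≡m w w))) (∸-monoˡ-≤ w 2w≤ks)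
      power : ∀ x → (x ^ k) ^ s ≡ x ^ w * x ^ r
      power x = trans (^-*-assoc x k s) (trans (cong (x ^_) (sym (m+[n∸m]≡n (≤-trans (m≤m+n w w) 2w≤ks)))) (^-distribˡ-+-* x w r))
      2^j≤h^k : 2 ^ j ≤ h ^ k
      2^j≤h^k = begin
        2 ^ j                   ≤⟨ ^-monoʳ (s≤s z≤n) (begin
          2 * b * g + (2 + γ)   ≤⟨ +-mono-≤ (*-monoʳ-≤ (2 * b) g≤k) (≤-trans (≤-reflexive (+-comm 2 γ)) (≤-trans g≥γ+2 (≤-trans g≤k (m≤m+n k (2 * k))))) ⟩
          2 * b * k + 3 * k     ≡⟨ *-distribʳ-+ k (2 * b) 3 ⟨
          (2 * b + 3) * k       ∎) ⟩
        2 ^ ((2 * b + 3) * k)   ≡⟨ ^-*-assoc 2 (2 * b + 3) k ⟨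
        h ^ k                   ∎
      joined : (w * H) ^ r ≡ 4 ^ r * (h ^ r * h ^ r) * w ^ r
      joined = begin-equality
        (w * H) ^ r                        ≡⟨ cong (λ x → (w * x) ^ r) (trans H≡ (trans (cong (2 ^_) (lemma b)) (trans (^-distribˡ-+-* 2 2 (2 * b + 3 + (2 * b + 3))) (cong (4 *_) (^-distribˡ-+-* 2 (2 * b + 3) (2 * b + 3)))))) ⟩
        (w * (4 * (h * h))) ^ r            ≡⟨ ^-distribʳ-* r w (4 * (h * h)) ⟩
        w ^ r * (4 * (h * h)) ^ r          ≡⟨ *-comm (w ^ r) _ ⟩
        (4 * (h * h)) ^ r * w ^ r          ≡⟨ cong (_* w ^ r) (trans (^-distribʳ-* r 4 (h * h)) (cong (4 ^ r *_) (^-distribʳ-* r h h))) ⟩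
        4 ^ r * (h ^ r * h ^ r) * w ^ r    ∎
        where
        lemma : ∀ b → 4 * b + 8 ≡ 2 + (2 * b + 3 + (2 * b + 3))
        lemma = solve-∀
      lemma₁ : ∀ a b c d → a * (b * c) * d ≡ a * d * (b * c)
      lemma₁ = solve-∀
      lemma₂ : ∀ a b c d e → a * b * (c * (d * e)) ≡ c * d * (a * b * e)
      lemma₂ = solve-∀
      lemma₃ : ∀ a b c d → a * b * (c * c * d) ≡ b * (a * (c * c) * d)
      lemma₃ = solve-∀
    quotient : ∀ x → H ≤ x → x ≤ 2 * H * (x / H)
    quotient x H≤x = begin
      x                      ≤⟨ <⇒≤ (m<[1+m/n]*n x H) ⟩
      suc (x / H) * H        ≤⟨ *-monoˡ-≤ H (+-monoˡ-≤ (x / H) 1≤q) ⟩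
      (x / H + x / H) * H    ≡⟨ lemma (x / H) H ⟩
      2 * H * (x / H)        ∎
      where
      1≤q : 1 ≤ x / H
      1≤q = n≢0⇒n>0 λ q≡0 → <⇒≱ (subst (λ q → x < suc q * H) q≡0 (m<[1+m/n]*n x H)) (≤-trans (≤-reflexive (*-identityˡ H)) H≤x)
      lemma : ∀ q H → (q + q) * H ≡ 2 * H * q
      lemma = solve-∀
    n≤2[n∸s] : n ≤ 2 * (n ∸ s)
    n≤2[n∸s] = begin
      n                      ≡⟨ m∸n+n≡m (≤-trans (m≤m+n s s) half) ⟨
      n ∸ s + s              ≤⟨ +-monoʳ-≤ (n ∸ s) (≤-trans (≤-reflexive (sym (m+n∸n≡m s s))) (∸-monoˡ-≤ s half)) ⟩
      n ∸ s + (n ∸ s)        ≡⟨ cong (n ∸ s +_) (+-identityʳ (n ∸ s)) ⟨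
      2 * (n ∸ s)            ∎
    product : ∀ x → H ≤ x → x * n ≤ 4 * H * (x / H * (n ∸ s))
    product x H≤x = ≤-trans (*-mono-≤ (quotient x H≤x) n≤2[n∸s]) (≤-reflexive (lemma H (x / H) (n ∸ s)))
      where
      lemma : ∀ H q r → 2 * H * q * (2 * r) ≡ 4 * H * (q * r)
      lemma = solve-∀
    binary-decay : ∀ M J → 8 * H * J * m ≤ 4 * H * M * k → 2 ^ J * (m ∸ k) ^ M ≤ m ^ M
    binary-decay M J h = decay {k} {m} {1} {J} {M} {2 ^ J} ≤-refl 1≤k k≤m
      (cancelˡ (4 * H) (*-mono-≤ (s≤s (z≤n {3})) 1≤H) (begin
        4 * H * (J * (m + k * 1))     ≤⟨ *-monoʳ-≤ (4 * H) (*-monoʳ-≤ J (+-monoʳ-≤ m (≤-trans (≤-reflexive (*-identityʳ k)) k≤m))) ⟩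
        4 * H * (J * (m + m))         ≡⟨ lemma H J m ⟩
        8 * H * J * m                 ≤⟨ h ⟩
        4 * H * M * k                 ≡⟨ lemma′ H M k ⟩
        4 * H * (M * (k * 1))         ∎))
      (≤-reflexive (trans (cong (2 ^ J *_) (^-zeroˡ J)) (*-identityʳ (2 ^ J))))
      where
      lemma : ∀ H J m → 4 * H * (J * (m + m)) ≡ 8 * H * J * m
      lemma = solve-∀
      lemma′ : ∀ H M k → 4 * H * M * k ≡ 4 * H * (M * (k * 1))
      lemma′ = solve-∀
    -- Mk/m ≥ k²n/(4Hm) ≥ g²/(4H), which is at least 2j because `g` is large compared with `H`.
    avoiding-colours : binom n s * ((m ∸ k) ^ (s * v)) ^ (n ∸ s) * G ^ s ≤ (m ^ (s * v)) ^ (n ∸ s)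
    avoiding-colours = begin
      binom n s * ((m ∸ k) ^ (s * v)) ^ (n ∸ s) * G ^ s      ≡⟨ xy∙z≈xz∙y (binom n s) (((m ∸ k) ^ (s * v)) ^ (n ∸ s)) (G ^ s) ⟩
      binom n s * G ^ s * ((m ∸ k) ^ (s * v)) ^ (n ∸ s)      ≤⟨ *-mono-≤ binom*G≤ (≤-reflexive (^-regroup (m ∸ k) s v (n ∸ s))) ⟩
      (2 ^ j) ^ s * ((m ∸ k) ^ M) ^ s                        ≡⟨ ^-distribʳ-* s (2 ^ j) ((m ∸ k) ^ M) ⟨
      (2 ^ j * (m ∸ k) ^ M) ^ s                              ≤⟨ ^-monoˡ-≤ s (binary-decay M j bound) ⟩
      (m ^ M) ^ s                                            ≡⟨ ^-regroup m s v (n ∸ s) ⟨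
      (m ^ (s * v)) ^ (n ∸ s)                                ∎
      where
      M = v * (n ∸ s)
      j≤ : j ≤ (2 * b + 2 + γ) * g
      j≤ = begin
        2 * b * g + (2 + γ)            ≤⟨ +-monoʳ-≤ (2 * b * g) (m≤m*n (2 + γ) g {{>-nonZero 1≤g}}) ⟩
        2 * b * g + (2 + γ) * g        ≡⟨ *-distribʳ-+ g (2 * b) (2 + γ) ⟨
        (2 * b + (2 + γ)) * g          ≡⟨ cong (_* g) (+-assoc (2 * b) 2 γ) ⟨
        (2 * b + 2 + γ) * g            ∎
      bound : 8 * H * j * m ≤ 4 * H * M * k
      bound = begin
        8 * H * j * m                         ≤⟨ *-monoˡ-≤ m (*-monoʳ-≤ (8 * H) j≤) ⟩
        8 * H * ((2 * b + 2 + γ) * g) * m     ≡⟨ cong (_* m) (*-assoc (8 * H) (2 * b + 2 + γ) g) ⟨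
        8 * H * (2 * b + 2 + γ) * g * m       ≤⟨ *-monoˡ-≤ m (*-monoˡ-≤ g g≥H) ⟩
        g * g * m                             ≡⟨ *-comm (g * g) m ⟩
        m * (g * g)                           ≤⟨ m*g²≤k²n ⟩
        k * k * n                             ≡⟨ xy∙z≈xz∙y k k n ⟩
        k * n * k                             ≤⟨ *-monoˡ-≤ k (product k (≤-trans (m≤n*m H 8) (≤-trans H≤g g≤k))) ⟩
        4 * H * M * k                         ∎
    -- With m/H colours to avoid, even 2^n choices of S and a factor G^n are affordable: Mk/m ≥
    -- kn/(4H) and k ≥ g.
    avoiding-fraction : binom n s * ((m ∸ k) ^ (m / H)) ^ (n ∸ s) * G ^ s ≤ (m ^ (m / H)) ^ (n ∸ s)
    avoiding-fraction = begin
      binom n s * ((m ∸ k) ^ (m / H)) ^ (n ∸ s) * G ^ s      ≡⟨ xy∙z≈xz∙y (binom n s) _ (G ^ s) ⟩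
      binom n s * G ^ s * ((m ∸ k) ^ (m / H)) ^ (n ∸ s)      ≡⟨ cong (binom n s * G ^ s *_) (^-*-assoc (m ∸ k) (m / H) (n ∸ s)) ⟩
      binom n s * G ^ s * (m ∸ k) ^ M                        ≤⟨ *-monoˡ-≤ ((m ∸ k) ^ M) (*-mono-≤ (binom≤2^n n s) (^-monoʳ (^-pos γ (s≤s z≤n)) (≤-trans (m≤m+n s s) half))) ⟩
      2 ^ n * G ^ n * (m ∸ k) ^ M                            ≡⟨ cong (_* (m ∸ k) ^ M) (trans (cong (2 ^ n *_) (^-*-assoc 2 γ n)) (sym (^-distribˡ-+-* 2 n (γ * n)))) ⟩
      2 ^ (n + γ * n) * (m ∸ k) ^ M                          ≤⟨ binary-decay M (n + γ * n) bound ⟩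
      m ^ M                                                  ≡⟨ ^-*-assoc m (m / H) (n ∸ s) ⟨
      (m ^ (m / H)) ^ (n ∸ s)                                ∎
      where
      M = m / H * (n ∸ s)
      bound : 8 * H * (n + γ * n) * m ≤ 4 * H * M * k
      bound = begin
        8 * H * (suc γ * n) * m               ≡⟨ lemma′ (8 * H) (suc γ) n m ⟩
        m * n * (8 * H * suc γ)               ≤⟨ *-mono-≤ (product m H≤m) (≤-trans (≤-trans (*-monoʳ-≤ (8 * H) (+-monoˡ-≤ γ (m≤n⇒m≤o+n (2 * b) (s≤s (z≤n {1}))))) g≥H) g≤k) ⟩
        4 * H * M * k                         ∎
        where
        lemma′ : ∀ h c n m → h * (c * n) * m ≡ m * n * (h * c)
        lemma′ = solve-∀
    avoiding : binom n s * ((m ∸ k) ^ w) ^ (n ∸ s) * G ^ s ≤ (m ^ w) ^ (n ∸ s)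
    avoiding with ⊓-sel (s * v) (m / H)
    ... | inj₁ eq = subst (λ w → binom n s * ((m ∸ k) ^ w) ^ (n ∸ s) * G ^ s ≤ (m ^ w) ^ (n ∸ s)) (sym eq) avoiding-colours
    ... | inj₂ eq = subst (λ w → binom n s * ((m ∸ k) ^ w) ^ (n ∸ s) * G ^ s ≤ (m ^ w) ^ (n ∸ s)) (sym eq) avoiding-fraction

  width : ℕ → ℕ
  width s with s * 2 ^ (2 * b * g) ≤? n
  ... | yes _ = s * u
  ... | no _  = s * (k / H) ⊓ (m / H)

  width-bounds : ∀ s → 1 ≤ s → s + s ≤ n → Bounds (width s) s
  width-bounds s 1≤s half with s * 2 ^ (2 * b * g) ≤? n
  ... | yes few = small s 1≤s few
  ... | no ¬few = large s 1≤s half (<⇒≤ (≰⇒> ¬few))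

  regimes-bound : ∀ D → 1 ≤ D → 2 ^ γ ≡ 4 * D → D * disconnected n m k ≤ binom m k ^ n
  regimes-bound D 1≤D G≡ = union-bound n m k D width 1≤D λ t 1≤t 2t≤n →
    subst (λ G → width t ≤ m
               × binom n t * (binom m (width t) * binom (width t) k ^ t) * G ^ t ≤ binom m k ^ t
               × binom n t * binom (m ∸ width t) k ^ (n ∸ t) * G ^ t ≤ binom m k ^ (n ∸ t))
      G≡ (width-bounds t 1≤t 2t≤n)

-- Integer logarithms and the choice of the parameters

last : ∀ {P : Pred ℕ 0ℓ} → Decidable P → P 0 → ∀ b → ¬ P b → ∃[ i ] i < b × P i × ¬ P (suc i)
last P? p0 zero    ¬pb = contradiction p0 ¬pb
last P? p0 (suc b) ¬pb with P? b
... | yes pb = b , ≤-refl , pb , ¬pb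
... | no ¬p with last P? p0 b ¬p
...   | i , i<b , pi , ¬psi = i , m≤n⇒m≤1+n i<b , pi , ¬psi

n<2^n : ∀ n → n < 2 ^ n
n<2^n zero    = s≤s z≤n
n<2^n (suc n) = +-mono-≤ (^-pos n (s≤s z≤n)) (≤-trans (n<2^n n) (m≤m+n (2 ^ n) 0))

-- i is the integer part of log n to base 1 + 1/K
IsLog : ℕ → ℕ → ℕ → Set
IsLog K n i = suc K ^ i ≤ n * K ^ i × n * K ^ suc i < suc K ^ suc i

-- The search ends before Kn, since (1 + 1/K)^(Kn) ≥ 2^n > n.
isLog : ∀ K n → 1 ≤ K → 1 ≤ n → ∃[ i ] IsLog K n i
isLog K n 1≤K 1≤n with last (λ i → suc K ^ i ≤? n * K ^ i) (≤-trans 1≤n (m≤m*n n 1)) (K * n)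
  (<⇒≱ (<-≤-trans (*-monoˡ-< (K ^ (K * n)) {{>-nonZero (^-pos (K * n) 1≤K)}} (n<2^n n)) (2K^K≤[1+K]^K K n 1≤K)))
... | i , _ , lower , ¬upper = i , lower , ≰⇒> ¬upper

isLog-unbounded : ∀ {K n i} I → 1 ≤ K → IsLog K n i → suc K ^ I ≤ n → I ≤ i
isLog-unbounded {K} {n} {i} I 1≤K (_ , upper) h = ≮⇒≥ λ i<I → <⇒≱ upper (begin
  suc K ^ suc i      ≤⟨ ^-monoʳ (s≤s z≤n) i<I ⟩
  suc K ^ I          ≤⟨ h ⟩
  n                  ≤⟨ m≤m*n n (K ^ suc i) {{>-nonZero (^-pos (suc i) 1≤K)}} ⟩
  n * K ^ suc i      ∎)
  where open ≤-Reasoning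

-- The constants are parameters with equations, since H has no feasible normal form.
module Threshold
  (R D K β b H γ c₁ c₂ c₃ : ℕ)
  (K≡ : K ≡ 5 + 6 * R)
  (β≡ : β ≡ 4 * suc K + 1)
  (b≡ : b ≡ (β + 3) * (2 * suc K))
  (H≡ : H ≡ 2 ^ (4 * b + 8))
  (γ≡ : γ ≡ 2 + D)
  (c₁≡ : c₁ ≡ 8 * H * (2 * b + 2 + γ))
  (c₂≡ : c₂ ≡ 4 * R * (1 + K * γ))
  (c₃≡ : c₃ ≡ 32 * (8 * R * K + H))
  (1≤R : 1 ≤ R)
  where

  Q = suc K
  -- The sum of all lower bounds that `Regimes` puts on `g`. From n ≥ Q^I follows i ≥ I, and hence g
  -- ≥ g₀.
  g₀ = (γ + 2) + Q + c₁ + c₂ + c₃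
  I = g₀ * g₀ * Q
  N = Q ^ I

  1≤K : 1 ≤ K
  1≤K = subst (1 ≤_) (sym K≡) (s≤s z≤n)

  -- The search stops at an `x` that is too small for the density condition while `κ = suc x` meets
  -- it. From κ ≤ 2x, or κ = 1 and n ≤ m, comes the upper bound on κ²n that `Regimes` needs;
  -- `disconnected-antitone` then passes from κ to the larger `k`.
  bound : ∀ n m k → N ≤ n → n ≤ m → k ≤ m →
    (∀ i → suc K ^ i ≤ n * K ^ i → suc R * (m * i) ≤ R * (suc K * (k * k * n))) →
    D * disconnected n m k ≤ binom m k ^ n
  bound n m k N≤n n≤m k≤m dense with isLog K n 1≤K (≤-trans (^-pos I (s≤s z≤n)) N≤n)
  ... | i , log with last (λ g → g * g * Q ≤? i) z≤n (suc i)
                      (<⇒≱ (≤-trans (m≤m*n (suc i) (suc i)) (m≤m*n (suc i * suc i) Q)))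
  ...   | g , _ , g²Q≤i , ¬i≤ = go (last (λ x → R * (Q * (x * x * n)) <? suc R * (m * i)) base k (≤⇒≯ (dense i (proj₁ log))))
    where
    open ≤-Reasoning
    1≤n : 1 ≤ n
    1≤n = ≤-trans (^-pos I (s≤s z≤n)) N≤n
    1≤m : 1 ≤ m
    1≤m = ≤-trans 1≤n n≤m
    I≤i : I ≤ i
    I≤i = isLog-unbounded I 1≤K log N≤n
    g₀≤g : g₀ ≤ g
    g₀≤g = ≮⇒≥ λ g<g₀ → ¬i≤ (≤-trans (*-monoˡ-≤ Q (*-mono-≤ g<g₀ g<g₀)) I≤i)
    1≤g : 1 ≤ g
    1≤g = ≤-trans (≤-trans (s≤s z≤n) (m≤n⇒m≤n+o c₃ (m≤n⇒m≤n+o c₂ (m≤n⇒m≤n+o c₁ (m≤n+m Q (γ + 2)))))) g₀≤g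
    1≤i : 1 ≤ i
    1≤i = ≤-trans (*-mono-≤ (*-mono-≤ 1≤g 1≤g) (s≤s (z≤n {K}))) g²Q≤i
    base : R * (Q * (0 * 0 * n)) < suc R * (m * i)
    base = subst (_< suc R * (m * i)) (sym (trans (cong (R *_) (*-zeroʳ Q)) (*-zeroʳ R))) (*-mono-≤ (s≤s (z≤n {R})) (*-mono-≤ 1≤m 1≤i))
    go : ∃[ x ] x < k × R * (Q * (x * x * n)) < suc R * (m * i) × ¬ (R * (Q * (suc x * suc x * n)) < suc R * (m * i)) → D * disconnected n m k ≤ binom m k ^ n
    go (x , x<k , below , ¬below) = cancelʳ (binom m κ ^ n) (^-pos n (1≤binom κ≤m)) (begin
      D * disconnected n m k * binom m κ ^ n                      ≡⟨ *-assoc D (disconnected n m k) _ ⟩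
      D * (disconnected n m k * binom m κ ^ n)                    ≤⟨ *-mono-≤ (<⇒≤ (n<2^n D)) (disconnected-antitone n m x<k k≤m) ⟩
      2 ^ D * (disconnected n m κ * binom m k ^ n)                ≡⟨ *-assoc (2 ^ D) (disconnected n m κ) _ ⟨
      2 ^ D * disconnected n m κ * binom m k ^ n                  ≤⟨ *-monoˡ-≤ (binom m k ^ n) reduced ⟩
      binom m κ ^ n * binom m k ^ n                               ≡⟨ *-comm (binom m κ ^ n) _ ⟩
      binom m k ^ n * binom m κ ^ n                               ∎)
      where
      κ = suc x
      κ≤m : κ ≤ m
      κ≤m = ≤-trans x<k k≤m
      x²n≤ : x * x * n ≤ 8 * (m * (g * g))
      x²n≤ = cancelˡ (R * Q) (*-mono-≤ 1≤R (s≤s (z≤n {K}))) (begin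
        R * Q * (x * x * n)                   ≡⟨ *-assoc R Q (x * x * n) ⟩
        R * (Q * (x * x * n))                 ≤⟨ <⇒≤ below ⟩
        suc R * (m * i)                       ≤⟨ *-mono-≤ (+-monoˡ-≤ R 1≤R) (*-monoʳ-≤ m (<⇒≤ (≰⇒> ¬i≤))) ⟩
        (R + R) * (m * (suc g * suc g * Q))   ≤⟨ *-monoʳ-≤ (R + R) (*-monoʳ-≤ m (*-monoˡ-≤ Q (*-mono-≤ (+-monoˡ-≤ g 1≤g) (+-monoˡ-≤ g 1≤g)))) ⟩
        (R + R) * (m * ((g + g) * (g + g) * Q)) ≡⟨ lemma R m g Q ⟩
        R * Q * (8 * (m * (g * g)))           ∎)
        where
        lemma : ∀ R m g Q → (R + R) * (m * ((g + g) * (g + g) * Q)) ≡ R * Q * (8 * (m * (g * g)))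
        lemma = solve-∀
      κ²n≤ : κ * κ * n ≤ 32 * (m * (g * g))
      κ²n≤ with x ≟ 0
      ... | yes refl = begin
        1 * 1 * n              ≡⟨ *-identityˡ n ⟩
        n                      ≤⟨ n≤m ⟩
        m                      ≤⟨ m≤m*n m (g * g) {{>-nonZero (*-mono-≤ 1≤g 1≤g)}} ⟩
        m * (g * g)            ≤⟨ m≤n*m (m * (g * g)) 32 ⟩
        32 * (m * (g * g))     ∎
      ... | no x≢0 = begin
        κ * κ * n              ≤⟨ *-monoˡ-≤ n (*-mono-≤ κ≤2x κ≤2x) ⟩
        (x + x) * (x + x) * n  ≡⟨ lemma x n ⟩
        4 * (x * x * n)        ≤⟨ *-monoʳ-≤ 4 x²n≤ ⟩
        4 * (8 * (m * (g * g))) ≡⟨ *-assoc 4 8 (m * (g * g)) ⟨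
        32 * (m * (g * g))     ∎
        where
        κ≤2x : κ ≤ x + x
        κ≤2x = +-monoˡ-≤ x (n≢0⇒n>0 x≢0)
        lemma : ∀ x n → (x + x) * (x + x) * n ≡ 4 * (x * x * n)
        lemma = solve-∀
      -- With 2^D in place of `D` the factor per node, 4 · 2^D, is a power of 2; hence γ = 2 + D.
      reduced : 2 ^ D * disconnected n m κ ≤ binom m κ ^ n
      reduced = Regimes.regimes-bound R γ b β K H g n m κ i K≡ β≡ b≡ H≡ 1≤R
        (≤-trans (m≤n⇒m≤n+o c₃ (m≤n⇒m≤n+o c₂ (m≤n⇒m≤n+o c₁ (m≤m+n (γ + 2) Q)))) g₀≤g)
        (≤-trans (m≤n⇒m≤n+o c₃ (m≤n⇒m≤n+o c₂ (m≤n⇒m≤n+o c₁ (m≤n+m Q (γ + 2))))) g₀≤g)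
        (≤-trans (≤-reflexive (sym c₁≡)) (≤-trans (m≤n⇒m≤n+o c₃ (m≤n⇒m≤n+o c₂ (m≤n+m c₁ (γ + 2 + Q)))) g₀≤g))
        (≤-trans (≤-reflexive (sym c₂≡)) (≤-trans (m≤n⇒m≤n+o c₃ (m≤n+m c₂ (γ + 2 + Q + c₁))) g₀≤g))
        (≤-trans (≤-reflexive (sym c₃≡)) (≤-trans (m≤n+m c₃ (γ + 2 + Q + c₁ + c₂)) g₀≤g))
        n≤m (proj₁ log) (<⇒≤ (proj₂ log)) g²Q≤i (<⇒≤ (≰⇒> ¬i≤)) (≮⇒≥ ¬below) κ²n≤
        (2 ^ D) (^-pos D (s≤s z≤n)) (trans (cong (2 ^_) γ≡) (sym (*-assoc 2 2 (2 ^ D))))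

abstract
  disconnected-rare : ∀ R D → 1 ≤ R → let K = 5 + 6 * R in ∃[ N ] ∀ n m k → N ≤ n → n ≤ m → k ≤ m →
    (∀ i → suc K ^ i ≤ n * K ^ i → suc R * (m * i) ≤ R * (suc K * (k * k * n))) →
    D * disconnected n m k ≤ binom m k ^ n
  disconnected-rare R D 1≤R = _ , Threshold.bound R D _ _ _ _ _ _ _ _ refl refl refl refl refl refl refl refl 1≤R

-- Moments of the number of isolated nodes

∈-tuples⁻ : ∀ {xs : List 𝒜} {F : Vec 𝒜 n} → F ∈ tuples n xs → ∀ v → lookup F v ∈ xs
∈-tuples⁻ {n = suc n} {xs} F∈ v with ∈-cartesianProductWith⁻ _∷_ xs (tuples n xs) F∈
∈-tuples⁻ F∈ zero    | _ , _ , x∈ , F′∈ , refl = x∈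
∈-tuples⁻ F∈ (suc v) | _ , _ , x∈ , F′∈ , refl = ∈-tuples⁻ F′∈ v

∈-kSubsets⁻ : {p : Subset m} → p ∈ kSubsets m k → card p ≡ k
∈-kSubsets⁻ {m} {k} p∈ = proj₂ (∈-filter⁻ (λ p → card p ≟ k) {xs = subsets m} p∈)

card-lookup : {F : Vec (Subset m) n} → F ∈ assignments n m k → ∀ v → card (lookup F v) ≡ k
card-lookup F∈ v = ∈-kSubsets⁻ (∈-tuples⁻ F∈ v)

card-∪ : ∀ (p q : Subset m) → q ⊆ ∁ₛ p → card (p ∪ q) ≡ card p + card q
card-∪ []            []            _ = refl
card-∪ (inside ∷ p)  (inside ∷ q)  h with () ← h here
card-∪ (inside ∷ p)  (outside ∷ q) h = cong suc (card-∪ p q (drop-∷-⊆ h))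
card-∪ (outside ∷ p) (inside ∷ q)  h = trans (cong suc (card-∪ p q (drop-∷-⊆ h))) (sym (+-suc (card p) (card q)))
card-∪ (outside ∷ p) (outside ∷ q) h = card-∪ p q (drop-∷-⊆ h)

𝟙-∪ : ∀ (p f g : Subset m) → 𝟙 (p ⊆? ∁ₛ f) * 𝟙 (p ⊆? ∁ₛ g) ≡ 𝟙 (p ⊆? ∁ₛ (f ∪ g))
𝟙-∪ []            []            []            = refl
𝟙-∪ (outside ∷ p) (_ ∷ f)       (_ ∷ g)       = 𝟙-∪ p f g
𝟙-∪ (inside ∷ p)  (inside ∷ f)  (_ ∷ g)       = refl
𝟙-∪ (inside ∷ p)  (outside ∷ f) (inside ∷ g)  = *-zeroʳ (𝟙 (p ⊆? ∁ₛ f))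
𝟙-∪ (inside ∷ p)  (outside ∷ f) (outside ∷ g) = 𝟙-∪ p f g

allAvoid : Subset m → Vec (Subset m) n → ℕ
allAvoid Y = othersAvoid Y ⊥

-- Again a product of indicators: nodes before `v` contribute on the way to it, those after it
-- through `allAvoid`.
isolated : Fin n → Vec (Subset m) n → ℕ
isolated zero    (f ∷ F) = allAvoid f F
isolated (suc v) (f ∷ F) = 𝟙 (f ⊆? ∁ₛ (lookup F v)) * isolated v F

𝟙-01 : {P : Set} (d : Dec P) → 𝟙 d ≡ 0 ⊎ P
𝟙-01 (yes p) = inj₂ p
𝟙-01 (no _)  = inj₁ refl

allAvoid-cases : ∀ (Y : Subset m) (F : Vec (Subset m) n) → allAvoid Y F ≡ 0 ⊎ (∀ v → lookup F v ⊆ ∁ₛ Y)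
allAvoid-cases Y []      = inj₂ λ ()
allAvoid-cases Y (f ∷ F) with 𝟙-01 (f ⊆? ∁ₛ Y) | allAvoid-cases Y F
... | inj₁ eq | _       = inj₁ (cong (_* allAvoid Y F) eq)
... | inj₂ _  | inj₁ eq = inj₁ (trans (cong (𝟙 (f ⊆? ∁ₛ Y) *_) eq) (*-zeroʳ (𝟙 (f ⊆? ∁ₛ Y))))
... | inj₂ f⊆ | inj₂ F⊆ = inj₂ λ { zero → f⊆ ; (suc v) → F⊆ v }

isolated-cases : ∀ v (F : Vec (Subset m) n) → isolated v F ≡ 0 ⊎ (∀ u → u ≢ v → lookup F u ⊆ ∁ₛ (lookup F v))
isolated-cases zero (f ∷ F) with allAvoid-cases f F
... | inj₁ eq = inj₁ eq
... | inj₂ F⊆ = inj₂ λ { zero 0≢0 → contradiction refl 0≢0 ; (suc u) _ → F⊆ u }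
isolated-cases (suc v) (f ∷ F) with 𝟙-01 (f ⊆? ∁ₛ (lookup F v)) | isolated-cases v F
... | inj₁ eq | _       = inj₁ (cong (_* isolated v F) eq)
... | inj₂ _  | inj₁ eq = inj₁ (trans (cong (𝟙 (f ⊆? ∁ₛ (lookup F v)) *_) eq) (*-zeroʳ (𝟙 (f ⊆? ∁ₛ (lookup F v)))))
... | inj₂ f⊆ | inj₂ F⊆ = inj₂ λ { zero _ → f⊆ ; (suc u) u≢v → F⊆ u (u≢v ∘ cong suc) }

allAvoid≤1 : ∀ (Y : Subset m) (F : Vec (Subset m) n) → allAvoid Y F ≤ 1
allAvoid≤1 Y []      = ≤-refl
allAvoid≤1 Y (f ∷ F) = *-mono-≤ (𝟙≤1 (f ⊆? ∁ₛ Y)) (allAvoid≤1 Y F)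

isolated≤1 : ∀ v (F : Vec (Subset m) n) → isolated v F ≤ 1
isolated≤1 zero    (f ∷ F) = allAvoid≤1 f F
isolated≤1 (suc v) (f ∷ F) = *-mono-≤ (𝟙≤1 (f ⊆? ∁ₛ (lookup F v))) (isolated≤1 v F)

allAvoid-∪ : ∀ (f g : Subset m) (F : Vec (Subset m) n) → allAvoid f F * allAvoid g F ≡ allAvoid (f ∪ g) F
allAvoid-∪ f g []      = refl
allAvoid-∪ f g (p ∷ F) = trans (interchange (𝟙 (p ⊆? ∁ₛ f)) (allAvoid f F) (𝟙 (p ⊆? ∁ₛ g)) (allAvoid g F))
                               (cong₂ _*_ (𝟙-∪ p f g) (allAvoid-∪ f g F))

∑-allAvoid : ∀ n k (Y : Subset m) → ∑ (assignments n m k) (allAvoid Y) ≡ binom (m ∸ card Y) k ^ n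
∑-allAvoid zero    k Y = refl
∑-allAvoid {m} (suc n) k Y = begin
  ∑ (assignments (suc n) m k) (allAvoid Y)                                   ≡⟨ ∑-tuples n (kSubsets m k) (allAvoid Y) ⟩
  ∑ (kSubsets m k) (λ f → ∑ (assignments n m k) λ F → 𝟙 (f ⊆? ∁ₛ Y) * allAvoid Y F)
    ≡⟨ ∑-cong (kSubsets m k) (λ f _ → ∑-*ˡ (assignments n m k) (𝟙 (f ⊆? ∁ₛ Y)) (allAvoid Y)) ⟩
  ∑ (kSubsets m k) (λ f → 𝟙 (f ⊆? ∁ₛ Y) * T)                                  ≡⟨ ∑-*ʳ (kSubsets m k) T (λ f → 𝟙 (f ⊆? ∁ₛ Y)) ⟩
  ∑ (kSubsets m k) (λ f → 𝟙 (f ⊆? ∁ₛ Y)) * T                                  ≡⟨ cong₂ _*_ (count-⊆∁ k Y) (∑-allAvoid n k Y) ⟩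
  binom (m ∸ card Y) k * binom (m ∸ card Y) k ^ n                            ∎
  where
  open ≡-Reasoning
  T = ∑ (assignments n m k) (allAvoid Y)

∑-isolated : ∀ n m k (v : Fin (suc n)) → ∑ (assignments (suc n) m k) (isolated v) ≡ binom m k * binom (m ∸ k) k ^ n
∑-isolated n m k zero = begin
  ∑ (assignments (suc n) m k) (isolated zero)                        ≡⟨ ∑-tuples n (kSubsets m k) (isolated zero) ⟩
  ∑ (kSubsets m k) (λ f → ∑ (assignments n m k) (allAvoid f))        ≡⟨ ∑-cong (kSubsets m k) (λ f f∈ → trans (∑-allAvoid n k f) (cong (λ c → binom (m ∸ c) k ^ n) (∈-kSubsets⁻ f∈))) ⟩
  ∑ (kSubsets m k) (λ _ → binom (m ∸ k) k ^ n)                       ≡⟨ ∑-const (kSubsets m k) _ ⟩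
  length (kSubsets m k) * binom (m ∸ k) k ^ n                        ≡⟨ cong (_* binom (m ∸ k) k ^ n) (length-kSubsets m k) ⟩
  binom m k * binom (m ∸ k) k ^ n                                    ∎
  where open ≡-Reasoning
∑-isolated (suc n) m k (suc v) = begin
  ∑ (assignments (2 + n) m k) (isolated (suc v))                     ≡⟨ ∑-tuples′ (suc n) (kSubsets m k) (isolated (suc v)) ⟩
  ∑ As (λ F → ∑ (kSubsets m k) λ f → 𝟙 (f ⊆? ∁ₛ (lookup F v)) * isolated v F)
    ≡⟨ ∑-cong As (λ F F∈ → trans (∑-*ʳ (kSubsets m k) (isolated v F) (λ f → 𝟙 (f ⊆? ∁ₛ (lookup F v))))
         (cong (_* isolated v F) (trans (count-⊆∁ k (lookup F v)) (cong (λ c → binom (m ∸ c) k) (card-lookup F∈ v))))) ⟩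
  ∑ As (λ F → a * isolated v F)                                      ≡⟨ ∑-*ˡ As a (isolated v) ⟩
  a * ∑ As (isolated v)                                              ≡⟨ cong (a *_) (∑-isolated n m k v) ⟩
  a * (binom m k * a ^ n)                                            ≡⟨ x∙yz≈y∙xz a (binom m k) (a ^ n) ⟩
  binom m k * (a * a ^ n)                                            ∎
  where
  open ≡-Reasoning
  a = binom (m ∸ k) k
  As = assignments (suc n) m k

∑-avoid-two : ∀ k (f g : Subset m) → card f ≡ k → card g ≡ k → g ⊆ ∁ₛ f →
              ∑ (kSubsets m k) (λ p → 𝟙 (p ⊆? ∁ₛ f) * 𝟙 (p ⊆? ∁ₛ g)) ≡ binom (m ∸ (k + k)) k
∑-avoid-two {m} k f g cf cg disj = trans (∑-cong (kSubsets m k) (λ p _ → 𝟙-∪ p f g)) (trans (count-⊆∁ k (f ∪ g))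
  (cong (λ c → binom (m ∸ c) k) (trans (card-∪ f g disj) (cong₂ _+_ cf cg))))

-- The count `c` from `∑-avoid-two` is right only for disjoint `f` and `g`. In the applications an
-- overlap makes the indicator `x` of the remaining nodes 0, and then both sides vanish.
∑-factor-out : ∀ k (f g : Subset m) x y c → (x ≡ 0 ⊎ ∑ (kSubsets m k) (λ p → 𝟙 (p ⊆? ∁ₛ f) * 𝟙 (p ⊆? ∁ₛ g)) ≡ c) →
               ∑ (kSubsets m k) (λ p → (𝟙 (p ⊆? ∁ₛ f) * x) * (𝟙 (p ⊆? ∁ₛ g) * y)) ≤ c * (x * y)
∑-factor-out {m} k f g x y c h = begin
  ∑ (kSubsets m k) (λ p → (𝟙 (p ⊆? ∁ₛ f) * x) * (𝟙 (p ⊆? ∁ₛ g) * y))    ≡⟨ ∑-cong (kSubsets m k) (λ p _ → interchange (𝟙 (p ⊆? ∁ₛ f)) x (𝟙 (p ⊆? ∁ₛ g)) y) ⟩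
  ∑ (kSubsets m k) (λ p → 𝟙 (p ⊆? ∁ₛ f) * 𝟙 (p ⊆? ∁ₛ g) * (x * y))      ≡⟨ ∑-*ʳ (kSubsets m k) (x * y) (λ p → 𝟙 (p ⊆? ∁ₛ f) * 𝟙 (p ⊆? ∁ₛ g)) ⟩
  S * (x * y)                                                          ≤⟨ cases h ⟩
  c * (x * y)                                                          ∎
  where
  open ≤-Reasoning
  S = ∑ (kSubsets m k) (λ p → 𝟙 (p ⊆? ∁ₛ f) * 𝟙 (p ⊆? ∁ₛ g))
  cases : (x ≡ 0 ⊎ S ≡ c) → S * (x * y) ≤ c * (x * y)
  cases (inj₁ refl) = ≤-reflexive (trans (*-zeroʳ S) (sym (*-zeroʳ c)))
  cases (inj₂ refl) = ≤-refl

-- `f` is the set of a further node that is to be isolated together with `v`. The set of `v` lies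
-- outside `f`, and each of the other `n` nodes avoids two disjoint k-sets.
∑-avoid-isolated : ∀ n m k (f : Subset m) → card f ≡ k → ∀ v →
  ∑ (assignments (suc n) m k) (λ F → allAvoid f F * isolated v F) ≤ binom (m ∸ k) k * binom (m ∸ (k + k)) k ^ n
∑-avoid-isolated n m k f cf zero = begin
  ∑ (assignments (suc n) m k) (λ F → allAvoid f F * isolated zero F)    ≡⟨ ∑-tuples n (kSubsets m k) _ ⟩
  ∑ (kSubsets m k) (λ g → ∑ As λ F → 𝟙 (g ⊆? ∁ₛ f) * allAvoid f F * allAvoid g F)
    ≡⟨ ∑-cong (kSubsets m k) (λ g _ → trans (∑-cong As λ F _ → trans (*-assoc (𝟙 (g ⊆? ∁ₛ f)) _ _) (cong (𝟙 (g ⊆? ∁ₛ f) *_) (allAvoid-∪ f g F)))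
         (trans (∑-*ˡ As (𝟙 (g ⊆? ∁ₛ f)) (allAvoid (f ∪ g))) (cong (𝟙 (g ⊆? ∁ₛ f) *_) (∑-allAvoid n k (f ∪ g))))) ⟩
  ∑ (kSubsets m k) (λ g → 𝟙 (g ⊆? ∁ₛ f) * binom (m ∸ card (f ∪ g)) k ^ n) ≡⟨ ∑-cong (kSubsets m k) (λ g g∈ → sized g (∈-kSubsets⁻ g∈)) ⟩
  ∑ (kSubsets m k) (λ g → 𝟙 (g ⊆? ∁ₛ f) * a₂ ^ n)                        ≡⟨ ∑-*ʳ (kSubsets m k) (a₂ ^ n) (λ g → 𝟙 (g ⊆? ∁ₛ f)) ⟩
  ∑ (kSubsets m k) (λ g → 𝟙 (g ⊆? ∁ₛ f)) * a₂ ^ n                        ≡⟨ cong (_* a₂ ^ n) (trans (count-⊆∁ k f) (cong (λ c → binom (m ∸ c) k) cf)) ⟩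
  binom (m ∸ k) k * a₂ ^ n                                              ∎
  where
  open ≤-Reasoning
  a₂ = binom (m ∸ (k + k)) k
  As = assignments n m k
  sized : ∀ g → card g ≡ k → 𝟙 (g ⊆? ∁ₛ f) * binom (m ∸ card (f ∪ g)) k ^ n ≡ 𝟙 (g ⊆? ∁ₛ f) * a₂ ^ n
  sized g cg with 𝟙-01 (g ⊆? ∁ₛ f)
  ... | inj₁ eq = trans (cong (_* binom (m ∸ card (f ∪ g)) k ^ n) eq) (cong (_* a₂ ^ n) (sym eq))
  ... | inj₂ g⊆ = cong (λ c → 𝟙 (g ⊆? ∁ₛ f) * binom (m ∸ c) k ^ n) (trans (card-∪ f g g⊆) (cong₂ _+_ cf cg))
∑-avoid-isolated (suc n) m k f cf (suc v) = begin
  ∑ (assignments (2 + n) m k) (λ F → allAvoid f F * isolated (suc v) F)    ≡⟨ ∑-tuples′ (suc n) (kSubsets m k) _ ⟩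
  ∑ As (λ F → ∑ (kSubsets m k) λ g → (𝟙 (g ⊆? ∁ₛ f) * allAvoid f F) * (𝟙 (g ⊆? ∁ₛ (lookup F v)) * isolated v F))
    ≤⟨ ∑-mono As (λ F F∈ → ∑-factor-out k f (lookup F v) (allAvoid f F) (isolated v F) a₂ (cases F F∈)) ⟩
  ∑ As (λ F → a₂ * (allAvoid f F * isolated v F))                          ≡⟨ ∑-*ˡ As a₂ _ ⟩
  a₂ * ∑ As (λ F → allAvoid f F * isolated v F)                            ≤⟨ *-monoʳ-≤ a₂ (∑-avoid-isolated n m k f cf v) ⟩
  a₂ * (binom (m ∸ k) k * a₂ ^ n)                                          ≡⟨ x∙yz≈y∙xz a₂ (binom (m ∸ k) k) (a₂ ^ n) ⟩
  binom (m ∸ k) k * (a₂ * a₂ ^ n)                                          ∎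
  where
  open ≤-Reasoning
  a₂ = binom (m ∸ (k + k)) k
  As = assignments (suc n) m k
  cases : ∀ F → F ∈ As → allAvoid f F ≡ 0 ⊎ ∑ (kSubsets m k) (λ p → 𝟙 (p ⊆? ∁ₛ f) * 𝟙 (p ⊆? ∁ₛ (lookup F v))) ≡ a₂
  cases F F∈ with allAvoid-cases f F
  ... | inj₁ eq = inj₁ eq
  ... | inj₂ F⊆ = inj₂ (∑-avoid-two k f (lookup F v) cf (card-lookup F∈ v) (F⊆ v))

-- A head node other than `u` and `v` contributes the factor C(m-2k,k); such nodes are removed until
-- one of the pair is the head.
∑-isolated-pair : ∀ n m k (u v : Fin (2 + n)) → u ≢ v →
  ∑ (assignments (2 + n) m k) (λ F → isolated u F * isolated v F) ≤ binom m k * (binom (m ∸ k) k * binom (m ∸ (k + k)) k ^ n)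
∑-isolated-pair n m k zero zero u≢v = contradiction refl u≢v
∑-isolated-pair n m k zero (suc v) _ = begin
  ∑ (assignments (2 + n) m k) (λ F → isolated zero F * isolated (suc v) F)    ≡⟨ ∑-tuples (suc n) (kSubsets m k) _ ⟩
  ∑ (kSubsets m k) (λ f → ∑ As λ F → allAvoid f F * (𝟙 (f ⊆? ∁ₛ (lookup F v)) * isolated v F))
    -- `allAvoid f F` already contains the condition that the set of `v` avoids `f`, so the second
    -- indicator is bounded by 1.
    ≤⟨ ∑-mono (kSubsets m k) (λ f f∈ → ≤-trans (∑-mono As λ F _ → *-monoʳ-≤ (allAvoid f F)
         (≤-trans (*-monoˡ-≤ (isolated v F) (𝟙≤1 (f ⊆? ∁ₛ (lookup F v)))) (≤-reflexive (*-identityˡ _))))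
         (∑-avoid-isolated n m k f (∈-kSubsets⁻ f∈) v)) ⟩
  ∑ (kSubsets m k) (λ _ → P)                                                  ≡⟨ ∑-const (kSubsets m k) P ⟩
  length (kSubsets m k) * P                                                   ≡⟨ cong (_* P) (length-kSubsets m k) ⟩
  binom m k * P                                                               ∎
  where
  open ≤-Reasoning
  As = assignments (suc n) m k
  P = binom (m ∸ k) k * binom (m ∸ (k + k)) k ^ n
∑-isolated-pair n m k (suc u) zero _ = ≤-trans
  (≤-reflexive (∑-cong (assignments (2 + n) m k) λ F _ → *-comm (isolated (suc u) F) (isolated zero F)))
  (∑-isolated-pair n m k zero (suc u) λ ())
∑-isolated-pair zero m k (suc zero) (suc zero) u≢v = contradiction refl u≢v
∑-isolated-pair (suc n) m k (suc u) (suc v) u≢v = begin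
  ∑ (assignments (3 + n) m k) (λ F → isolated (suc u) F * isolated (suc v) F)    ≡⟨ ∑-tuples′ (2 + n) (kSubsets m k) _ ⟩
  ∑ As (λ F → ∑ (kSubsets m k) λ f → (𝟙 (f ⊆? ∁ₛ (lookup F u)) * isolated u F) * (𝟙 (f ⊆? ∁ₛ (lookup F v)) * isolated v F))
    ≤⟨ ∑-mono As (λ F F∈ → ∑-factor-out k (lookup F u) (lookup F v) (isolated u F) (isolated v F) a₂ (cases F F∈)) ⟩
  ∑ As (λ F → a₂ * (isolated u F * isolated v F))        ≡⟨ ∑-*ˡ As a₂ _ ⟩
  a₂ * ∑ As (λ F → isolated u F * isolated v F)          ≤⟨ *-monoʳ-≤ a₂ (∑-isolated-pair n m k u v (u≢v ∘ cong suc)) ⟩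
  a₂ * (binom m k * (binom (m ∸ k) k * a₂ ^ n))          ≡⟨ lemma a₂ (binom m k) (binom (m ∸ k) k) (a₂ ^ n) ⟩
  binom m k * (binom (m ∸ k) k * (a₂ * a₂ ^ n))          ∎
  where
  open ≤-Reasoning
  a₂ = binom (m ∸ (k + k)) k
  As = assignments (2 + n) m k
  cases : ∀ F → F ∈ As → isolated u F ≡ 0 ⊎ ∑ (kSubsets m k) (λ p → 𝟙 (p ⊆? ∁ₛ (lookup F u)) * 𝟙 (p ⊆? ∁ₛ (lookup F v))) ≡ a₂
  cases F F∈ with isolated-cases u F
  ... | inj₁ eq = inj₁ eq
  ... | inj₂ F⊆ = inj₂ (∑-avoid-two k (lookup F u) (lookup F v) (card-lookup F∈ u) (card-lookup F∈ v) (F⊆ v (u≢v ∘ cong suc ∘ sym)))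
  lemma : ∀ x y z w → x * (y * (z * w)) ≡ y * (z * (x * w))
  lemma = solve-∀

-- Chebyshev's inequality for the number of isolated nodes

2ab≤a²+b² : ∀ a b → 2 * (a * b) ≤ a * a + b * b
2ab≤a²+b² a b with ≤-total a b
... | inj₁ a≤b with m≤n⇒∃[o]m+o≡n a≤b
...   | c , refl = ≤-trans (m≤m+n _ (c * c)) (≤-reflexive (lemma a c))
  where
  lemma : ∀ a c → 2 * (a * (a + c)) + c * c ≡ a * a + (a + c) * (a + c)
  lemma = solve-∀
2ab≤a²+b² a b | inj₂ b≤a with m≤n⇒∃[o]m+o≡n b≤a
...   | c , refl = ≤-trans (m≤m+n _ (c * c)) (≤-reflexive (lemma b c))
  where
  lemma : ∀ b c → 2 * ((b + c) * b) + c * c ≡ (b + c) * (b + c) + b * b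
  lemma = solve-∀

-- Chebyshev: with mean μ = S/T, sum the inequality 𝟙(X = 0) μ² + 2 μ X ≤ X² + μ²
second-moment : ∀ (xs : List 𝒜) (X : 𝒜 → ℕ) → let T = length xs ; S = ∑ xs X in
  ∑ xs (λ x → 𝟙 (X x ≟ 0)) * (S * S) + T * (S * S) ≤ T * T * ∑ xs (λ x → X x * X x)
second-moment xs X = +-cancelʳ-≤ (T * (S * S)) _ _ (begin
  Z * (S * S) + T * (S * S) + T * (S * S)        ≡⟨ lemma Z T S ⟩
  Z * (S * S) + 2 * T * S * S                    ≡⟨ cong₂ _+_ (sym (∑-*ʳ xs (S * S) _)) (sym (∑-*ˡ xs (2 * T * S) X)) ⟩
  ∑ xs (λ x → 𝟙 (X x ≟ 0) * (S * S)) + ∑ xs (λ x → 2 * T * S * X x)  ≡⟨ ∑-+ xs _ _ ⟨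
  ∑ xs (λ x → 𝟙 (X x ≟ 0) * (S * S) + 2 * T * S * X x) ≤⟨ ∑-mono xs (λ x _ → pointwise (X x)) ⟩
  ∑ xs (λ x → T * T * (X x * X x) + S * S)       ≡⟨ ∑-+ xs _ _ ⟩
  ∑ xs (λ x → T * T * (X x * X x)) + ∑ xs (λ _ → S * S)  ≡⟨ cong₂ _+_ (∑-*ˡ xs (T * T) _) (∑-const xs (S * S)) ⟩
  T * T * ∑ xs (λ x → X x * X x) + T * (S * S)   ∎)
  where
  open ≤-Reasoning
  T = length xs
  S = ∑ xs X
  Z = ∑ xs (λ x → 𝟙 (X x ≟ 0))
  lemma : ∀ Z T S → Z * (S * S) + T * (S * S) + T * (S * S) ≡ Z * (S * S) + 2 * T * S * S
  lemma = solve-∀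
  pointwise : ∀ y → 𝟙 (y ≟ 0) * (S * S) + 2 * T * S * y ≤ T * T * (y * y) + S * S
  pointwise zero    = ≤-reflexive (lemma′ T S)
    where
    lemma′ : ∀ T S → 1 * (S * S) + 2 * T * S * 0 ≡ T * T * 0 + S * S
    lemma′ = solve-∀
  pointwise y@(suc _) = begin
    2 * T * S * y             ≡⟨ lemma′ T S y ⟩
    2 * (T * y * S)           ≤⟨ 2ab≤a²+b² (T * y) S ⟩
    T * y * (T * y) + S * S   ≡⟨ cong (_+ S * S) (interchange T y T y) ⟩
    T * T * (y * y) + S * S   ∎
    where
    lemma′ : ∀ T S y → 2 * T * S * y ≡ 2 * (T * y * S)
    lemma′ = solve-∀

isolatedNodes : Vec (Subset m) n → ℕ
isolatedNodes {n = n} F = ∑ (allFin n) (λ v → isolated v F)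

∑-diagonal : ∀ n (u : Fin n) c → ∑ (allFin n) (λ v → 𝟙 (u Fin.≟ v) * c) ≤ c
∑-diagonal (suc n) u c = ≤-trans (≤-reflexive (cong (𝟙 (u Fin.≟ zero) * c +_)
  (trans (cong (λ xs → ∑ xs (λ v → 𝟙 (u Fin.≟ v) * c)) (sym (List.map-tabulate id suc))) (∑-map suc (allFin n) _)))) (go u)
  where
  go : ∀ u → 𝟙 (u Fin.≟ zero) * c + ∑ (allFin n) (λ v → 𝟙 (u Fin.≟ suc v) * c) ≤ c
  go zero    = ≤-reflexive (trans (cong₂ _+_ (*-identityˡ c) (∑-zero (allFin n))) (+-identityʳ c))
  go (suc u) = ∑-diagonal n u c

∑-isolatedNodes : ∀ n m k → ∑ (assignments (suc n) m k) isolatedNodes ≡ suc n * (binom m k * binom (m ∸ k) k ^ n)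
∑-isolatedNodes n m k = trans (∑-swap (assignments (suc n) m k) (allFin (suc n)) (λ F v → isolated v F))
  (trans (∑-cong (allFin (suc n)) λ v _ → ∑-isolated n m k v)
  (trans (∑-const (allFin (suc n)) _) (cong (_* (binom m k * binom (m ∸ k) k ^ n)) (List.length-tabulate {n = suc n} id))))

∑-square : ∀ N (xs : List 𝒜) (f : Fin N → 𝒜 → ℕ) E P → (∀ u → ∑ xs (λ x → f u x * f u x) ≤ E) →
           (∀ u v → u ≢ v → ∑ xs (λ x → f u x * f v x) ≤ P) →
           ∑ xs (λ x → ∑ (allFin N) (λ u → f u x) * ∑ (allFin N) (λ v → f v x)) ≤ N * E + N * N * P
∑-square N xs f E P same different = begin
  ∑ xs (λ x → X x * X x)
    ≡⟨ ∑-cong xs (λ x _ → trans (sym (∑-*ʳ Vs (X x) (λ u → f u x))) (∑-cong Vs λ u _ → sym (∑-*ˡ Vs (f u x) (λ v → f v x)))) ⟩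
  ∑ xs (λ x → ∑ Vs λ u → ∑ Vs λ v → f u x * f v x)
    ≡⟨ ∑-swap xs Vs (λ x u → ∑ Vs λ v → f u x * f v x) ⟩
  ∑ Vs (λ u → ∑ xs λ x → ∑ Vs λ v → f u x * f v x)
    ≤⟨ ∑-mono Vs (λ u _ → row u) ⟩
  ∑ Vs (λ _ → E + N * P)                        ≡⟨ trans (∑-const Vs (E + N * P)) (cong (_* (E + N * P)) lengthVs) ⟩
  N * (E + N * P)                               ≡⟨ trans (*-distribˡ-+ N E (N * P)) (cong (N * E +_) (sym (*-assoc N N P))) ⟩
  N * E + N * N * P                             ∎
  where
  open ≤-Reasoning
  Vs = allFin N
  X : _ → ℕ
  X x = ∑ Vs (λ v → f v x)
  lengthVs : length Vs ≡ N
  lengthVs = List.length-tabulate {n = N} id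
  pair : ∀ u v → (d : Dec (u ≡ v)) → ∑ xs (λ x → f u x * f v x) ≤ 𝟙 d * E + P
  pair u .u (yes refl) = ≤-trans (same u) (≤-trans (≤-reflexive (sym (*-identityˡ E))) (m≤m+n (1 * E) P))
  pair u v (no u≢v)    = different u v u≢v
  row : ∀ u → ∑ xs (λ x → ∑ Vs λ v → f u x * f v x) ≤ E + N * P
  row u = begin
    ∑ xs (λ x → ∑ Vs λ v → f u x * f v x)         ≡⟨ ∑-swap xs Vs (λ x v → f u x * f v x) ⟩
    ∑ Vs (λ v → ∑ xs λ x → f u x * f v x)         ≤⟨ ∑-mono Vs (λ v _ → pair u v (u Fin.≟ v)) ⟩
    ∑ Vs (λ v → 𝟙 (u Fin.≟ v) * E + P)            ≡⟨ ∑-+ Vs (λ v → 𝟙 (u Fin.≟ v) * E) (λ _ → P) ⟩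
    ∑ Vs (λ v → 𝟙 (u Fin.≟ v) * E) + ∑ Vs (λ _ → P) ≤⟨ +-mono-≤ (∑-diagonal N u E) (≤-reflexive (trans (∑-const Vs P) (cong (_* P) lengthVs))) ⟩
    E + N * P                                     ∎

∑-isolatedNodes² : ∀ n m k → let N = 2 + n ; a = binom (m ∸ k) k in
  ∑ (assignments N m k) (λ F → isolatedNodes F * isolatedNodes F)
  ≤ N * (binom m k * a ^ suc n) + N * N * (binom m k * (a * binom (m ∸ (k + k)) k ^ n))
∑-isolatedNodes² n m k = ∑-square (2 + n) (assignments (2 + n) m k) isolated _ _
  (λ u → ≤-trans (∑-mono (assignments (2 + n) m k) λ F _ → *-monoʳ-≤ (isolated u F) (isolated≤1 u F))
    (≤-reflexive (trans (∑-*ʳ (assignments (2 + n) m k) 1 (isolated u)) (trans (*-identityʳ _) (∑-isolated (suc n) m k u)))))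
  (∑-isolated-pair n m k)

another : 2 ≤ n → (v : Fin n) → ∃[ u ] v ≢ u
another (s≤s (s≤s z≤n)) zero    = suc zero , λ ()
another (s≤s (s≤s z≤n)) (suc v) = zero , λ ()

-- A path from an isolated `v` to another node would begin with an edge at `v`.
connected⇒no-isolated : 2 ≤ n → (F : Vec (Subset m) n) → Connected F → isolatedNodes F ≡ 0
connected⇒no-isolated {n} 2≤n F conn = trans (∑-cong (allFin n) λ v _ → zero-at v) (∑-zero (allFin n))
  where
  zero-at : ∀ v → isolated v F ≡ 0
  zero-at v with isolated-cases v F
  ... | inj₁ eq = eq
  ... | inj₂ F⊆ with another 2≤n v
  ...   | u , v≢u with conn v u
  ...     | stop = contradiction refl v≢u
  ...     | _◅_ {j = w} (v≢w , c , c∈) _ with x∈p∩q⁻ (lookup F v) (lookup F w) c∈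
  ...       | c∈v , c∈w = contradiction c∈v (x∈∁p⇒x∉p (F⊆ w (v≢w ∘ sym) c∈w))

connected : ℕ → ℕ → ℕ → ℕ
connected n m k = length (filter connected? (assignments n m k))

connected≤no-isolated : ∀ n m k → 2 ≤ n → connected n m k ≤ ∑ (assignments n m k) (λ F → 𝟙 (isolatedNodes F ≟ 0))
connected≤no-isolated n m k 2≤n = length-filter-≤ connected? (assignments n m k)
  λ F _ conn → ≤-reflexive (sym (𝟙-yes (isolatedNodes F ≟ 0) (connected⇒no-isolated 2≤n F conn)))

-- With mean μ = S/T this is Pr(X = 0) ≤ 1/μ + (C/a - 1): the diagonal contributes 1/μ, and by
-- log-concavity the pairs contribute at most C/a. The hypotheses `mean` and `ratio` make both terms
-- at most 1/(2D).
second-moment-bound : ∀ n m k D → let N = 2 + n ; C = binom m k ; a = binom (m ∸ k) k in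
  1 ≤ a → binom (m ∸ (k + k)) k * C ≤ a * a →
  2 * D * C ^ N ≤ N * (C * a ^ suc n) → 2 * D * C ≤ suc (2 * D) * a →
  1 ≤ C → D * connected N m k ≤ C ^ N
second-moment-bound n m k D 1≤a a₂C≤a² mean ratio 1≤C =
  cancelʳ (2 * a * (S * S)) (*-mono-≤ (*-mono-≤ (s≤s (z≤n {1})) 1≤a) (*-mono-≤ 1≤S 1≤S)) (begin
  D * Y * (2 * a * (S * S))                      ≤⟨ *-monoˡ-≤ (2 * a * (S * S)) (*-monoʳ-≤ D (connected≤no-isolated (2 + n) m k (s≤s (s≤s z≤n)))) ⟩
  D * Z * (2 * a * (S * S))                      ≤⟨ +-cancelʳ-≤ (2 * D * a * (T * (S * S))) _ _ (begin
    D * Z * (2 * a * (S * S)) + 2 * D * a * (T * (S * S))     ≡⟨ lemma₁ D Z a S T ⟩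
    2 * D * (a * (Z * (S * S) + T * (S * S)))                 ≤⟨ *-monoʳ-≤ (2 * D) (*-monoʳ-≤ a moments) ⟩
    2 * D * (a * (T * T * (S + N * N * P)))                   ≡⟨ lemma₂ D a T S (N * N * P) ⟩
    2 * D * T * (a * T * S) + 2 * D * T * (a * (T * (N * N * P)))   ≤⟨ +-mono-≤ (*-monoˡ-≤ (a * T * S) mean′) (*-monoʳ-≤ (2 * D * T) pairs) ⟩
    S * (a * T * S) + 2 * D * T * (C * (S * S))               ≡⟨ lemma₃ S a T D C ⟩
    a * (T * (S * S)) + 2 * D * C * (T * (S * S))             ≤⟨ +-monoʳ-≤ (a * (T * (S * S))) (*-monoˡ-≤ (T * (S * S)) ratio) ⟩
    a * (T * (S * S)) + suc (2 * D) * a * (T * (S * S))       ≡⟨ lemma₄ a T S D ⟩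
    T * (2 * a * (S * S)) + 2 * D * a * (T * (S * S))         ∎) ⟩
  T * (2 * a * (S * S))                          ∎)
  where
  open ≤-Reasoning
  N = 2 + n
  C = binom m k
  a = binom (m ∸ k) k
  a₂ = binom (m ∸ (k + k)) k
  As = assignments N m k
  Y = connected N m k
  Z = ∑ As (λ F → 𝟙 (isolatedNodes F ≟ 0))
  T = C ^ N
  S = N * (C * a ^ suc n)
  P = C * (a * a₂ ^ n)
  1≤S : 1 ≤ S
  1≤S = *-mono-≤ (s≤s (z≤n {suc n})) (*-mono-≤ 1≤C (^-pos (suc n) 1≤a))
  mean′ : 2 * D * T ≤ S
  mean′ = mean
  moments : Z * (S * S) + T * (S * S) ≤ T * T * (S + N * N * P)
  moments = subst₂ (λ T S → Z * (S * S) + T * (S * S) ≤ T * T * (N * (C * a ^ suc n) + N * N * P))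
    (length-assignments N m k) (∑-isolatedNodes (suc n) m k)
    (≤-trans (second-moment As isolatedNodes) (*-monoʳ-≤ (length As * length As) (∑-isolatedNodes² n m k)))
  -- C/a instead of 1, because the mutual avoidance of the two nodes enters once in `P` but twice in
  -- the square of the mean.
  pairs : a * (T * (N * N * P)) ≤ C * (S * S)
  pairs = begin
    a * (T * (N * N * P))                              ≡⟨ lemma a C (C ^ n) N (a₂ ^ n) ⟩
    N * N * (C * C * C * (a * a)) * (a₂ ^ n * C ^ n)   ≡⟨ cong (N * N * (C * C * C * (a * a)) *_) (^-distribʳ-* n a₂ C) ⟨
    N * N * (C * C * C * (a * a)) * (a₂ * C) ^ n       ≤⟨ *-monoʳ-≤ (N * N * (C * C * C * (a * a))) (^-monoˡ-≤ n a₂C≤a²) ⟩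
    N * N * (C * C * C * (a * a)) * (a * a) ^ n        ≡⟨ cong (N * N * (C * C * C * (a * a)) *_) (^-distribʳ-* n a a) ⟩
    N * N * (C * C * C * (a * a)) * (a ^ n * a ^ n)    ≡⟨ lemma′ a C N (a ^ n) ⟩
    C * (S * S)                                        ∎
    where
    lemma : ∀ a C p N q → a * (C * (C * p) * (N * N * (C * (a * q)))) ≡ N * N * (C * C * C * (a * a)) * (q * p)
    lemma = solve-∀
    lemma′ : ∀ a C N x → N * N * (C * C * C * (a * a)) * (x * x) ≡ C * (N * (C * (a * x)) * (N * (C * (a * x))))
    lemma′ = solve-∀
  lemma₁ : ∀ D Z a S T → D * Z * (2 * a * (S * S)) + 2 * D * a * (T * (S * S)) ≡ 2 * D * (a * (Z * (S * S) + T * (S * S)))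
  lemma₁ = solve-∀
  lemma₂ : ∀ D a T S x → 2 * D * (a * (T * T * (S + x))) ≡ 2 * D * T * (a * T * S) + 2 * D * T * (a * (T * x))
  lemma₂ = solve-∀
  lemma₃ : ∀ S a T D C → S * (a * T * S) + 2 * D * T * (C * (S * S)) ≡ a * (T * (S * S)) + 2 * D * C * (T * (S * S))
  lemma₃ = solve-∀
  lemma₄ : ∀ a T S D → a * (T * (S * S)) + suc (2 * D) * a * (T * (S * S)) ≡ T * (2 * a * (S * S)) + 2 * D * a * (T * (S * S))
  lemma₄ = solve-∀

-- Below the threshold

-- `c₀` adds up the constants c for which ck² ≤ m is used.
module SparseThreshold
  (R D K c₀ : ℕ)
  (K≡ : K ≡ 2 * suc R)
  (c₀≡ : c₀ ≡ K * K * (2 + K) + (2 * D + 2) + 3)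
  where

  open ≤-Reasoning

  Q γ e y I N : ℕ
  Q = suc K
  γ = suc D
  e = suc (K * γ)
  y = 2 * K * c₀
  -- The three summands ensure that `i′` is large, that `i′ + K * γ` is `i`, and that y ≤ τ.
  I = 2 * Q * R * e + K * γ + 2 * K * y
  N = Q ^ I + 2

  1≤K : 1 ≤ K
  1≤K = subst (1 ≤_) (sym K≡) (s≤s z≤n)

  module _ (m k i n′ : ℕ)
    (n≤m : 2 + n′ ≤ m) (1≤k : 1 ≤ k) (I≤i : I ≤ i)
    (lower-n : suc K ^ i ≤ (2 + n′) * K ^ i)
    (sparse : suc R * (K * (k * k * (2 + n′))) ≤ R * (m * suc i))
    where

    ν = 2 + n′

    2^[i/K]≤n : ∀ t → K * t ≤ i → 2 ^ t ≤ ν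
    2^[i/K]≤n t Kt≤i = cancelʳ (K ^ i) (^-pos i 1≤K) (begin
      2 ^ t * K ^ i                             ≡⟨ cong (λ x → 2 ^ t * K ^ x) i≡ ⟩
      2 ^ t * K ^ (K * t + r)                   ≡⟨ cong (2 ^ t *_) (^-distribˡ-+-* K (K * t) r) ⟩
      2 ^ t * (K ^ (K * t) * K ^ r)             ≡⟨ *-assoc (2 ^ t) (K ^ (K * t)) (K ^ r) ⟨
      2 ^ t * K ^ (K * t) * K ^ r               ≤⟨ *-mono-≤ (2K^K≤[1+K]^K K t 1≤K) (^-monoˡ-≤ r (n≤1+n K)) ⟩
      Q ^ (K * t) * Q ^ r                       ≡⟨ ^-distribˡ-+-* Q (K * t) r ⟨
      Q ^ (K * t + r)                           ≡⟨ cong (Q ^_) i≡ ⟨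
      Q ^ i                                     ≤⟨ lower-n ⟩
      ν * K ^ i                                 ∎)
      where
      r = i ∸ K * t
      i≡ : i ≡ K * t + r
      i≡ = sym (m+[n∸m]≡n Kt≤i)

    instance
      2K-nonZero : NonZero (2 * K)
      2K-nonZero = >-nonZero (≤-trans 1≤K (m≤m+n K (K + 0)))

    τ = i / (2 * K)

    y≤τ : y ≤ τ
    y≤τ = ≮⇒≥ λ τ<y → <⇒≱ (m<[1+m/n]*n i (2 * K)) (begin
      suc τ * (2 * K)     ≤⟨ *-monoˡ-≤ (2 * K) τ<y ⟩
      y * (2 * K)         ≡⟨ *-comm y (2 * K) ⟩
      2 * K * y           ≤⟨ m≤n+m (2 * K * y) (2 * Q * R * e + K * γ) ⟩
      I                   ≤⟨ I≤i ⟩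
      i                   ∎)

    -- Logarithms are small against `n`: in n ≥ 2^τ 2^τ one factor is at least the constant `y`, the
    -- other at least τ + 1. As `sparse` gives k²n ≤ m(i+1), it follows that k² is small against
    -- `m`.
    c₀[i+1]≤n : c₀ * suc i ≤ ν
    c₀[i+1]≤n = begin
      c₀ * suc i                   ≤⟨ *-monoʳ-≤ c₀ (m<[1+m/n]*n i (2 * K)) ⟩
      c₀ * (suc τ * (2 * K))       ≡⟨ lemma c₀ (suc τ) K ⟩
      y * suc τ                    ≤⟨ *-mono-≤ (≤-trans y≤τ (n≤2^n τ)) (n<2^n τ) ⟩
      2 ^ τ * 2 ^ τ                ≡⟨ ^-distribˡ-+-* 2 τ τ ⟨
      2 ^ (τ + τ)                  ≤⟨ 2^[i/K]≤n (τ + τ) (≤-trans (≤-reflexive (lemma′ K τ)) (m/n*n≤m i (2 * K))) ⟩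
      ν                            ∎
      where
      lemma : ∀ c t K → c * (t * (2 * K)) ≡ 2 * K * c * t
      lemma = solve-∀
      lemma′ : ∀ K t → K * (t + t) ≡ t * (2 * K)
      lemma′ = solve-∀

    c₀k²≤m : c₀ * (k * k) ≤ m
    c₀k²≤m = cancelʳ (suc i) (s≤s z≤n) (begin
      c₀ * (k * k) * suc i      ≡⟨ xy∙z≈y∙xz c₀ (k * k) (suc i) ⟩
      k * k * (c₀ * suc i)      ≤⟨ *-monoʳ-≤ (k * k) c₀[i+1]≤n ⟩
      k * k * ν                 ≤⟨ cancelˡ (suc R) (s≤s z≤n) (begin
        suc R * (k * k * ν)           ≤⟨ *-monoʳ-≤ (suc R) (m≤n*m (k * k * ν) K {{>-nonZero 1≤K}}) ⟩
        suc R * (K * (k * k * ν))     ≤⟨ sparse ⟩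
        R * (m * suc i)               ≤⟨ *-monoˡ-≤ (m * suc i) (n≤1+n R) ⟩
        suc R * (m * suc i)           ∎) ⟩
      m * suc i                 ∎)

    k≤k² : k ≤ k * k
    k≤k² = m≤m*n k k {{>-nonZero 1≤k}}

    part : ∀ c → c ≤ c₀ → c * (k * k) ≤ m
    part c c≤c₀ = ≤-trans (*-monoˡ-≤ (k * k) c≤c₀) c₀k²≤m

    3k²≤m : 3 * (k * k) ≤ m
    3k²≤m = part 3 (≤-trans (m≤n+m 3 (K * K * (2 + K) + (2 * D + 2))) (≤-reflexive (sym c₀≡)))

    c = m ∸ (k + k)

    1≤c : 1 ≤ c
    1≤c = ≤-trans 1≤k (≤-trans (≤-reflexive (sym (trans (cong (_∸ (k + k)) (lemma k)) (m+n∸m≡n (k + k) k))))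
            (∸-monoˡ-≤ (k + k) (≤-trans (*-monoʳ-≤ 3 k≤k²) 3k²≤m)))
      where
      lemma : ∀ k → 3 * k ≡ k + k + k
      lemma = solve-∀

    2k≤m : k + k ≤ m
    2k≤m = begin
      k + k              ≤⟨ m≤m+n (k + k) k ⟩
      k + k + k          ≡⟨ lemma k ⟩
      3 * k              ≤⟨ *-monoʳ-≤ 3 k≤k² ⟩
      3 * (k * k)        ≤⟨ 3k²≤m ⟩
      m                  ∎
      where
      lemma : ∀ k → k + k + k ≡ 3 * k
      lemma = solve-∀

    m≡ : m ≡ k + (k + c)
    m≡ = sym (trans (sym (+-assoc k k c)) (m+[n∸m]≡n 2k≤m))

    M = k + c

    m∸k≡M : m ∸ k ≡ M
    m∸k≡M = trans (cong (_∸ k) m≡) (m+n∸m≡n k M)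

    C = binom m k
    a = binom (m ∸ k) k

    -- The `K * γ` steps set aside yield the factor 2^γ in `tail`, which lifts the mean to 2D.
    i′ = i ∸ K * γ

    i≡ : i′ + K * γ ≡ i
    i≡ = m∸n+n≡m (≤-trans (≤-trans (m≤n+m (K * γ) (2 * Q * R * e)) (m≤m+n _ (2 * K * y))) I≤i)

    i′≥ : 2 * Q * R * e ≤ i′
    i′≥ = +-cancelʳ-≤ (K * γ) _ _ (≤-trans (m≤m+n _ (2 * K * y)) (≤-trans I≤i (≤-reflexive (sym i≡))))

    rate : k * ν * (k * Q) + i′ * (k * Q) ≤ i′ * M
    rate = +-cancelʳ-≤ (i′ * k) _ _ (cancelˡ (K * K) (*-mono-≤ 1≤K 1≤K) (begin
      K * K * (k * ν * (k * Q) + i′ * (k * Q) + i′ * k)          ≡⟨ lemma₁ K k ν i′ ⟩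
      suc K * (K * (K * (k * k * ν))) + K * K * (2 + K) * k * i′ ≤⟨ +-mono-≤ dense (*-monoˡ-≤ i′ (≤-trans (*-monoʳ-≤ (K * K * (2 + K)) k≤k²)
                                                                     (part (K * K * (2 + K)) (≤-trans (m≤n⇒m≤n+o 3 (m≤m+n _ (2 * D + 2))) (≤-reflexive (sym c₀≡)))))) ⟩
      2 * Q * R * (m * suc i) + m * i′                           ≡⟨ cong (λ i → 2 * Q * R * (m * suc i) + m * i′) i≡ ⟨
      2 * Q * R * (m * suc (i′ + K * γ)) + m * i′                ≡⟨ lemma₂ (2 * Q * R) m i′ (K * γ) ⟩
      2 * Q * R * (m * i′) + m * (2 * Q * R * e) + m * i′        ≤⟨ +-monoˡ-≤ (m * i′) (+-monoʳ-≤ (2 * Q * R * (m * i′)) (*-monoʳ-≤ m i′≥)) ⟩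
      2 * Q * R * (m * i′) + m * i′ + m * i′                     ≡⟨ lemma₃ (2 * Q * R) (m * i′) ⟩
      (2 * Q * R + 2) * (m * i′)                                 ≤⟨ *-monoˡ-≤ (m * i′) coefficient ⟩
      K * K * (m * i′)                                           ≡⟨ cong (K * K *_) (trans (cong (_* i′) m≡) (lemma₄ k M i′)) ⟩
      K * K * (i′ * M + i′ * k)                                  ∎))
      where
      dense : suc K * (K * (K * (k * k * ν))) ≤ 2 * Q * R * (m * suc i)
      dense = begin
        suc K * (K * (K * (k * k * ν)))               ≡⟨ cong (λ x → suc K * (x * (K * (k * k * ν)))) K≡ ⟩
        suc K * (2 * suc R * (K * (k * k * ν)))       ≡⟨ lemma (suc K) (suc R) (K * (k * k * ν)) ⟩
        2 * Q * (suc R * (K * (k * k * ν)))           ≤⟨ *-monoʳ-≤ (2 * Q) sparse ⟩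
        2 * Q * (R * (m * suc i))                     ≡⟨ *-assoc (2 * Q) R (m * suc i) ⟨
        2 * Q * R * (m * suc i)                       ∎
        where
        lemma : ∀ q r x → q * (2 * r * x) ≡ 2 * q * (r * x)
        lemma = solve-∀
      -- As R/(R+1) = 2R/K, the main term has the coefficient 2QR; the 2 is for two terms of lower
      -- order, each at most m i′.
      coefficient : 2 * Q * R + 2 ≤ K * K
      coefficient = subst (λ K → 2 * suc K * R + 2 ≤ K * K) (sym K≡)
        (≤-trans (m≤m+n _ (2 * R + 2)) (≤-reflexive (lemma R)))
        where
        lemma : ∀ R → 2 * suc (2 * suc R) * R + 2 + (2 * R + 2) ≡ 2 * suc R * (2 * suc R)
        lemma = solve-∀
      lemma₁ : ∀ K k ν i → K * K * (k * ν * (k * suc K) + i * (k * suc K) + i * k) ≡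
                           suc K * (K * (K * (k * k * ν))) + K * K * (2 + K) * k * i
      lemma₁ = solve-∀
      lemma₂ : ∀ x m i g → x * (m * suc (i + g)) + m * i ≡ x * (m * i) + m * (x * suc g) + m * i
      lemma₂ = solve-∀
      lemma₃ : ∀ x z → x * z + z + z ≡ (x + 2) * z
      lemma₃ = solve-∀
      lemma₄ : ∀ k M i → (k + M) * i ≡ i * M + i * k
      lemma₄ = solve-∀

    tail : 2 ^ γ * Q ^ i′ ≤ ν * K ^ i′
    tail = cancelʳ (K ^ (K * γ)) (^-pos (K * γ) 1≤K) (begin
      2 ^ γ * Q ^ i′ * K ^ (K * γ)       ≡⟨ xy∙z≈y∙xz (2 ^ γ) (Q ^ i′) (K ^ (K * γ)) ⟩
      Q ^ i′ * (2 ^ γ * K ^ (K * γ))     ≤⟨ *-monoʳ-≤ (Q ^ i′) (2K^K≤[1+K]^K K γ 1≤K) ⟩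
      Q ^ i′ * Q ^ (K * γ)               ≡⟨ trans (sym (^-distribˡ-+-* Q i′ (K * γ))) (cong (Q ^_) i≡) ⟩
      Q ^ i                              ≤⟨ lower-n ⟩
      ν * K ^ i                          ≡⟨ cong (ν *_) (trans (cong (K ^_) (sym i≡)) (^-distribˡ-+-* K i′ (K * γ))) ⟩
      ν * (K ^ i′ * K ^ (K * γ))         ≡⟨ *-assoc ν (K ^ i′) _ ⟨
      ν * K ^ i′ * K ^ (K * γ)           ∎)

    decayed : 2 ^ γ * M ^ (k * ν) ≤ ν * c ^ (k * ν)
    decayed = cancelʳ (K ^ i′) (^-pos i′ 1≤K) (begin
      2 ^ γ * M ^ (k * ν) * K ^ i′         ≡⟨ *-assoc (2 ^ γ) (M ^ (k * ν)) (K ^ i′) ⟩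
      2 ^ γ * (M ^ (k * ν) * K ^ i′)       ≤⟨ *-monoʳ-≤ (2 ^ γ) (subst (λ x → x ^ (k * ν) * K ^ i′ ≤ c ^ (k * ν) * Q ^ i′) (+-comm c k)
                                                (decay-lower c k K i′ (k * ν) 1≤c 1≤k (subst (λ x → k * ν * (k * Q) + i′ * (k * Q) ≤ i′ * x) (+-comm k c) rate))) ⟩
      2 ^ γ * (c ^ (k * ν) * Q ^ i′)       ≡⟨ x∙yz≈y∙xz (2 ^ γ) (c ^ (k * ν)) (Q ^ i′) ⟩
      c ^ (k * ν) * (2 ^ γ * Q ^ i′)       ≤⟨ *-monoʳ-≤ (c ^ (k * ν)) tail ⟩
      c ^ (k * ν) * (ν * K ^ i′)           ≡⟨ x∙yz≈yx∙z (c ^ (k * ν)) ν (K ^ i′) ⟩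
      ν * c ^ (k * ν) * K ^ i′             ∎)

    C*c^k≤a*M^k : C * c ^ k ≤ a * M ^ k
    C*c^k≤a*M^k = subst₂ (λ x y → binom x k * c ^ k ≤ binom y k * M ^ k) (sym m≡) (sym m∸k≡M) (binom-avoid-≥ k c k 0 (+-identityʳ k))

    1≤a : 1 ≤ a
    1≤a = 1≤binom (≤-trans (m≤m+n k c) (≤-reflexive (sym m∸k≡M)))

    a≤C : a ≤ C
    a≤C = binom-monoˡ-≤ k (m∸n≤m m k)

    1≤C : 1 ≤ C
    1≤C = ≤-trans 1≤a a≤C

    -- The mean is ν(a/C)^(ν-1) ≥ ν(a/C)^ν ≥ ν(c/M)^(kν) ≥ 2^γ.
    mean : 2 * D * C ^ ν ≤ ν * (C * a ^ suc n′)
    mean = begin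
      2 * D * C ^ ν                  ≤⟨ *-monoˡ-≤ (C ^ ν) (*-monoʳ-≤ 2 (<⇒≤ (n<2^n D))) ⟩
      2 ^ γ * C ^ ν                  ≤⟨ cancelʳ (c ^ (k * ν)) (^-pos (k * ν) 1≤c) (begin
        2 ^ γ * C ^ ν * c ^ (k * ν)         ≡⟨ *-assoc (2 ^ γ) (C ^ ν) _ ⟩
        2 ^ γ * (C ^ ν * c ^ (k * ν))       ≡⟨ cong (2 ^ γ *_) (trans (cong (C ^ ν *_) (sym (^-*-assoc c k ν))) (sym (^-distribʳ-* ν C (c ^ k)))) ⟩
        2 ^ γ * (C * c ^ k) ^ ν             ≤⟨ *-monoʳ-≤ (2 ^ γ) (^-monoˡ-≤ ν C*c^k≤a*M^k) ⟩
        2 ^ γ * (a * M ^ k) ^ ν             ≡⟨ cong (2 ^ γ *_) (trans (^-distribʳ-* ν a (M ^ k)) (cong (a ^ ν *_) (^-*-assoc M k ν))) ⟩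
        2 ^ γ * (a ^ ν * M ^ (k * ν))       ≡⟨ x∙yz≈y∙xz (2 ^ γ) (a ^ ν) (M ^ (k * ν)) ⟩
        a ^ ν * (2 ^ γ * M ^ (k * ν))       ≤⟨ *-monoʳ-≤ (a ^ ν) decayed ⟩
        a ^ ν * (ν * c ^ (k * ν))           ≡⟨ x∙yz≈yx∙z (a ^ ν) ν (c ^ (k * ν)) ⟩
        ν * a ^ ν * c ^ (k * ν)             ∎) ⟩
      ν * a ^ ν                      ≤⟨ *-monoʳ-≤ ν (*-monoˡ-≤ (a ^ suc n′) a≤C) ⟩
      ν * (C * a ^ suc n′)           ∎

    [2D+1]k²≤M : suc (2 * D) * (k * k) ≤ M
    [2D+1]k²≤M = +-cancelˡ-≤ k _ _ (begin
      k + suc (2 * D) * (k * k)             ≤⟨ +-monoˡ-≤ (suc (2 * D) * (k * k)) k≤k² ⟩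
      k * k + suc (2 * D) * (k * k)         ≡⟨ cong (_* (k * k)) (+-comm 2 (2 * D)) ⟩
      (2 * D + 2) * (k * k)                 ≤⟨ part (2 * D + 2) (≤-trans (m≤n⇒m≤n+o 3 (m≤n+m (2 * D + 2) (K * K * (2 + K)))) (≤-reflexive (sym c₀≡))) ⟩
      m                                     ≡⟨ m≡ ⟩
      k + M                                 ∎)

    -- Bernoulli's inequality applied to a/C ≥ (1 - k/M)^k gives 1 - a/C ≤ k²/M, which tends to 0.
    C*M≤ : C * M ≤ a * M + C * (k * k)
    C*M≤ = cancelʳ (M ^ k) (^-pos k (≤-trans 1≤k (m≤m+n k c))) (begin
      C * M * M ^ k                               ≡⟨ xy∙z≈x∙zy C M (M ^ k) ⟩
      C * (M ^ k * M)                             ≤⟨ *-monoʳ-≤ C (subst (λ x → x ^ k * x ≤ c ^ k * x + k * k * x ^ k) (+-comm c k) (bernoulli⁻ c k k)) ⟩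
      C * (c ^ k * M + k * k * M ^ k)             ≡⟨ lemma₂ C (c ^ k) M (k * k) (M ^ k) ⟩
      C * c ^ k * M + C * (k * k) * M ^ k         ≤⟨ +-monoˡ-≤ (C * (k * k) * M ^ k) (*-monoˡ-≤ M C*c^k≤a*M^k) ⟩
      a * M ^ k * M + C * (k * k) * M ^ k         ≡⟨ lemma₃ a (M ^ k) M (C * (k * k)) ⟩
      (a * M + C * (k * k)) * M ^ k               ∎)
      where
      lemma₂ : ∀ C x M y p → C * (x * M + y * p) ≡ C * x * M + C * y * p
      lemma₂ = solve-∀
      lemma₃ : ∀ a p M z → a * p * M + z * p ≡ (a * M + z) * p
      lemma₃ = solve-∀

    ratio-bound : 2 * D * C ≤ suc (2 * D) * a
    ratio-bound = cancelʳ M (≤-trans 1≤k (m≤m+n k c)) (+-cancelʳ-≤ (C * M) _ _ (begin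
      2 * D * C * M + C * M                                        ≡⟨ lemma₁ D C M ⟩
      suc (2 * D) * (C * M)                                        ≤⟨ *-monoʳ-≤ (suc (2 * D)) C*M≤ ⟩
      suc (2 * D) * (a * M + C * (k * k))                          ≡⟨ lemma₂ (suc (2 * D)) a M C (k * k) ⟩
      suc (2 * D) * a * M + C * (suc (2 * D) * (k * k))            ≤⟨ +-monoʳ-≤ (suc (2 * D) * a * M) (*-monoʳ-≤ C [2D+1]k²≤M) ⟩
      suc (2 * D) * a * M + C * M                                  ∎))
      where
      lemma₁ : ∀ D C M → 2 * D * C * M + C * M ≡ suc (2 * D) * (C * M)
      lemma₁ = solve-∀
      lemma₂ : ∀ d a M C x → d * (a * M + C * x) ≡ d * a * M + C * (d * x)
      lemma₂ = solve-∀

    concave : binom (m ∸ (k + k)) k * C ≤ a * a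
    concave = subst₂ (λ x y → binom c k * binom x k ≤ binom y k * binom y k) (sym m≡) (sym m∸k≡M) (binom-log-concave c k k)

    rare : D * connected ν m k ≤ C ^ ν
    rare = second-moment-bound n′ m k D 1≤a concave mean ratio-bound 1≤C

  bound : ∀ n m k → N ≤ n → n ≤ m → 1 ≤ k →
    (∀ i → n * K ^ i ≤ suc K ^ i → suc R * (K * (k * k * n)) ≤ R * (m * i)) →
    D * connected n m k ≤ binom m k ^ n
  bound (suc (suc n′)) m k N≤n n≤m 1≤k sparse =
    let i , log = isLog K (2 + n′) 1≤K (s≤s z≤n) in
    rare m k i n′ n≤m 1≤k (isLog-unbounded I 1≤K log (≤-trans (m≤m+n (Q ^ I) 2) N≤n)) (proj₁ log) (sparse (suc i) (<⇒≤ (proj₂ log)))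
  bound zero       m k N≤n = contradiction (≤-trans (m≤n+m 2 (Q ^ I)) N≤n) λ ()
  bound (suc zero) m k N≤n = contradiction (≤-trans (m≤n+m 2 (Q ^ I)) N≤n) λ { (s≤s ()) }

abstract
  connected-rare : ∀ R D → let K = 2 * suc R in ∃[ N ] ∀ n m k → N ≤ n → n ≤ m → 1 ≤ k →
    (∀ i → n * K ^ i ≤ suc K ^ i → suc R * (K * (k * k * n)) ≤ R * (m * i)) →
    D * connected n m k ≤ binom m k ^ n
  connected-rare R D = _ , SparseThreshold.bound R D _ _ refl refl

-- Translation from real to natural numbers

import Data.Integer.Base as ℤ
import Data.Integer.Properties as ℤ
open import Data.Rational.Base as ℚ using (ℚ; 0ℚ; 1ℚ; toℚᵘ)
import Data.Rational.Properties as ℚ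
open import Algebra.Properties.CommutativeSemigroup (CommutativeMonoid.commutativeSemigroup ℚ.*-1-commutativeMonoid)
  using () renaming (interchange to ℚ-interchange)
import Data.Rational.Unnormalised.Base as ℚᵘ
import Data.Rational.Unnormalised.Properties as ℚᵘ

open HarmonicLemmas
open RationalLemmas
open RecipLemmas
open PositivityLemmas

toℚᵘ-fromℕ : ∀ n → toℚᵘ (fromℕ n) ℚᵘ.≃ ℚᵘ.mkℚᵘ (ℤ.+ n) 0
toℚᵘ-fromℕ n = ℚ.toℚᵘ-fromℚᵘ (ℚᵘ.mkℚᵘ (ℤ.+ n) 0)

fromℕ-mono-≤ : ∀ {a b} → a ≤ b → fromℕ a ℚ.≤ fromℕ b
fromℕ-mono-≤ {a} {b} a≤b = ℚ.toℚᵘ-cancel-≤ (begin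
  toℚᵘ (fromℕ a)         ≃⟨ toℚᵘ-fromℕ a ⟩
  ℚᵘ.mkℚᵘ (ℤ.+ a) 0      ≤⟨ ℚᵘ.*≤* (ℤ.*-monoʳ-≤-nonNeg (ℤ.+ 1) (ℤ.+≤+ a≤b)) ⟩
  ℚᵘ.mkℚᵘ (ℤ.+ b) 0      ≃⟨ toℚᵘ-fromℕ b ⟨
  toℚᵘ (fromℕ b)         ∎)
  where open ℚᵘ.≤-Reasoning

fromℕ-cancel-≤ : ∀ {a b} → fromℕ a ℚ.≤ fromℕ b → a ≤ b
fromℕ-cancel-≤ {a} {b} h with begin
    ℚᵘ.mkℚᵘ (ℤ.+ a) 0      ≃⟨ toℚᵘ-fromℕ a ⟨
    toℚᵘ (fromℕ a)         ≤⟨ ℚ.toℚᵘ-mono-≤ h ⟩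
    toℚᵘ (fromℕ b)         ≃⟨ toℚᵘ-fromℕ b ⟩
    ℚᵘ.mkℚᵘ (ℤ.+ b) 0      ∎
  where open ℚᵘ.≤-Reasoning
... | ℚᵘ.*≤* le = ℤ.drop‿+≤+ (ℤ.*-cancelʳ-≤-pos (ℤ.+ a) (ℤ.+ b) (ℤ.+ 1) le)

fromℕ-+ : ∀ a b → fromℕ (a + b) ≡ fromℕ a ℚ.+ fromℕ b
fromℕ-+ zero    b = sym (ℚ.+-identityˡ (fromℕ b))
fromℕ-+ (suc a) b = trans (fromℕ-suc (a + b)) (trans (cong (1ℚ ℚ.+_) (fromℕ-+ a b))
  (trans (sym (ℚ.+-assoc 1ℚ (fromℕ a) (fromℕ b))) (cong (ℚ._+ fromℕ b) (sym (fromℕ-suc a)))))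

fromℕ-* : ∀ a b → fromℕ (a * b) ≡ fromℕ a ℚ.* fromℕ b
fromℕ-* zero    b = sym (ℚ.*-zeroˡ (fromℕ b))
fromℕ-* (suc a) b = trans (fromℕ-+ b (a * b)) (trans (cong (fromℕ b ℚ.+_) (fromℕ-* a b)) (sym (fromℕ-suc-* a (fromℕ b))))

fromℕ-nonNeg : ∀ n → 0ℚ ℚ.≤ fromℕ n
fromℕ-nonNeg n = fromℕ-mono-≤ (z≤n {n})

fromℕ-*-1/suc≡1 : ∀ p → fromℕ (suc p) ℚ.* 1/suc p ≡ 1ℚ
fromℕ-*-1/suc≡1 p = trans (cong (λ q → fromℕ (suc p) ℚ.* 1/suc q) (sym (+-identityʳ p))) (fromℕ-*-1/suc p 0)

*-monoˡ : ∀ {c p q} → 0ℚ ℚ.≤ c → p ℚ.≤ q → c ℚ.* p ℚ.≤ c ℚ.* q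
*-monoˡ {c} 0≤c = ℚ.*-monoˡ-≤-nonNeg c {{ℚ.nonNegative 0≤c}}

harmonic-mono : ∀ a {c d} → c ≤ d → harmonic a c ℚ.≤ harmonic a d
harmonic-mono a {zero}  {zero}  _         = ℚ.≤-refl
harmonic-mono a {zero}  {suc d} _         = ℚ.≤-trans (harmonic-mono (suc a) (z≤n {d}))
  (subst (ℚ._≤ harmonic a (suc d)) (ℚ.+-identityˡ _) (ℚ.+-monoˡ-≤ (harmonic (suc a) d) (ℚ.<⇒≤ (0<1/suc a))))
harmonic-mono a {suc c} {suc d} (s≤s c≤d) = ℚ.+-monoʳ-≤ (1/suc a) (harmonic-mono (suc a) c≤d)

-- ∫ dt/t over [cKⁱ, c(K+1)ⁱ] is the sum of i integrals over intervals [a, a(1 + 1/K)]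
module GeometricChain (κ : ℕ) where
  K Q : ℕ
  K = suc κ
  Q = suc K

  -- Writing c for `suc c`: the last interval [cKQ^i, cQQ^i] of ratio Q/K is cut off, and what
  -- remains is the chain of length `i` with cK in place of c.
  split : ∀ i c len → suc c * K ^ suc i + len ≡ suc c * Q ^ suc i →
          let x = suc c * Q ^ i ; len′ = suc c * K * Q ^ i ∸ suc c * K * K ^ i in
          (suc c * K * K ^ i + len′ ≡ suc c * K * Q ^ i)
          × harmonic (suc c * K ^ suc i) len ≡ harmonic (suc c * K * K ^ i) len′ ℚ.+ harmonic (suc c * K * Q ^ i) x
  split i c len eq = start , trans (cong₂ harmonic a≡ len≡)
    (trans (harmonic-+ a len′ x) (cong (λ y → harmonic a len′ ℚ.+ harmonic y x) start))
    where
    x = suc c * Q ^ i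
    a = suc c * K * K ^ i
    len′ = suc c * K * Q ^ i ∸ a
    start : a + len′ ≡ suc c * K * Q ^ i
    start = m+[n∸m]≡n (*-monoʳ-≤ (suc c * K) (^-monoˡ-≤ i (n≤1+n K)))
    a≡ : suc c * K ^ suc i ≡ a
    a≡ = sym (*-assoc (suc c) K (K ^ i))
    len≡ : len ≡ len′ + x
    len≡ = +-cancelˡ-≡ a _ _ (trans (cong (_+ len) (sym a≡)) (trans eq (trans (lemma (suc c) K (Q ^ i)) (trans (cong (_+ x) (sym start)) (+-assoc a len′ x)))))
      where
      lemma : ∀ c K q → c * (suc K * q) ≡ c * K * q + c * q
      lemma = solve-∀

  module _ (i c : ℕ) where
    x = suc c * Q ^ i
    1≤x : 1 ≤ x
    1≤x = *-mono-≤ (s≤s (z≤n {c})) (^-pos i (s≤s (z≤n {K})))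
    p = pred x
    x≡ : suc p ≡ x
    x≡ = suc-pred x {{>-nonZero 1≤x}}

    -- The `x` terms 1/(Kx+1), ..., 1/(Qx) have a sum between 1/Q and 1/K.
    step-lower : 1/suc K ℚ.≤ harmonic (suc c * K * Q ^ i) x
    step-lower = subst (ℚ._≤ harmonic (suc c * K * Q ^ i) x) (trans (cong (λ y → fromℕ y ℚ.* 1/suc (p + K * suc p)) (sym x≡)) (fromℕ-*-1/suc p K))
      (harmonic-lower (suc c * K * Q ^ i) x (≤-reflexive (trans (lemma (suc c) K (Q ^ i)) (cong (λ y → y + K * y) (sym x≡)))))
      where
      lemma : ∀ c K q → c * K * q + c * q ≡ c * q + K * (c * q)
      lemma = solve-∀

    step-upper : harmonic (suc c * K * Q ^ i) x ℚ.≤ 1/suc κ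
    step-upper = subst (harmonic (suc c * K * Q ^ i) x ℚ.≤_) (trans (cong (λ y → fromℕ y ℚ.* 1/suc (p + κ * suc p)) (sym x≡)) (fromℕ-*-1/suc p κ))
      (harmonic-upper (suc c * K * Q ^ i) x (≤-trans (n≤1+n _) (≤-reflexive (trans (cong (λ y → y + κ * y) x≡) (lemma (suc c) κ (Q ^ i))))))
      where
      lemma : ∀ c κ q → c * q + κ * (c * q) ≡ c * suc κ * q
      lemma = solve-∀

  chain-lower : ∀ i c len → suc c * K ^ i + len ≡ suc c * Q ^ i → fromℕ i ℚ.* 1/suc K ℚ.≤ harmonic (suc c * K ^ i) len
  chain-lower zero    c len eq = subst (ℚ._≤ harmonic (suc c * 1) len) (sym (ℚ.*-zeroˡ (1/suc K))) (harmonic-mono (suc c * 1) (z≤n {len}))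
  chain-lower (suc i) c len eq = let start , h = split i c len eq in subst₂ ℚ._≤_ (sym (trans (fromℕ-suc-* i (1/suc K)) (ℚ.+-comm (1/suc K) _))) (sym h)
    -- Multipliers are stored by their predecessors: `suc (κ + c * K)` is `suc c * K`.
    (ℚ.+-mono-≤ (chain-lower i (κ + c * K) _ start) (step-lower i c))

  chain-upper : ∀ i c len → suc c * K ^ i + len ≡ suc c * Q ^ i → harmonic (suc c * K ^ i) len ℚ.≤ fromℕ i ℚ.* 1/suc κ
  chain-upper zero    c len eq = subst₂ ℚ._≤_ (cong (harmonic (suc c * 1)) (sym (+-cancelˡ-≡ (suc c * 1) len 0 (trans eq (sym (+-identityʳ _))))))
    (sym (ℚ.*-zeroˡ (1/suc κ))) ℚ.≤-refl
  chain-upper (suc i) c len eq = let start , h = split i c len eq in subst₂ ℚ._≤_ (sym h) (sym (trans (fromℕ-suc-* i (1/suc κ)) (ℚ.+-comm (1/suc κ) _)))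
    (ℚ.+-mono-≤ (chain-upper i (κ + c * K) _ start) (step-upper i c))

  length-≡ : ∀ i c → suc c * K ^ i + (suc c * Q ^ i ∸ suc c * K ^ i) ≡ suc c * Q ^ i
  length-≡ i c = m+[n∸m]≡n (*-monoʳ-≤ (suc c) (^-monoˡ-≤ i (n≤1+n K)))

  logSum-lower : ∀ i c p → Q ^ i ≤ suc p * K ^ i → fromℕ i ℚ.* 1/suc K ℚ.≤ logSum (suc p) (suc c * K ^ i)
  logSum-lower i c p h = ℚ.≤-trans (chain-lower i c _ (length-≡ i c)) (harmonic-mono (suc c * K ^ i)
    (≤-trans (∸-monoˡ-≤ (suc c * K ^ i) (≤-trans (*-monoʳ-≤ (suc c) h) (≤-reflexive (lemma (suc c) p (K ^ i)))))
             (≤-reflexive (m+n∸m≡n (suc c * K ^ i) _))))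
    where
    lemma : ∀ c p x → c * (suc p * x) ≡ c * x + p * (c * x)
    lemma = solve-∀

  logSum-upper : ∀ i c p → suc p * K ^ i ≤ Q ^ i → logSum (suc p) (suc c * K ^ i) ℚ.≤ fromℕ i ℚ.* 1/suc κ
  logSum-upper i c p h = ℚ.≤-trans (harmonic-mono (suc c * K ^ i)
    (≤-trans (≤-reflexive (sym (m+n∸m≡n (suc c * K ^ i) (p * (suc c * K ^ i)))))
      (∸-monoˡ-≤ (suc c * K ^ i) (≤-trans (≤-reflexive (lemma (suc c) p (K ^ i))) (*-monoʳ-≤ (suc c) h)))))
    (chain-upper i c _ (length-≡ i c))
    where
    lemma : ∀ c p x → c * x + p * (c * x) ≡ c * (suc p * x)
    lemma = solve-∀

  -- The chain fits subdivisions into a multiple of K^i parts; as the Riemann sums increase, the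
  -- bound persists for all finer ones.
  A-lower : ∀ i p j → K ^ i ≤ suc j → Q ^ i ≤ suc p * K ^ i → fromℕ i ℚ.* 1/suc K ℚ.≤ A p j
  A-lower i p j K^i≤ h = ℚ.≤-trans (subst (λ x → fromℕ i ℚ.* 1/suc K ℚ.≤ logSum (suc p) x) (trans (*-identityˡ (K ^ i)) (sym (suc-pred (K ^ i) {{nz}}))) (logSum-lower i 0 p h))
    (subst (λ x → A p (pred (K ^ i)) ℚ.≤ A p x) (m∸n+n≡m (pred-mono-≤ K^i≤)) (A-mono p (pred (K ^ i)) (j ∸ pred (K ^ i))))
    where nz = >-nonZero (^-pos {K} i (s≤s z≤n))

  -- Refining to `suc j * K ^ i` parts, where the chain fits, only increases the sum; so the bound
  -- holds for every `j`.
  A-upper : ∀ i p j → suc p * K ^ i ≤ Q ^ i → A p j ℚ.≤ fromℕ i ℚ.* 1/suc κ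
  A-upper i p j h = ℚ.≤-trans (subst (λ x → A p j ℚ.≤ A p x) (m∸n+n≡m j≤) (A-mono p j (pred y ∸ j)))
    (subst (λ x → logSum (suc p) x ℚ.≤ fromℕ i ℚ.* 1/suc κ) (sym (suc-pred y {{>-nonZero 1≤y}})) (logSum-upper i j p h))
    where
    y = suc j * K ^ i
    1≤y : 1 ≤ y
    1≤y = *-mono-≤ (s≤s (z≤n {j})) (^-pos {K} i (s≤s z≤n))
    j≤ : j ≤ pred y
    j≤ = pred-mono-≤ (m≤m*n (suc j) (K ^ i) {{>-nonZero (^-pos {K} i (s≤s z≤n))}})

-- Clearing denominators in the ratio

p+q-q≡p : ∀ p q → p ℚ.+ q ℚ.- q ≡ p
p+q-q≡p p q = trans (ℚ.+-assoc p q (ℚ.- q)) (trans (cong (p ℚ.+_) (ℚ.+-inverseʳ q)) (ℚ.+-identityʳ p))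

p-q+q≡p : ∀ p q → p ℚ.- q ℚ.+ q ≡ p
p-q+q≡p p q = trans (ℚ.+-assoc p (ℚ.- q) q) (trans (cong (p ℚ.+_) (ℚ.+-inverseˡ q)) (ℚ.+-identityʳ p))

r+[q-r]≡q : ∀ r q → r ℚ.+ (q ℚ.- r) ≡ q
r+[q-r]≡q r q = trans (ℚ.+-comm r (q ℚ.- r)) (p-q+q≡p q r)

-- For t < r the premise is what `const r ≤ᴿ x` says with ε = r - t about a late term z of x. A
-- strict gap thus turns an inequality between reals into one between rationals.
p≤q+[r-t]⇒ : ∀ {r t z} → r ℚ.≤ z ℚ.+ (r ℚ.- t) → t ℚ.≤ z
p≤q+[r-t]⇒ {r} {t} {z} h = subst₂ ℚ._≤_ (p+q-q≡p t r) (p+q-q≡p z r) (ℚ.+-monoˡ-≤ (ℚ.- r)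
  (subst₂ ℚ._≤_ (ℚ.+-comm r t) (trans (ℚ.+-assoc z (r ℚ.- t) t) (cong (z ℚ.+_) (p-q+q≡p r t))) (ℚ.+-monoˡ-≤ t h)))

p<q⇒0<q-p : ∀ {p q} → p ℚ.< q → 0ℚ ℚ.< q ℚ.- p
p<q⇒0<q-p {p} {q} p<q = subst (ℚ._< q ℚ.- p) (ℚ.+-inverseʳ p) (ℚ.+-monoˡ-< (ℚ.- p) p<q)

*-recip-cancel : ∀ x y → 0ℚ ℚ.< y → x ℚ.* recip y ℚ.* y ≡ x
*-recip-cancel x y 0<y = trans (ℚ.*-assoc x (recip y) y) (trans (cong (x ℚ.*_) (trans (ℚ.*-comm (recip y) y) (*-recip y 0<y))) (ℚ.*-identityʳ x))

regroup : ∀ R Q s y i v → R ℚ.* Q ℚ.* (s ℚ.* (y ℚ.* (i ℚ.* v))) ≡ R ℚ.* s ℚ.* (y ℚ.* i) ℚ.* (Q ℚ.* v)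
regroup R Q s y i v = trans (cong (R ℚ.* Q ℚ.*_) (trans (cong (s ℚ.*_) (sym (ℚ.*-assoc y i v))) (sym (ℚ.*-assoc s (y ℚ.* i) v))))
  (trans (ℚ-interchange R Q (s ℚ.* (y ℚ.* i)) v)
  (cong (ℚ._* (Q ℚ.* v)) (sym (ℚ.*-assoc R s (y ℚ.* i)))))

*-nonNeg : ∀ {a b} → 0ℚ ℚ.≤ a → 0ℚ ℚ.≤ b → 0ℚ ℚ.≤ a ℚ.* b
*-nonNeg {a} {b} 0≤a 0≤b = subst (ℚ._≤ a ℚ.* b) (ℚ.*-zeroˡ 0ℚ) (*-mono-nonNeg ℚ.≤-refl 0≤b 0≤a 0≤b)

*-monoʳ : ∀ {c p q} → 0ℚ ℚ.≤ c → p ℚ.≤ q → p ℚ.* c ℚ.≤ q ℚ.* c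
*-monoʳ {c} 0≤c = ℚ.*-monoʳ-≤-nonNeg c {{ℚ.nonNegative 0≤c}}

-- The chain (1 + 1/R)(Y i/Q) ≤ q Y L ≤ X, multiplied by RQ. In the application X = k²n, Y = m, and
-- `L` is a term of the sequence for log n.
ratio-lower⇒ : ∀ X Y i ρ K {q r L z} → 0ℚ ℚ.< fromℕ Y → 0ℚ ℚ.< L → z ≡ fromℕ X ℚ.* recip (fromℕ Y ℚ.* L) →
  r ℚ.≤ z ℚ.+ (r ℚ.- q) → 1ℚ ℚ.+ 1/suc ρ ℚ.≤ q → fromℕ i ℚ.* 1/suc K ℚ.≤ L →
  suc (suc ρ) * (Y * i) ≤ suc ρ * (suc K * X)
ratio-lower⇒ X Y i ρ K {q} {r} {L} {z} 0<Y 0<L z≡ r≤ 1+1/R≤q i/Q≤L = fromℕ-cancel-≤ (begin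
  fromℕ (suc (suc ρ) * (Y * i))                        ≡⟨ trans (fromℕ-* (suc (suc ρ)) (Y * i)) (cong₂ ℚ._*_ (fromℕ-suc (suc ρ)) (fromℕ-* Y i)) ⟩
  (1ℚ ℚ.+ R) ℚ.* (y ℚ.* fromℕ i)                       ≡⟨ scale ⟩
  R ℚ.* Q ℚ.* ((1ℚ ℚ.+ 1/suc ρ) ℚ.* (y ℚ.* (fromℕ i ℚ.* 1/suc K)))
                                                       ≤⟨ *-monoˡ (*-nonNeg (fromℕ-nonNeg (suc ρ)) (fromℕ-nonNeg (suc K))) main ⟩
  R ℚ.* Q ℚ.* fromℕ X                                  ≡⟨ trans (ℚ.*-assoc R Q (fromℕ X)) (trans (cong (R ℚ.*_) (sym (fromℕ-* (suc K) X))) (sym (fromℕ-* (suc ρ) (suc K * X)))) ⟩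
  fromℕ (suc ρ * (suc K * X))                          ∎)
  where
  open ℚ.≤-Reasoning
  R = fromℕ (suc ρ)
  Q = fromℕ (suc K)
  y = fromℕ Y
  d = y ℚ.* L
  0<d : 0ℚ ℚ.< d
  0<d = *-pos 0<Y 0<L
  0≤1+1/R : 0ℚ ℚ.≤ 1ℚ ℚ.+ 1/suc ρ
  0≤1+1/R = ℚ.+-mono-≤ (ℚ.<⇒≤ (ℚ.positive⁻¹ 1ℚ)) (ℚ.<⇒≤ (0<1/suc ρ))
  main : (1ℚ ℚ.+ 1/suc ρ) ℚ.* (y ℚ.* (fromℕ i ℚ.* 1/suc K)) ℚ.≤ fromℕ X
  main = begin
    (1ℚ ℚ.+ 1/suc ρ) ℚ.* (y ℚ.* (fromℕ i ℚ.* 1/suc K))  ≤⟨ *-mono-nonNeg 0≤1+1/R (ℚ.<⇒≤ 0<d) 1+1/R≤q (*-monoˡ (ℚ.<⇒≤ 0<Y) i/Q≤L) ⟩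
    q ℚ.* d                                            ≤⟨ *-monoʳ (ℚ.<⇒≤ 0<d) (p≤q+[r-t]⇒ {r} {q} {z} r≤) ⟩
    z ℚ.* d                                            ≡⟨ cong (ℚ._* d) z≡ ⟩
    fromℕ X ℚ.* recip d ℚ.* d                          ≡⟨ *-recip-cancel (fromℕ X) d 0<d ⟩
    fromℕ X                                            ∎
  scale : (1ℚ ℚ.+ R) ℚ.* (y ℚ.* fromℕ i) ≡ R ℚ.* Q ℚ.* ((1ℚ ℚ.+ 1/suc ρ) ℚ.* (y ℚ.* (fromℕ i ℚ.* 1/suc K)))
  scale = sym (trans (regroup R Q (1ℚ ℚ.+ 1/suc ρ) y (fromℕ i) (1/suc K))
    (trans (cong₂ (λ a b → a ℚ.* (y ℚ.* fromℕ i) ℚ.* b) R[1+1/R] (fromℕ-*-1/suc≡1 K))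
           (ℚ.*-identityʳ ((1ℚ ℚ.+ R) ℚ.* (y ℚ.* fromℕ i)))))
    where
    R[1+1/R] : R ℚ.* (1ℚ ℚ.+ 1/suc ρ) ≡ 1ℚ ℚ.+ R
    R[1+1/R] = trans (ℚ.*-distribˡ-+ R 1ℚ (1/suc ρ)) (trans (cong₂ ℚ._+_ (ℚ.*-identityʳ R) (fromℕ-*-1/suc≡1 ρ)) (ℚ.+-comm R 1ℚ))

ratio-upper⇒ : ∀ X Y i ρ κ {q r L z} → 0ℚ ℚ.< fromℕ Y → 0ℚ ℚ.< L → z ≡ fromℕ X ℚ.* recip (fromℕ Y ℚ.* L) →
  z ℚ.≤ r ℚ.+ (q ℚ.- r) → q ℚ.+ 1/suc ρ ℚ.≤ 1ℚ → L ℚ.≤ fromℕ i ℚ.* 1/suc κ →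
  suc ρ * (suc κ * X) ≤ ρ * (Y * i)
ratio-upper⇒ X Y i ρ κ {q} {r} {L} {z} 0<Y 0<L z≡ ≤r q+1/R≤1 L≤i/K = fromℕ-cancel-≤ (begin
  fromℕ (suc ρ * (suc κ * X))                          ≡⟨ trans (fromℕ-* (suc ρ) (suc κ * X)) (cong (R ℚ.*_) (fromℕ-* (suc κ) X)) ⟩
  R ℚ.* (K ℚ.* fromℕ X)                                ≡⟨ ℚ.*-assoc R K (fromℕ X) ⟨
  R ℚ.* K ℚ.* fromℕ X                                  ≤⟨ *-monoˡ (*-nonNeg (fromℕ-nonNeg (suc ρ)) (fromℕ-nonNeg (suc κ))) main ⟩
  R ℚ.* K ℚ.* ((1ℚ ℚ.- 1/suc ρ) ℚ.* (y ℚ.* (fromℕ i ℚ.* 1/suc κ)))  ≡⟨ scale ⟩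
  fromℕ ρ ℚ.* (y ℚ.* fromℕ i)                          ≡⟨ trans (fromℕ-* ρ (Y * i)) (cong (fromℕ ρ ℚ.*_) (fromℕ-* Y i)) ⟨
  fromℕ (ρ * (Y * i))                                  ∎)
  where
  open ℚ.≤-Reasoning
  R = fromℕ (suc ρ)
  K = fromℕ (suc κ)
  y = fromℕ Y
  d = y ℚ.* L
  0<d : 0ℚ ℚ.< d
  0<d = *-pos 0<Y 0<L
  q≤ : q ℚ.≤ 1ℚ ℚ.- 1/suc ρ
  q≤ = subst (ℚ._≤ 1ℚ ℚ.- 1/suc ρ) (p+q-q≡p q (1/suc ρ)) (ℚ.+-monoˡ-≤ (ℚ.- 1/suc ρ) q+1/R≤1)
  0≤1-1/R : 0ℚ ℚ.≤ 1ℚ ℚ.- 1/suc ρ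
  0≤1-1/R = 0≤q-p {1/suc ρ} {1ℚ} (1/suc-anti {0} {ρ} z≤n)
  main : fromℕ X ℚ.≤ (1ℚ ℚ.- 1/suc ρ) ℚ.* (y ℚ.* (fromℕ i ℚ.* 1/suc κ))
  main = begin
    fromℕ X                                             ≡⟨ *-recip-cancel (fromℕ X) d 0<d ⟨
    fromℕ X ℚ.* recip d ℚ.* d                           ≡⟨ cong (ℚ._* d) z≡ ⟨
    z ℚ.* d                                             ≤⟨ *-monoʳ (ℚ.<⇒≤ 0<d) (ℚ.≤-trans ≤r (ℚ.≤-reflexive (r+[q-r]≡q r q))) ⟩
    q ℚ.* d                                             ≤⟨ *-monoʳ (ℚ.<⇒≤ 0<d) q≤ ⟩
    (1ℚ ℚ.- 1/suc ρ) ℚ.* d                              ≤⟨ *-monoˡ 0≤1-1/R (*-monoˡ (ℚ.<⇒≤ 0<Y) L≤i/K) ⟩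
    (1ℚ ℚ.- 1/suc ρ) ℚ.* (y ℚ.* (fromℕ i ℚ.* 1/suc κ))  ∎
  scale : R ℚ.* K ℚ.* ((1ℚ ℚ.- 1/suc ρ) ℚ.* (y ℚ.* (fromℕ i ℚ.* 1/suc κ))) ≡ fromℕ ρ ℚ.* (y ℚ.* fromℕ i)
  scale = trans (regroup R K (1ℚ ℚ.- 1/suc ρ) y (fromℕ i) (1/suc κ))
    (trans (cong₂ (λ a b → a ℚ.* (y ℚ.* fromℕ i) ℚ.* b) R[1-1/R] (fromℕ-*-1/suc≡1 κ))
           (ℚ.*-identityʳ (fromℕ ρ ℚ.* (y ℚ.* fromℕ i))))
    where
    R[1-1/R] : R ℚ.* (1ℚ ℚ.- 1/suc ρ) ≡ fromℕ ρ
    R[1-1/R] = trans (ℚ.*-distribˡ-+ R 1ℚ (ℚ.- 1/suc ρ))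
      (trans (cong₂ ℚ._+_ (trans (ℚ.*-identityʳ R) (trans (fromℕ-suc ρ) (ℚ.+-comm 1ℚ (fromℕ ρ))))
                          (trans (sym (ℚ.neg-distribʳ-* R (1/suc ρ))) (cong (ℚ.-_) (fromℕ-*-1/suc≡1 ρ))))
             (p+q-q≡p (fromℕ ρ) 1ℚ))

module Ratio (k m : ℕ → ℕ) (n≤m : ∀ n → n ≤ m n) where

  module Term (n′ : ℕ) where
    ν = 2 + n′
    X = k ν * k ν * ν

    0<m : 0ℚ ℚ.< fromℕ (m ν)
    0<m = fromℕ-pos (≤-trans (s≤s z≤n) (n≤m ν))

    0<A : ∀ j → 0ℚ ℚ.< A (suc n′) j
    0<A j = ℚ.<-≤-trans (proj₁ (proj₂ (log-pos n′))) (proj₂ (proj₂ (proj₂ (log-pos n′))) j z≤n)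

    seq-ratio : ∀ j → seq (ratio k m n≤m n′) j ≡ fromℕ X ℚ.* recip (fromℕ (m ν) ℚ.* A (suc n′) j)
    seq-ratio j = refl

    dense : ∀ {r q} ρ → q ℚ.< r → 1ℚ ℚ.+ 1/suc ρ ℚ.≤ q → const r ≤ᴿ ratio k m n≤m n′ →
            ∀ K i → 1 ≤ K → suc K ^ i ≤ ν * K ^ i → suc (suc ρ) * (m ν * i) ≤ suc ρ * (suc K * X)
    dense {r} {q} ρ q<r 1+1/R≤q r≤ K@(suc κ) i 1≤K h =
      let J , close = r≤ (r ℚ.- q) (p<q⇒0<q-p q<r)
          -- Late enough both for the inequality between reals and for `A-lower`.
          j = J ⊔ K ^ i
      in ratio-lower⇒ X (m ν) i ρ K {q} {r} {z = seq (ratio k m n≤m n′) j} 0<m (0<A j) (seq-ratio j)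
        (close j (m≤m⊔n J (K ^ i))) 1+1/R≤q (GeometricChain.A-lower κ i (suc n′) j (m≤n⇒m≤1+n (m≤n⊔m J (K ^ i))) h)

    sparse : ∀ {r q} ρ → r ℚ.< q → q ℚ.+ 1/suc ρ ℚ.≤ 1ℚ → ratio k m n≤m n′ ≤ᴿ const r →
             ∀ K i → 1 ≤ K → ν * K ^ i ≤ suc K ^ i → suc ρ * (K * X) ≤ ρ * (m ν * i)
    sparse {r} {q} ρ r<q q+1/R≤1 ≤r (suc κ) i 1≤K h =
      let J , close = ≤r (q ℚ.- r) (p<q⇒0<q-p r<q)
      in ratio-upper⇒ X (m ν) i ρ κ {q} {r} {z = seq (ratio k m n≤m n′) J} 0<m (0<A J) (seq-ratio J)
        (close J ≤-refl) q+1/R≤1 (GeometricChain.A-upper κ i (suc n′) J h)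

  -- `ratio` begins with n = 2, so the index N + j belongs to n = 2 + (N + j).
  from-index : ∀ N (P : ℕ → Set) → (∀ j → P (2 + (N + j))) → ∀ n → 2 + N ≤ n → P n
  from-index N P h n le = subst P (m+[n∸m]≡n le) (h (n ∸ (2 + N)))

  eventually-dense : 1ℚ <liminf ratio k m n≤m → ∃[ R ] 1 ≤ R × ∃[ N ] ∀ n → N ≤ n → ∀ K i → 1 ≤ K →
    suc K ^ i ≤ n * K ^ i → suc R * (m n * i) ≤ R * (suc K * (k n * k n * n))
  eventually-dense (N , r , 1<r , r≤) =
    -- The intermediate `q` leaves two gaps: q < r provides the ε for `_≤ᴿ_`, and 1 < q provides
    -- 1/R.
    let q , 1<q , q<r = ℚ.<-dense 1<r
        ρ , small = archimedean (q ℚ.- 1ℚ) (p<q⇒0<q-p 1<q)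
    in suc ρ , s≤s z≤n , 2 + N , from-index N
    (λ n → ∀ K i → 1 ≤ K → suc K ^ i ≤ n * K ^ i → suc (suc ρ) * (m n * i) ≤ suc ρ * (suc K * (k n * k n * n)))
    λ j → Term.dense (N + j) ρ q<r (subst (1ℚ ℚ.+ 1/suc ρ ℚ.≤_) (r+[q-r]≡q 1ℚ q) (ℚ.+-monoʳ-≤ 1ℚ (ℚ.<⇒≤ small))) (r≤ j)

  eventually-sparse : limsup ratio k m n≤m < 1ℚ → ∃[ R ] ∃[ N ] ∀ n → N ≤ n → ∀ K i → 1 ≤ K →
    n * K ^ i ≤ suc K ^ i → suc R * (K * (k n * k n * n)) ≤ R * (m n * i)
  eventually-sparse (N , r , r<1 , ≤r) =
    let q , r<q , q<1 = ℚ.<-dense r<1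
        ρ , small = archimedean (1ℚ ℚ.- q) (p<q⇒0<q-p q<1)
    in ρ , 2 + N , from-index N
    (λ n → ∀ K i → 1 ≤ K → n * K ^ i ≤ suc K ^ i → suc ρ * (K * (k n * k n * n)) ≤ ρ * (m n * i))
    λ j → Term.sparse (N + j) ρ r<q (subst (q ℚ.+ 1/suc ρ ℚ.≤_) (r+[q-r]≡q q 1ℚ) (ℚ.+-monoʳ-≤ q (ℚ.<⇒≤ small))) (≤r j)

-- From counts to probabilities

proportion-suc : ∀ a t → proportion a (suc t) ≡ fromℕ a ℚ.* 1/suc t
proportion-suc a t = ℚ.toℚᵘ-injective (begin-equality
  toℚᵘ (proportion a (suc t))                       ≃⟨ ℚ.toℚᵘ-fromℚᵘ (ℚᵘ.mkℚᵘ (ℤ.+ a) t) ⟩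
  ℚᵘ.mkℚᵘ (ℤ.+ a) t                                 ≃⟨ ℚᵘ.*≡* (cong₂ ℤ._*_ (sym (ℤ.*-identityʳ (ℤ.+ a))) (cong (λ x → ℤ.+ suc x) (+-identityʳ t))) ⟩
  ℚᵘ.mkℚᵘ (ℤ.+ a) 0 ℚᵘ.* ℚᵘ.mkℚᵘ (ℤ.+ 1) t          ≃⟨ ℚᵘ.*-cong (toℚᵘ-fromℕ a) (ℚ.toℚᵘ-fromℚᵘ (ℚᵘ.mkℚᵘ (ℤ.+ 1) t)) ⟨
  toℚᵘ (fromℕ a) ℚᵘ.* toℚᵘ (1/suc t)                ≃⟨ ℚ.toℚᵘ-homo-* (fromℕ a) (1/suc t) ⟨
  toℚᵘ (fromℕ a ℚ.* 1/suc t)                        ∎)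
  where open ℚᵘ.≤-Reasoning

-- The distance to 1 is b/T, and D b ≤ T for every `D` eventually puts it below any ε; this is the
-- form in which both counting arguments deliver their bounds.
proportion⟶1 : (g b T : ℕ → ℕ) → (∀ n → g n + b n ≡ T n) →
               (∀ D → ∃[ N ] ∀ n → N ≤ n → 1 ≤ T n × D * b n ≤ T n) → (λ n → proportion (g n) (T n)) ⟶ 1ℚ
proportion⟶1 g b T total rare ε 0<ε with archimedean ε 0<ε
... | d , 1/d<ε with rare (suc d)
...   | N , h = N , λ n N≤n → close (g n) (b n) (T n) (total n) (proj₁ (h n N≤n)) (proj₂ (h n N≤n))
  where
  open ℚ.≤-Reasoning
  close : ∀ g b T → g + b ≡ T → 1 ≤ T → suc d * b ≤ T → ℚ.∣ proportion g T ℚ.- 1ℚ ∣ ℚ.< ε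
  close g b T@(suc t) g+b≡T _ db≤T = begin-strict
    ℚ.∣ proportion g T ℚ.- 1ℚ ∣                       ≡⟨ ∣p-q∣≡∣q-p∣ (proportion g T) 1ℚ ⟩
    ℚ.∣ 1ℚ ℚ.- proportion g T ∣                       ≡⟨ cong ℚ.∣_∣ complement ⟩
    ℚ.∣ fromℕ b ℚ.* u ∣                               ≡⟨ ℚ.0≤p⇒∣p∣≡p 0≤bu ⟩
    fromℕ b ℚ.* u                                     ≡⟨ cong (ℚ._* u) (trans (sym (ℚ.*-identityˡ (fromℕ b))) (cong (ℚ._* fromℕ b) (trans (sym (fromℕ-*-1/suc≡1 d)) (ℚ.*-comm (fromℕ (suc d)) v)))) ⟩
    v ℚ.* fromℕ (suc d) ℚ.* fromℕ b ℚ.* u             ≡⟨ trans (ℚ.*-assoc (v ℚ.* fromℕ (suc d)) (fromℕ b) u) (trans (ℚ.*-assoc v (fromℕ (suc d)) (fromℕ b ℚ.* u)) (cong (v ℚ.*_) (sym (ℚ.*-assoc (fromℕ (suc d)) (fromℕ b) u)))) ⟩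
    v ℚ.* (fromℕ (suc d) ℚ.* fromℕ b ℚ.* u)           ≡⟨ cong (λ x → v ℚ.* (x ℚ.* u)) (fromℕ-* (suc d) b) ⟨
    v ℚ.* (fromℕ (suc d * b) ℚ.* u)                   ≤⟨ *-monoˡ (ℚ.<⇒≤ (0<1/suc d)) (ℚ.*-monoʳ-≤-nonNeg u {{ℚ.nonNegative 0≤u}} (fromℕ-mono-≤ db≤T)) ⟩
    v ℚ.* (fromℕ T ℚ.* u)                             ≡⟨ trans (cong (v ℚ.*_) (fromℕ-*-1/suc≡1 t)) (ℚ.*-identityʳ v) ⟩
    v                                                 <⟨ 1/d<ε ⟩
    ε                                                 ∎
    where
    u = 1/suc t
    v = 1/suc d
    0≤u : 0ℚ ℚ.≤ u
    0≤u = ℚ.<⇒≤ (0<1/suc t)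
    0≤bu : 0ℚ ℚ.≤ fromℕ b ℚ.* u
    0≤bu = subst (ℚ._≤ fromℕ b ℚ.* u) (ℚ.*-zeroˡ u) (ℚ.*-monoʳ-≤-nonNeg u {{ℚ.nonNegative 0≤u}} (fromℕ-nonNeg b))
    complement : 1ℚ ℚ.- proportion g T ≡ fromℕ b ℚ.* u
    complement = trans (cong₂ ℚ._-_ (sym (trans (cong (λ x → fromℕ x ℚ.* u) g+b≡T) (fromℕ-*-1/suc≡1 t))) (proportion-suc g t))
      (trans (cong (λ x → x ℚ.* u ℚ.- fromℕ g ℚ.* u) (fromℕ-+ g b))
        (trans (cong (ℚ._- fromℕ g ℚ.* u) (trans (ℚ.*-distribʳ-+ u (fromℕ g) (fromℕ b)) (ℚ.+-comm (fromℕ g ℚ.* u) (fromℕ b ℚ.* u))))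
          (p+q-q≡p (fromℕ b ℚ.* u) (fromℕ g ℚ.* u))))

length-filter-¬ : ∀ {A : Set} {P : Pred A 0ℓ} (P? : Decidable P) xs →
                  length (filter P? xs) + length (filter (¬? ∘ P?) xs) ≡ length xs
length-filter-¬ P? []       = refl
length-filter-¬ P? (x ∷ xs) with P? x
... | yes _ = cong suc (length-filter-¬ P? xs)
... | no _  = trans (+-suc _ _) (cong suc (length-filter-¬ P? xs))

module Assembly (k m : ℕ → ℕ) (1≤k : ∀ n → 1 ≤ n → 1 ≤ k n) (k≤m : ∀ n → 1 ≤ n → k n ≤ m n) (n≤m : ∀ n → n ≤ m n) where

  space : ∀ n → List (Vec (Subset (m n)) n)
  space n = assignments n (m n) (k n)

  1≤space : ∀ n → 1 ≤ n → 1 ≤ length (space n)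
  1≤space n 1≤n = subst (1 ≤_) (sym (length-assignments n (m n) (k n))) (^-pos n (1≤binom (k≤m n 1≤n)))

  disconnected⟶0 : 1ℚ <liminf ratio k m n≤m → ∀ D → ∃[ N ] ∀ n → N ≤ n →
                   1 ≤ length (space n) × D * disconnected n (m n) (k n) ≤ length (space n)
  disconnected⟶0 h D =
    let R , 1≤R , N₁ , dense = Ratio.eventually-dense k m n≤m h
        N₂ , rare = disconnected-rare R D 1≤R
    in suc (N₁ + N₂) , λ n N≤n → let 1≤n = ≤-trans (s≤s z≤n) N≤n in
      1≤space n 1≤n , ≤-trans
        (rare n (m n) (k n) (≤-trans (m≤n⇒m≤1+n (m≤n+m N₂ N₁)) N≤n) (n≤m n) (k≤m n 1≤n)
          λ i → dense n (≤-trans (m≤n⇒m≤1+n (m≤m+n N₁ N₂)) N≤n) (5 + 6 * R) i (s≤s z≤n))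
        (≤-reflexive (sym (length-assignments n (m n) (k n))))

  connected⟶0 : limsup ratio k m n≤m < 1ℚ → ∀ D → ∃[ N ] ∀ n → N ≤ n →
                1 ≤ length (space n) × D * connected n (m n) (k n) ≤ length (space n)
  connected⟶0 h D =
    let R , N₁ , sparse = Ratio.eventually-sparse k m n≤m h
        N₂ , rare = connected-rare R D
    in suc (N₁ + N₂) , λ n N≤n → let 1≤n = ≤-trans (s≤s z≤n) N≤n in
      1≤space n 1≤n , ≤-trans
        (rare n (m n) (k n) (≤-trans (m≤n⇒m≤1+n (m≤n+m N₂ N₁)) N≤n) (n≤m n) (1≤k n 1≤n)
          λ i → sparse n (≤-trans (m≤n⇒m≤1+n (m≤m+n N₁ N₂)) N≤n) (2 * suc R) i (s≤s z≤n))
        (≤-reflexive (sym (length-assignments n (m n) (k n))))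

  -- The complement of the event `∁ Connected` is a double negation, which decidability brings back
  -- to `Connected`.
  length-¬¬connected : ∀ n → length (filter (¬? ∘ ∁? connected?) (space n)) ≤ connected n (m n) (k n)
  length-¬¬connected n = ≤-trans
    (length-filter-≤ (¬? ∘ ∁? connected?) (space n) {𝟙 ∘ connected?} λ F _ ¬¬c → ≤-reflexive (sym (𝟙-yes (connected? F) (decidable-stable (connected? F) ¬¬c))))
    (≤-reflexive (sym (length-filter connected? (space n))))

  above : 1ℚ <liminf ratio k m n≤m → AAS k m Connected connected?
  above h = proportion⟶1 (λ n → connected n (m n) (k n)) (λ n → disconnected n (m n) (k n)) (λ n → length (space n))
    (λ n → length-filter-¬ connected? (space n)) (disconnected⟶0 h)

  below : limsup ratio k m n≤m < 1ℚ → AAS k m (∁ Connected) (∁? connected?)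
  below h = proportion⟶1 (λ n → length (filter (∁? connected?) (space n))) (λ n → length (filter (¬? ∘ ∁? connected?) (space n))) (λ n → length (space n))
    (λ n → length-filter-¬ (∁? connected?) (space n)) λ D → let N , rare = connected⟶0 h D in
      N , λ n N≤n → proj₁ (rare n N≤n) , ≤-trans (*-monoʳ-≤ D (length-¬¬connected n)) (proj₂ (rare n N≤n))

theorem5 : (k m : ℕ → ℕ) →
    (∀ n → 1 ≤ n → 1 ≤ k n) →
    (∀ n → 1 ≤ n → k n ≤ m n) →
    (n≤m : ∀ n → n ≤ m n) →
    (1ℚ <liminf ratio k m n≤m → AAS k m Connected connected?) ×
    (limsup ratio k m n≤m < 1ℚ → AAS k m (∁ Connected) (∁? connected?))
theorem5 k m 1≤k k≤m n≤m = Assembly.above k m 1≤k k≤m n≤m , Assembly.below k m 1≤k k≤m n≤m
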